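{- Let $q$ be a prime power. If $\mathrm{PGL}_2(q)$ is (isomorphic to) the full automorphism group of an abstract regular polytope $\mathcal P$ of rank $n\ge 4$, then $n=4$, $q=5$, and $\mathcal P$ is the $4$-simplex $\{3,3,3\}$. Equivalently, if $(G,\{\rho_0,\dots,\rho_{n-1}\})$ is a string C-group of rank $n\ge 4$ with $G\cong\mathrm{PGL}_2(q)$, then $n=4$, $q=5$, and $G\cong S_5$ with the generators acting as in the natural representation of $S_5$ as the automorphism group of the $4$-simplex (i.e. $\rho_i$ correspond to the transpositions $(i+1\ i+2)$ up to isomorphism of C-groups).
   Context: An (abstract) polytope of rank $n$ is a ranked partially ordered set with faces of ranks $-1,0,\dots,n$, with a unique least face and a unique greatest face, in which every flag (maximal chain) contains exactly one face of each rank, which is strongly flag-connected, and which is thin: for every flag and every $j=0,\dots,n-1$ there is exactly one other flag differing from it only in the face of rank $j$. It is regular if its automorphism group acts transitively on flags. A string C-group of rank $n$ is a group generated by $n$ pairwise distinct involutions $\rho_0,\dots,\rho_{n-1}$ with $(\rho_j\rho_k)^2=1$ whenever $|j-k|\ge2$ and the intersection property $\langle \rho_j : j\in J\rangle\cap\langle \rho_j : j\in K\rangle=\langle \rho_j : j\in J\cap K\rangle$ for all $J,K\subseteq\{0,\dots,n-1\}$; automorphism groups of regular $n$-polytopes (with generators mapping a base flag to its adjacent flags) are exactly the string C-groups of rank $n$, and each string C-group determines a unique regular polytope. The $4$-simplex has Schläfli type $\{3,3,3\}$ and automorphism group $S_5\cong\mathrm{PGL}_2(5)$. -}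

module Defs where

open import Level using (Level; _⊔_)
open import Data.Nat using (ℕ; _≥_)
open import Data.Fin using (Fin; toℕ; zero; suc; inject₁)
open import Data.Fin.Subset using (Subset; _∈_; _∩_)
open import Data.Fin.Permutation using (Permutation′; transpose)
open import Data.List using (List; []; _∷_)
open import Data.List.Relation.Unary.All using (All)
open import Data.Product using (Σ; ∃; _×_; _,_; proj₁)
open import Relation.Nullary using (¬_)
open import Data.Sum using (_⊎_)
import Data.Nat
import Data.Fin.Subset
open import Relation.Binary.PropositionalEquality using (_≡_; _≢_)
open import Algebra.Bundles using (Group)
open import Algebra.Structures using (IsCommutativeRing)
open import Function.Bundles using (_↔_; Inverse)

record FiniteField (q : ℕ) : Set₁ where
  field
    Carrier : Set
    _+_ _*_ : Carrier → Carrier → Carrier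
    -_      : Carrier → Carrier
    0# 1#   : Carrier
    isCommutativeRing : IsCommutativeRing _≡_ _+_ _*_ -_ 0# 1#
    0≢1     : 0# ≢ 1#
    inverse : ∀ x → x ≢ 0# → Σ Carrier λ y → x * y ≡ 1#
    enumeration : Fin q ↔ Carrier

module Matrices {q : ℕ} (F : FiniteField q) where
  open FiniteField F

  record M₂ : Set where
    constructor mat
    field a b c d : Carrier

  det : M₂ → Carrier
  det (mat a b c d) = (a * d) + (- (b * c))

  _·_ : M₂ → M₂ → M₂
  mat a b c d · mat a' b' c' d' =
    mat ((a * a') + (b * c')) ((a * b') + (b * d'))
        ((c * a') + (d * c')) ((c * b') + (d * d'))

  scale : Carrier → M₂ → M₂
  scale λ' (mat a b c d) = mat (λ' * a) (λ' * b) (λ' * c) (λ' * d)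

  GL₂ : Set
  GL₂ = Σ M₂ λ A → det A ≢ 0#

  gmul : GL₂ → GL₂ → M₂
  gmul (A , _) (B , _) = A · B

  -- equality in PGL₂(F): equal up to a nonzero scalar
  _∼_ : M₂ → M₂ → Set
  A ∼ B = Σ Carrier λ λ' → (λ' ≢ 0#) × (scale λ' A ≡ B)

  record IsoPGL₂ {c ℓ : Level} (G : Group c ℓ) : Set (c ⊔ ℓ) where
    open Group G renaming (Carrier to |G|)
    field
      φ        : |G| → GL₂
      φ-cong   : ∀ {x y} → x ≈ y → proj₁ (φ x) ∼ proj₁ (φ y)
      φ-hom    : ∀ x y → proj₁ (φ (x ∙ y)) ∼ gmul (φ x) (φ y)
      φ-inj    : ∀ x y → proj₁ (φ x) ∼ proj₁ (φ y) → x ≈ y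
      φ-surj   : ∀ (A : GL₂) → Σ |G| λ x → proj₁ (φ x) ∼ proj₁ A

module _ {c ℓ : Level} (G : Group c ℓ) where
  open Group G renaming (Carrier to |G|)

  evalWord : {n : ℕ} → (Fin n → |G|) → List (Fin n) → |G|
  evalWord ρ []      = ε
  evalWord ρ (i ∷ w) = ρ i ∙ evalWord ρ w

  InSubgroup : {n : ℕ} → (Fin n → |G|) → Subset n → |G| → Set ℓ
  InSubgroup ρ J g = ∃ λ (w : List (Fin _)) → All (_∈ J) w × (g ≈ evalWord ρ w)

  FarApart : {n : ℕ} → Fin n → Fin n → Set
  FarApart i j = (toℕ i ≥ Data.Nat.suc (Data.Nat.suc (toℕ j)))
               ⊎ (toℕ j ≥ Data.Nat.suc (Data.Nat.suc (toℕ i)))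

  record IsStringCGroup (n : ℕ) (ρ : Fin n → |G|) : Set (c ⊔ ℓ) where
    field
      generates    : ∀ g → InSubgroup ρ (Data.Fin.Subset.⊤) g
      involution   : ∀ i → ρ i ∙ ρ i ≈ ε
      nontrivial   : ∀ i → ¬ (ρ i ≈ ε)
      distinct     : ∀ i j → i ≢ j → ¬ (ρ i ≈ ρ j)
      string       : ∀ i j → FarApart i j → (ρ i ∙ ρ j) ∙ (ρ i ∙ ρ j) ≈ ε
      intersection : ∀ (J K : Subset n) g →
                     InSubgroup ρ J g → InSubgroup ρ K g → InSubgroup ρ (J ∩ K) g

  -- (G, ρ) is isomorphic, as a C-group, to S₅ with generators the
  -- transpositions (1 2), (2 3), (3 4), (4 5) (points labelled 0..4 here:
  -- ρ_i ↦ (i  i+1)), i.e. the automorphism group of the 4-simplex {3,3,3}.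
  record IsoSimplex (ρ : Fin 4 → |G|) : Set (c ⊔ ℓ) where
    field
      ψ      : |G| → Permutation′ 5
      ψ-cong : ∀ {x y} → x ≈ y → ∀ p → Inverse.to (ψ x) p ≡ Inverse.to (ψ y) p
      ψ-hom  : ∀ x y p → Inverse.to (ψ (x ∙ y)) p ≡ Inverse.to (ψ x) (Inverse.to (ψ y) p)
      ψ-inj  : ∀ x y → (∀ p → Inverse.to (ψ x) p ≡ Inverse.to (ψ y) p) → x ≈ y
      ψ-surj : ∀ (σ : Permutation′ 5) → Σ |G| λ x → ∀ p → Inverse.to (ψ x) p ≡ Inverse.to σ p
      ψ-gens : ∀ (i : Fin 4) p →
               Inverse.to (ψ (ρ i)) p ≡ Inverse.to (transpose (inject₁ i) (suc i)) p

{-# OPTIONS --safe #-}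
-- For q even, commuting is an equivalence relation on the involutions of PGL₂(q), which would make G abelian.
--
-- For q odd, every involution x is the involution of a unique maximal torus T x, of index 2 in its centralizer, and
-- distinct tori meet trivially.  If n ≥ 5, then ρ₀ρ₁ lies in the tori of both ρ₃ and ρ₄, so ρ₃ = ρ₄.  Let n = 4 and
-- H = ⟨ρ₀ , ρ₁ , ρ₂⟩; by the intersection property ρ₃ ∉ H, so ρ₀ρ₁, which lies in the torus of ρ₃, has odd order.
-- As G contains elements of nonsquare determinant, the Klein group {1 , ρ₀ , ρ₂ , ρ₀ρ₂} contains involutions of square
-- and of nonsquare determinant.  Together with ρ₃ they give three classes of tori of H, and counting elements shows
-- that the orders d of the tori satisfy 1/d₀ + 1/d₁ + 1/d₂ > 1.  Since two involutions of different determinant class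
-- have a product of even order, d₁ = d₂ = 2 is impossible; this leaves d₀ = 3 and forces (ρ₀ρ₁)³ = 1 and, if ρ₂ has
-- nonsquare determinant, (ρ₀ρ₁ρ₂)⁴ = 1.  Dually (ρ₂ρ₃)³ = 1, and (ρ₃ρ₂ρ₁)⁴ = 1 if ρ₁ has nonsquare determinant.
-- A trace computation turns these relations into 5 = 0 in F and (ρ₁ρ₂)³ = 1.  So the Coxeter relations of S₅ hold,
-- the intersection property makes G isomorphic to S₅, and |G| = 120 leaves only q = 5.
module Submission where

open import Defs
open import Level using (Level; 0ℓ; _⊔_; Lift; lift) renaming (suc to lsuc)
open import Algebra.Bundles using (Group; CommutativeRing)
import Algebra.Properties.AbelianGroup
import Algebra.Properties.Group
import Algebra.Properties.Monoid.Mult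
import Algebra.Properties.Ring
import Algebra.Properties.Semiring.Mult.TCOptimised
import Algebra.Solver.Ring
open import Algebra.Solver.Ring.AlmostCommutativeRing using (fromCommutativeRing; _-Raw-AlmostCommutative⟶_)
open import Data.Empty using (⊥; ⊥-elim)
open import Data.Fin using (Fin; zero; suc; toℕ; fromℕ; inject₁; punchIn; punchOut; combine; remQuot)
open import Data.Fin.Patterns using (0F; 1F; 2F; 3F; 4F)
open import Data.Fin.Permutation using (Permutation′; transpose; _∘ₚ_; flip) renaming (id to idₚ)
open import Data.Fin.Permutation.Transposition.List using (TranspositionList; decompose; eval; eval-decompose)
import Data.Fin.Properties as Fin
open import Data.Fin.Subset using (Subset; _∈_; _∉_; ⁅_⁆; inside; outside)
open import Data.Fin.Subset.Properties using (_∈?_; x∈p∩q⁻; x∈⁅y⁆⇒x≡y; x∈⁅x⁆)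
open import Data.Integer as ℤ using (ℤ)
import Data.Integer.Properties as ℤ
open import Data.List using (List; []; _∷_; [_]; _++_; allFin; concatMap; drop; filter; length; lookup; map; reverse; tabulate)
import Data.List.Properties as List
open import Data.List.Relation.Unary.All as All using (All; []; _∷_)
import Data.List.Relation.Unary.All.Properties as All
open import Data.List.Relation.Unary.AllPairs using (AllPairs; []; _∷_)
open import Data.List.Relation.Unary.Any as Any using (Any; here; there)
import Data.List.Relation.Unary.Any.Properties as Any
open import Data.Maybe as Maybe using (Maybe; just; nothing; maybe′)
open import Data.Nat as ℕ using (ℕ; zero; suc; _≤_; _≥_; z≤n; s≤s; _≤?_; _<?_; _!)
import Data.Nat.Properties as ℕ
open import Data.Nat.Solver using (module +-*-Solver)
open import Data.Product using (Σ; ∃; _×_; _,_; proj₁; proj₂)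
open import Data.Sum as Sum using (_⊎_; inj₁; inj₂; [_,_]′)
open import Data.Unit using (⊤; tt)
open import Data.Vec using ([]; _∷_)
open import Function using (_∘_)
open import Function.Bundles using (Inverse)
open import Function.Definitions using (Injective)
open import Relation.Binary.Bundles using (DecSetoid)
open import Relation.Binary.PropositionalEquality using (_≡_; _≢_; cong; cong₂; subst; subst₂; module ≡-Reasoning)
  renaming (refl to ≡-refl; sym to ≡-sym; trans to ≡-trans)
open import Relation.Nullary using (¬_; Dec; yes; no; contradiction)
open import Relation.Nullary.Decidable
  using (_×-dec_; _⊎-dec_; _→-dec_; ¬?; dec⇒maybe; decidable-stable; map′; toWitness; toWitnessFalse)

-- Fields

-- The count takes the place of Dickson's list of the subgroups of PGL₂(q). It gives only an
-- inequality, because unipotent elements lie in no torus and a torus may be its whole centralizer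
-- in H. So only lower bounds for the torus orders enter, and the count is applied at the two
-- boundary cases 1/4 + 1/4 + 1/2 = 1 and 1/3 + 1/6 + 1/2 = 1.
--
-- Behind the tori is a sign. If two elements commute in PGL₂, their matrices satisfy AB = BA or AB
-- = - BA, and the torus of an involution consists of the elements with the first sign. This makes
-- torus membership decidable by comparing matrices and explains both the index 2 and the failure in
-- characteristic 2, where the signs agree.
--
-- Membership in H is an unbounded search over words, whereas counting has to decide it for every
-- element. The relations to be proved are equations with decidable equality, so deciding H up to
-- double negation is enough.
--
-- The isomorphism with S₅ rests on a normal form computed from words alone: in both groups a word
-- is trivial exactly when its normal form is.

module IntegerRingSolver {c ℓ} (R : CommutativeRing c ℓ) where
  open import Data.Integer using (+_; -[1+_])
  open CommutativeRing R
    renaming (refl to ≈-refl; sym to ≈-sym; trans to ≈-trans)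
  open Algebra.Properties.Ring ring
  open Algebra.Properties.Semiring.Mult.TCOptimised semiring
    using (×-homo-+; ×1-homo-*; 1+×) renaming (_×_ to _×′_)
  open import Algebra.Properties.AbelianGroup +-abelianGroup using (⁻¹-∙-comm)
  open import Relation.Binary.Reasoning.Setoid setoid

  -- The optimised multiple sends 1 to `1#` itself rather than to a sum ending in `0#`, so that
  -- `con (+ 1)` matches a literal `1#` in a goal by computation.
  ⟦_⟧ℤ : ℤ → Carrier
  ⟦ + n ⟧ℤ      = n ×′ 1#
  ⟦ -[1+ n ] ⟧ℤ = - (suc n ×′ 1#)

  ⊖-homo : ∀ m n → ⟦ m ℤ.⊖ n ⟧ℤ ≈ (m ×′ 1#) - (n ×′ 1#)
  ⊖-homo m zero = ≈-sym (≈-trans (+-congˡ -0#≈0#) (+-identityʳ _))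
  ⊖-homo zero (suc n) = ≈-sym (+-identityˡ _)
  ⊖-homo (suc m) (suc n) = begin
    ⟦ suc m ℤ.⊖ suc n ⟧ℤ              ≡⟨ cong ⟦_⟧ℤ (ℤ.[1+m]⊖[1+n]≡m⊖n m n) ⟩
    ⟦ m ℤ.⊖ n ⟧ℤ                      ≈⟨ ⊖-homo m n ⟩
    m′ - n′                           ≈⟨ +-congʳ (+-identityʳ m′) ⟨
    (m′ + 0#) - n′                    ≈⟨ +-congʳ (+-congˡ (-‿inverseʳ 1#)) ⟨
    (m′ + (1# - 1#)) - n′             ≈⟨ +-congʳ (+-assoc _ _ _) ⟨
    ((m′ + 1#) - 1#) - n′             ≈⟨ +-assoc _ _ _ ⟩
    (m′ + 1#) + (- 1# - n′)           ≈⟨ +-cong (+-comm _ _) (⁻¹-∙-comm _ _) ⟩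
    (1# + m′) - (1# + n′)             ≈⟨ +-cong (1+× m 1#) (-‿cong (1+× n 1#)) ⟨
    (suc m ×′ 1#) - (suc n ×′ 1#)     ∎
    where m′ = m ×′ 1#
          n′ = n ×′ 1#

  -‿homo : ∀ i → ⟦ ℤ.- i ⟧ℤ ≈ - ⟦ i ⟧ℤ
  -‿homo (+ zero)   = ≈-sym -0#≈0#
  -‿homo (+ suc n)  = ≈-refl
  -‿homo -[1+ n ]   = ≈-sym (-‿involutive _)

  +-homo : ∀ i j → ⟦ i ℤ.+ j ⟧ℤ ≈ ⟦ i ⟧ℤ + ⟦ j ⟧ℤ
  +-homo (+ m)    (+ n)    = ×-homo-+ 1# m n
  +-homo (+ m)    -[1+ n ] = ⊖-homo m (suc n)
  +-homo -[1+ m ] (+ n)    = ≈-trans (⊖-homo n (suc m)) (+-comm _ _)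
  +-homo -[1+ m ] -[1+ n ] = begin
    - (suc (suc (m ℕ.+ n)) ×′ 1#)     ≡⟨ cong (λ k → - (suc k ×′ 1#)) (ℕ.+-suc m n) ⟨
    - ((suc m ℕ.+ suc n) ×′ 1#)       ≈⟨ -‿cong (×-homo-+ 1# (suc m) (suc n)) ⟩
    - (suc m ×′ 1# + suc n ×′ 1#)            ≈⟨ ⁻¹-∙-comm _ _ ⟨
    - (suc m ×′ 1#) - (suc n ×′ 1#)          ∎

  *-homo-+ : ∀ m j → ⟦ + m ℤ.* j ⟧ℤ ≈ (m ×′ 1#) * ⟦ j ⟧ℤ
  *-homo-+ m (+ n) = begin
    ⟦ + m ℤ.* + n ⟧ℤ          ≡⟨ cong ⟦_⟧ℤ (ℤ.pos-* m n) ⟨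
    (m ℕ.* n) ×′ 1#    ≈⟨ ×1-homo-* m n ⟩
    (m ×′ 1#) * (n ×′ 1#)     ∎
  *-homo-+ m -[1+ n ] = begin
    ⟦ + m ℤ.* -[1+ n ] ⟧ℤ            ≡⟨ cong ⟦_⟧ℤ (ℤ.neg-distribʳ-* (+ m) (+ suc n)) ⟨
    ⟦ ℤ.- (+ m ℤ.* + suc n) ⟧ℤ       ≈⟨ -‿homo (+ m ℤ.* + suc n) ⟩
    - ⟦ + m ℤ.* + suc n ⟧ℤ           ≈⟨ -‿cong (*-homo-+ m (+ suc n)) ⟩
    - ((m ×′ 1#) * (suc n ×′ 1#))    ≈⟨ -‿distribʳ-* _ _ ⟩
    (m ×′ 1#) * - (suc n ×′ 1#)      ∎

  *-homo : ∀ i j → ⟦ i ℤ.* j ⟧ℤ ≈ ⟦ i ⟧ℤ * ⟦ j ⟧ℤ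
  *-homo (+ m) j = *-homo-+ m j
  *-homo -[1+ m ] j = begin
    ⟦ -[1+ m ] ℤ.* j ⟧ℤ             ≡⟨ cong ⟦_⟧ℤ (ℤ.neg-distribˡ-* (+ suc m) j) ⟨
    ⟦ ℤ.- (+ suc m ℤ.* j) ⟧ℤ        ≈⟨ -‿homo (+ suc m ℤ.* j) ⟩
    - ⟦ + suc m ℤ.* j ⟧ℤ            ≈⟨ -‿cong (*-homo-+ (suc m) j) ⟩
    - ((suc m ×′ 1#) * ⟦ j ⟧ℤ)      ≈⟨ -‿distribˡ-* _ _ ⟩
    - (suc m ×′ 1#) * ⟦ j ⟧ℤ        ∎

  ℤ-morphism : ℤ.+-*-rawRing -Raw-AlmostCommutative⟶ fromCommutativeRing R
  ℤ-morphism = record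
    { ⟦_⟧ = ⟦_⟧ℤ ; +-homo = +-homo ; *-homo = *-homo ; -‿homo = -‿homo
    ; 0-homo = ≈-refl ; 1-homo = ≈-refl }

  coefficient≟ : ∀ i j → Maybe (⟦ i ⟧ℤ ≈ ⟦ j ⟧ℤ)
  coefficient≟ i j = Maybe.map (λ { ≡-refl → ≈-refl }) (dec⇒maybe (i ℤ.≟ j))

  open Algebra.Solver.Ring ℤ.+-*-rawRing (fromCommutativeRing R) ℤ-morphism coefficient≟ public
    using (solve; _:=_; _:+_; _:*_; _:-_; :-_; con)

module FieldTheory {q : ℕ} (F : FiniteField q) where
  open FiniteField F using (0≢1; inverse; enumeration)

  ring : CommutativeRing 0ℓ 0ℓ
  ring = record { isCommutativeRing = FiniteField.isCommutativeRing F }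

  open CommutativeRing ring public
    using (Carrier; _+_; _*_; -_; _-_; 0#; 1#; *-comm; *-assoc; *-identityˡ; *-identityʳ;
           zeroˡ; zeroʳ; +-identityˡ; +-identityʳ; -‿inverseʳ)
  open IntegerRingSolver ring public using (⟦_⟧ℤ; +-homo; solve; _:=_; _:+_; _:*_; _:-_; :-_; con)

  infix 4 _≟_
  _≟_ : (x y : Carrier) → Dec (x ≡ y)
  x ≟ y = map′ (λ e → ≡-trans (≡-sym (Inverse.strictlyInverseˡ enumeration x))
                        (≡-trans (cong (Inverse.to enumeration) e) (Inverse.strictlyInverseˡ enumeration y)))
               (cong (Inverse.from enumeration))
               (Inverse.from enumeration x Fin.≟ Inverse.from enumeration y)

  ∃? : ∀ {p} {P : Carrier → Set p} → (∀ x → Dec (P x)) → Dec (∃ P)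
  ∃? {P = P} P? = map′ (λ { (i , p) → Inverse.to enumeration i , p })
    (λ { (x , p) → Inverse.from enumeration x , subst P (≡-sym (Inverse.strictlyInverseˡ enumeration x)) p })
    (Fin.any? λ i → P? (Inverse.to enumeration i))

  1≢0 : 1# ≢ 0#
  1≢0 e = 0≢1 (≡-sym e)

  _⁻¹[_] : ∀ x → x ≢ 0# → Carrier
  x ⁻¹[ x≢0 ] = proj₁ (inverse x x≢0)

  *-inverseʳ : ∀ x (x≢0 : x ≢ 0#) → x * x ⁻¹[ x≢0 ] ≡ 1#
  *-inverseʳ x x≢0 = proj₂ (inverse x x≢0)

  *-inverseˡ : ∀ x (x≢0 : x ≢ 0#) → x ⁻¹[ x≢0 ] * x ≡ 1#
  *-inverseˡ x x≢0 = ≡-trans (*-comm _ _) (*-inverseʳ x x≢0)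

  ⁻¹≢0 : ∀ x (x≢0 : x ≢ 0#) → x ⁻¹[ x≢0 ] ≢ 0#
  ⁻¹≢0 x x≢0 e = 1≢0 (≡-trans (≡-sym (*-inverseʳ x x≢0)) (≡-trans (cong (x *_) e) (zeroʳ x)))

  *-cancelˡ : ∀ {x} y z → x ≢ 0# → x * y ≡ x * z → y ≡ z
  *-cancelˡ {x} y z x≢0 e = ≡-trans (≡-sym (lem y)) (≡-trans (cong (x ⁻¹[ x≢0 ] *_) e) (lem z))
    where lem : ∀ w → x ⁻¹[ x≢0 ] * (x * w) ≡ w
          lem w = ≡-trans (≡-sym (*-assoc _ _ _)) (≡-trans (cong (_* w) (*-inverseˡ x x≢0)) (*-identityˡ w))

  *-zero-split : ∀ x y → x * y ≡ 0# → x ≡ 0# ⊎ y ≡ 0#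
  *-zero-split x y e with x ≟ 0#
  ... | yes x≡0 = inj₁ x≡0
  ... | no  x≢0 = inj₂ (*-cancelˡ y 0# x≢0 (≡-trans e (≡-sym (zeroʳ x))))

  *-cancelʳ-0 : ∀ {x y} → y ≢ 0# → x * y ≡ 0# → x ≡ 0#
  *-cancelʳ-0 {x} {y} y≢0 e = *-cancelˡ x 0# y≢0 (≡-trans (*-comm y x) (≡-trans e (≡-sym (zeroʳ y))))

  *-≢0 : ∀ {x y} → x ≢ 0# → y ≢ 0# → x * y ≢ 0#
  *-≢0 {x} {y} x≢0 y≢0 e with *-zero-split x y e
  ... | inj₁ p = x≢0 p
  ... | inj₂ p = y≢0 p

  +-cancelˡ : ∀ x y z → x + y ≡ x + z → y ≡ z
  +-cancelˡ x y z e = ≡-trans (solve 2 (λ x y → y := (x :+ y) :- x) ≡-refl x y)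
    (≡-trans (cong (λ w → w - x) e) (solve 2 (λ x z → (x :+ z) :- x := z) ≡-refl x z))

  -≡0⇒≡ : ∀ {x y} → x - y ≡ 0# → x ≡ y
  -≡0⇒≡ {x} {y} e = ≡-trans (solve 2 (λ x y → x := (x :- y) :+ y) ≡-refl x y) (≡-trans (cong (_+ y) e) (+-identityˡ y))

  ≡⇒-≡0 : ∀ {x y} → x ≡ y → x - y ≡ 0#
  ≡⇒-≡0 {x} ≡-refl = -‿inverseʳ x

  square-root-unique : ∀ x y → x * x ≡ y * y → x ≡ y ⊎ x ≡ - y
  square-root-unique x y e with *-zero-split (x - y) (x + y)
      (≡-trans (solve 2 (λ x y → (x :- y) :* (x :+ y) := x :* x :- y :* y) ≡-refl x y) (≡⇒-≡0 e))
  ... | inj₁ p = inj₁ (-≡0⇒≡ p)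
  ... | inj₂ p = inj₂ (-≡0⇒≡ (≡-trans (solve 2 (λ x y → x :- :- y := x :+ y) ≡-refl x y) p))

-- Two by two matrices

module MatrixTheory {q : ℕ} (F : FiniteField q) where
  open FieldTheory F
  open Matrices F
  open ≡-Reasoning

  tr : M₂ → Carrier
  tr (mat a b c d) = a + d

  I : M₂
  I = mat 1# 0# 0# 1#

  2# 3# 4# 5# : Carrier
  2# = ⟦ ℤ.+ 2 ⟧ℤ
  3# = ⟦ ℤ.+ 3 ⟧ℤ
  4# = ⟦ ℤ.+ 4 ⟧ℤ
  5# = ⟦ ℤ.+ 5 ⟧ℤ

  mat-≡ : ∀ {a b c d a′ b′ c′ d′} → a ≡ a′ → b ≡ b′ → c ≡ c′ → d ≡ d′ → mat a b c d ≡ mat a′ b′ c′ d′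
  mat-≡ ≡-refl ≡-refl ≡-refl ≡-refl = ≡-refl

  -- Opaque, because unfolding nested matrix products makes conversion checking explode.
  opaque
    infixl 20 _•_
    _•_ : M₂ → M₂ → M₂
    _•_ = _·_

    •≡· : ∀ A B → A • B ≡ A · B
    •≡· A B = ≡-refl

    •-assoc : ∀ A B C → (A • B) • C ≡ A • (B • C)
    •-assoc (mat a b c d) (mat e f g h) (mat i j k l) = mat-≡ (entry a b i k) (entry a b j l) (entry c d i k) (entry c d j l)
      where entry : ∀ a b i k → (a * e + b * g) * i + (a * f + b * h) * k ≡ a * (e * i + f * k) + b * (g * i + h * k)
            entry a b i k = solve 8 (λ a b i k e f g h →
              (a :* e :+ b :* g) :* i :+ (a :* f :+ b :* h) :* k := a :* (e :* i :+ f :* k) :+ b :* (g :* i :+ h :* k))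
              ≡-refl a b i k e f g h

    •-identityˡ : ∀ A → I • A ≡ A
    •-identityˡ (mat a b c d) = mat-≡ (e₁ a c) (e₁ b d) (e₂ a c) (e₂ b d)
      where e₁ : ∀ x y → 1# * x + 0# * y ≡ x
            e₁ = solve 2 (λ x y → con (ℤ.+ 1) :* x :+ con (ℤ.+ 0) :* y := x) ≡-refl
            e₂ : ∀ x y → 0# * x + 1# * y ≡ y
            e₂ = solve 2 (λ x y → con (ℤ.+ 0) :* x :+ con (ℤ.+ 1) :* y := y) ≡-refl

    •-identityʳ : ∀ A → A • I ≡ A
    •-identityʳ (mat a b c d) = mat-≡ (e₁ a b) (e₂ a b) (e₁ c d) (e₂ c d)
      where e₁ : ∀ x y → x * 1# + y * 0# ≡ x
            e₁ = solve 2 (λ x y → x :* con (ℤ.+ 1) :+ y :* con (ℤ.+ 0) := x) ≡-refl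
            e₂ : ∀ x y → x * 0# + y * 1# ≡ y
            e₂ = solve 2 (λ x y → x :* con (ℤ.+ 0) :+ y :* con (ℤ.+ 1) := y) ≡-refl

    scale-•ˡ : ∀ k A B → scale k A • B ≡ scale k (A • B)
    scale-•ˡ k (mat a b c d) (mat e f g h) = mat-≡ (lem a b e g) (lem a b f h) (lem c d e g) (lem c d f h)
      where lem : ∀ a b e g → (k * a) * e + (k * b) * g ≡ k * (a * e + b * g)
            lem = solve 5 (λ k a b e g → (k :* a) :* e :+ (k :* b) :* g := k :* (a :* e :+ b :* g)) ≡-refl k

    scale-•ʳ : ∀ k A B → A • scale k B ≡ scale k (A • B)
    scale-•ʳ k (mat a b c d) (mat e f g h) = mat-≡ (lem a b e g) (lem a b f h) (lem c d e g) (lem c d f h)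
      where lem : ∀ a b e g → a * (k * e) + b * (k * g) ≡ k * (a * e + b * g)
            lem = solve 5 (λ k a b e g → a :* (k :* e) :+ b :* (k :* g) := k :* (a :* e :+ b :* g)) ≡-refl k

    det-• : ∀ A B → det (A • B) ≡ det A * det B
    det-• (mat a b c d) (mat e f g h) = solve 8 (λ a b c d e f g h →
      (a :* e :+ b :* g) :* (c :* f :+ d :* h) :+ :- ((a :* f :+ b :* h) :* (c :* e :+ d :* g))
        := (a :* d :+ :- (b :* c)) :* (e :* h :+ :- (f :* g))) ≡-refl a b c d e f g h

  scale-scale : ∀ k l A → scale k (scale l A) ≡ scale (k * l) A
  scale-scale k l (mat a b c d) = ≡-sym (mat-≡ (*-assoc k l a) (*-assoc k l b) (*-assoc k l c) (*-assoc k l d))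

  scale-1 : ∀ A → scale 1# A ≡ A
  scale-1 (mat a b c d) = mat-≡ (*-identityˡ a) (*-identityˡ b) (*-identityˡ c) (*-identityˡ d)

  scale-cancel : ∀ {k A B} → k ≢ 0# → scale k A ≡ scale k B → A ≡ B
  scale-cancel {k} {mat a b c d} {mat a′ b′ c′ d′} k≢0 e =
    mat-≡ (*-cancelˡ a a′ k≢0 (cong M₂.a e)) (*-cancelˡ b b′ k≢0 (cong M₂.b e))
          (*-cancelˡ c c′ k≢0 (cong M₂.c e)) (*-cancelˡ d d′ k≢0 (cong M₂.d e))

  det-scale : ∀ k A → det (scale k A) ≡ (k * k) * det A
  det-scale k (mat a b c d) = solve 5 (λ k a b c d →
    (k :* a) :* (k :* d) :+ :- ((k :* b) :* (k :* c)) := (k :* k) :* (a :* d :+ :- (b :* c))) ≡-refl k a b c d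

  •-det≢0 : ∀ {A B} → det A ≢ 0# → det B ≢ 0# → det (A • B) ≢ 0#
  •-det≢0 {A} {B} a b e = *-≢0 a b (≡-trans (≡-sym (det-• A B)) e)

  ∼-reflexive : ∀ {A B} → A ≡ B → A ∼ B
  ∼-reflexive {A} ≡-refl = 1# , 1≢0 , scale-1 A

  ∼-refl : ∀ {A} → A ∼ A
  ∼-refl = ∼-reflexive ≡-refl

  ∼-sym : ∀ {A B} → A ∼ B → B ∼ A
  ∼-sym {A} (k , k≢0 , ≡-refl) = k ⁻¹[ k≢0 ] , ⁻¹≢0 k k≢0 ,
    ≡-trans (scale-scale _ k A) (≡-trans (cong (λ l → scale l A) (*-inverseˡ k k≢0)) (scale-1 A))

  ∼-trans : ∀ {A B C} → A ∼ B → B ∼ C → A ∼ C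
  ∼-trans {A} (k , k≢0 , ≡-refl) (l , l≢0 , ≡-refl) = l * k , *-≢0 l≢0 k≢0 , ≡-sym (scale-scale l k A)

  •-cong-∼ : ∀ {A A′ B B′} → A ∼ A′ → B ∼ B′ → (A • B) ∼ (A′ • B′)
  •-cong-∼ {A} {B = B} (k , k≢0 , ≡-refl) (l , l≢0 , ≡-refl) = k * l , *-≢0 k≢0 l≢0 ,
    ≡-sym (≡-trans (scale-•ˡ k A (scale l B)) (≡-trans (cong (scale k) (scale-•ʳ l A B)) (scale-scale k l (A • B))))

  infix 4 _≟ᴹ_ _∼?_
  _≟ᴹ_ : (A B : M₂) → Dec (A ≡ B)
  mat a b c d ≟ᴹ mat a′ b′ c′ d′ = map′
    (λ (p , r , s , t) → mat-≡ p r s t)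
    (λ e → cong M₂.a e , cong M₂.b e , cong M₂.c e , cong M₂.d e)
    ((a ≟ a′) ×-dec (b ≟ b′) ×-dec (c ≟ c′) ×-dec (d ≟ d′))

  _∼?_ : (A B : M₂) → Dec (A ∼ B)
  A ∼? B = ∃? λ k → ¬? (k ≟ 0#) ×-dec (scale k A ≟ᴹ B)

  Comm : M₂ → M₂ → Set
  Comm A B = A • B ≡ B • A

  Comm-resp-∼ : ∀ {A A′ B B′} → A ∼ A′ → B ∼ B′ → Comm A B → Comm A′ B′
  Comm-resp-∼ {A} {_} {B} (k , _ , ≡-refl) (l , _ , ≡-refl) e = begin
    scale k A • scale l B     ≡⟨ scale-•ˡ k A (scale l B) ⟩
    scale k (A • scale l B)   ≡⟨ cong (scale k) (scale-•ʳ l A B) ⟩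
    scale k (scale l (A • B)) ≡⟨ cong (λ X → scale k (scale l X)) e ⟩
    scale k (scale l (B • A)) ≡⟨ cong (scale k) (scale-•ˡ l B A) ⟨
    scale k (scale l B • A)   ≡⟨ scale-•ʳ k (scale l B) A ⟨
    scale l B • scale k A     ∎

  Comm-I : ∀ A → Comm A I
  Comm-I A = ≡-trans (•-identityʳ A) (≡-sym (•-identityˡ A))

  Comm-• : ∀ {A B C} → Comm A B → Comm A C → Comm A (B • C)
  Comm-• {A} {B} {C} ab ac = begin
    A • (B • C)  ≡⟨ •-assoc A B C ⟨
    (A • B) • C  ≡⟨ cong (_• C) ab ⟩
    (B • A) • C  ≡⟨ •-assoc B A C ⟩
    B • (A • C)  ≡⟨ cong (B •_) ac ⟩
    B • (C • A)  ≡⟨ •-assoc B C A ⟨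
    (B • C) • A  ∎

  AntiComm : M₂ → M₂ → Set
  AntiComm A B = scale (- 1#) (A • B) ≡ B • A

  AntiComm-• : ∀ {A B C} → AntiComm A B → AntiComm A C → Comm A (B • C)
  AntiComm-• {A} {B} {C} ab ac = scale-cancel neg≢0 (begin
    scale (- 1#) (A • (B • C))  ≡⟨ cong (scale (- 1#)) (•-assoc A B C) ⟨
    scale (- 1#) ((A • B) • C)  ≡⟨ scale-•ˡ (- 1#) (A • B) C ⟨
    scale (- 1#) (A • B) • C    ≡⟨ cong (_• C) ab ⟩
    (B • A) • C                 ≡⟨ •-assoc B A C ⟩
    B • (A • C)                 ≡⟨ scale-1 _ ⟨
    scale 1# (B • (A • C))      ≡⟨ cong (λ k → scale k (B • (A • C))) (≡-sym minus-one-squared) ⟩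
    scale (- 1# * - 1#) (B • (A • C)) ≡⟨ scale-scale _ _ _ ⟨
    scale (- 1#) (scale (- 1#) (B • (A • C))) ≡⟨ cong (scale (- 1#)) (scale-•ʳ _ B (A • C)) ⟨
    scale (- 1#) (B • scale (- 1#) (A • C)) ≡⟨ cong (λ X → scale (- 1#) (B • X)) ac ⟩
    scale (- 1#) (B • (C • A))  ≡⟨ cong (scale (- 1#)) (•-assoc B C A) ⟨
    scale (- 1#) ((B • C) • A)  ∎)
    where
    minus-one-squared : - 1# * - 1# ≡ 1#
    minus-one-squared = solve 0 (:- con (ℤ.+ 1) :* :- con (ℤ.+ 1) := con (ℤ.+ 1)) ≡-refl
    neg≢0 : - 1# ≢ 0#
    neg≢0 e = 1≢0 (≡-trans (≡-sym minus-one-squared) (≡-trans (cong (- 1# *_) e) (zeroʳ _)))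

  -- Taking determinants in `scale k (A • B) ≡ B • A` gives k² = 1, so k is 1 or - 1.
  ∼-comm-split : ∀ A B → det A ≢ 0# → det B ≢ 0# → (A • B) ∼ (B • A) → Comm A B ⊎ AntiComm A B
  ∼-comm-split A B a≢0 b≢0 (k , _ , e) = split (square-root-unique k 1# k²≡1)
    where
    D = det A * det B
    k²≡1 : k * k ≡ 1# * 1#
    k²≡1 = *-cancelˡ (k * k) (1# * 1#) (*-≢0 a≢0 b≢0) (begin
      D * (k * k)             ≡⟨ *-comm _ _ ⟩
      (k * k) * D             ≡⟨ cong ((k * k) *_) (det-• A B) ⟨
      (k * k) * det (A • B)   ≡⟨ det-scale k (A • B) ⟨
      det (scale k (A • B))   ≡⟨ cong det e ⟩
      det (B • A)             ≡⟨ det-• B A ⟩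
      det B * det A           ≡⟨ *-comm _ _ ⟩
      D                       ≡⟨ *-identityʳ D ⟨
      D * 1#                  ≡⟨ cong (D *_) (*-identityˡ 1#) ⟨
      D * (1# * 1#)           ∎)
    split : k ≡ 1# ⊎ k ≡ - 1# → Comm A B ⊎ AntiComm A B
    split (inj₁ k≡1)  = inj₁ (≡-trans (≡-sym (scale-1 (A • B))) (≡-trans (cong (λ l → scale l (A • B)) (≡-sym k≡1)) e))
    split (inj₂ k≡-1) = inj₂ (≡-trans (cong (λ l → scale l (A • B)) (≡-sym k≡-1)) e)

  module _ (u₁ u₂ u₃ v₁ v₂ v₃ : Carrier) where
    -- The cross product of u and v vanishes. It is applied to u = (a - d , b , c), the coordinates
    -- of a matrix modulo scalars, for which parallel vectors mean commuting matrices.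
    Parallel : Set
    Parallel = u₁ * v₂ ≡ u₂ * v₁ × u₁ * v₃ ≡ u₃ * v₁ × u₂ * v₃ ≡ u₃ * v₂

    parallel⇒multiple : ¬ (u₁ ≡ 0# × u₂ ≡ 0# × u₃ ≡ 0#) → Parallel →
                        ∃ λ k → v₁ ≡ k * u₁ × v₂ ≡ k * u₂ × v₃ ≡ k * u₃
    parallel⇒multiple u≢0 (p₁₂ , p₁₃ , p₂₃) = choose (u₁ ≟ 0#) (u₂ ≟ 0#) (u₃ ≟ 0#)
      where
      ratio : ∀ {u v u′ v′} (u≢0 : u ≢ 0#) → u * v′ ≡ u′ * v → v′ ≡ (v * u ⁻¹[ u≢0 ]) * u′
      ratio {u} {v} {u′} {v′} u≢0 e = *-cancelˡ _ _ u≢0 (begin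
        u * v′                          ≡⟨ e ⟩
        u′ * v                          ≡⟨ *-identityˡ _ ⟨
        1# * (u′ * v)                   ≡⟨ cong (_* (u′ * v)) (*-inverseʳ u u≢0) ⟨
        (u * u ⁻¹[ u≢0 ]) * (u′ * v)    ≡⟨ solve 4 (λ u i u′ v → (u :* i) :* (u′ :* v) := u :* ((v :* i) :* u′)) ≡-refl u _ u′ v ⟩
        u * ((v * u ⁻¹[ u≢0 ]) * u′)    ∎)
      choose : Dec (u₁ ≡ 0#) → Dec (u₂ ≡ 0#) → Dec (u₃ ≡ 0#) → ∃ λ k → v₁ ≡ k * u₁ × v₂ ≡ k * u₂ × v₃ ≡ k * u₃
      choose (no n) _ _ = _ , ratio n ≡-refl , ratio n p₁₂ , ratio n p₁₃
      choose (yes _) (no n) _ = _ , ratio n (≡-sym p₁₂) , ratio n ≡-refl , ratio n p₂₃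
      choose (yes _) (yes _) (no n) = _ , ratio n (≡-sym p₁₃) , ratio n (≡-sym p₂₃) , ratio n ≡-refl
      choose (yes a) (yes b) (yes c) = contradiction (a , b , c) u≢0

  -- Phrased through (a - d , b , c), so that `¬ Scalar` is literally the hypothesis on u in
  -- `parallel⇒multiple`. The zero matrix is included, hence the determinant condition in
  -- `scalar⇒∼I`.
  Scalar : M₂ → Set
  Scalar (mat a b c d) = (a - d ≡ 0#) × b ≡ 0# × c ≡ 0#

  scalar⇒∼I : ∀ A → det A ≢ 0# → Scalar A → A ∼ I
  scalar⇒∼I (mat a b c d) D≢0 (a-d , ≡-refl , ≡-refl) = ∼-sym (a , a≢0 , mat-≡ (e₁ a) (e₀ a) (e₀ a) (≡-trans (e₁ a) (-≡0⇒≡ a-d)))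
    where
    e₁ : ∀ a → a * 1# ≡ a
    e₁ = *-identityʳ
    e₀ : ∀ a → a * 0# ≡ 0#
    e₀ = zeroʳ
    a≢0 : a ≢ 0#
    a≢0 ≡-refl = D≢0 (solve 1 (λ d → con (ℤ.+ 0) :* d :+ :- (con (ℤ.+ 0) :* con (ℤ.+ 0)) := con (ℤ.+ 0)) ≡-refl d)

  ∼I⇒scalar : ∀ A → A ∼ I → Scalar A
  ∼I⇒scalar A A∼I with ∼-sym A∼I
  ... | k , _ , ≡-refl = ≡⇒-≡0 ≡-refl , zeroʳ k , zeroʳ k

  opaque
    unfolding _•_

    comm⇒parallel : ∀ {a b c d e f g h} → Comm (mat a b c d) (mat e f g h) → Parallel (a - d) b c (e - h) f g
    comm⇒parallel {a} {b} {c} {d} {e} {f} {g} {h} eq =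
        -≡0⇒≡ (≡-trans (solve 6 (λ a b d e f h → (a :- d) :* f :- b :* (e :- h) := (a :* f :+ b :* h) :- (e :* b :+ f :* d)) ≡-refl a b d e f h) (≡⇒-≡0 (cong M₂.b eq)))
      , -≡0⇒≡ (≡-trans (solve 6 (λ a c d e g h → (a :- d) :* g :- c :* (e :- h) := (g :* a :+ h :* c) :- (c :* e :+ d :* g)) ≡-refl a c d e g h) (≡⇒-≡0 (≡-sym (cong M₂.c eq))))
      , -≡0⇒≡ (≡-trans (solve 6 (λ a b c e f g → b :* g :- c :* f := (a :* e :+ b :* g) :- (e :* a :+ f :* c)) ≡-refl a b c e f g) (≡⇒-≡0 (cong M₂.a eq)))

    parallel⇒comm : ∀ {a b c d e f g h} → Parallel (a - d) b c (e - h) f g → Comm (mat a b c d) (mat e f g h)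
    parallel⇒comm {a} {b} {c} {d} {e} {f} {g} {h} (p , r , s) = mat-≡
      (-≡0⇒≡ (≡-trans (solve 6 (λ a b c e f g → (a :* e :+ b :* g) :- (e :* a :+ f :* c) := b :* g :- c :* f) ≡-refl a b c e f g) (≡⇒-≡0 s)))
      (-≡0⇒≡ (≡-trans (solve 6 (λ a b d e f h → (a :* f :+ b :* h) :- (e :* b :+ f :* d) := (a :- d) :* f :- b :* (e :- h)) ≡-refl a b d e f h) (≡⇒-≡0 p)))
      (≡-sym (-≡0⇒≡ (≡-trans (solve 6 (λ a c d e g h → (g :* a :+ h :* c) :- (c :* e :+ d :* g) := (a :- d) :* g :- c :* (e :- h)) ≡-refl a c d e g h) (≡⇒-≡0 r))))
      (≡-sym (-≡0⇒≡ (≡-trans (solve 6 (λ d b c h f g → (g :* b :+ h :* d) :- (c :* f :+ d :* h) := b :* g :- c :* f) ≡-refl d b c h f g) (≡⇒-≡0 s))))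

  -- The centralizer of a nonscalar matrix A is spanned by I and A, hence commutative: modulo
  -- scalars, X and Y are both multiples of A. This is why distinct tori meet trivially.
  comm-trans : ∀ {X A Y} → ¬ Scalar A → Comm A X → Comm A Y → Comm X Y
  comm-trans {mat x₁ x₂ x₃ x₄} {mat a b c d} {mat y₁ y₂ y₃ y₄} A≢ cx cy
    with parallel⇒multiple _ _ _ _ _ _ A≢ (comm⇒parallel cx) | parallel⇒multiple _ _ _ _ _ _ A≢ (comm⇒parallel cy)
  ... | k , p₁ , p₂ , p₃ | l , r₁ , r₂ , r₃ = parallel⇒comm
      (minor p₁ p₂ r₁ r₂ , minor p₁ p₃ r₁ r₃ , minor p₂ p₃ r₂ r₃)
    where
    minor : ∀ {u v x y x′ y′} → x ≡ k * u → y ≡ k * v → x′ ≡ l * u → y′ ≡ l * v → x * y′ ≡ y * x′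
    minor {u} {v} ≡-refl ≡-refl ≡-refl ≡-refl = solve 4 (λ k l u v → (k :* u) :* (l :* v) := (k :* v) :* (l :* u)) ≡-refl k l u v

  opaque
    unfolding _•_

    -- Cayley-Hamilton: A² = (tr A) A - det A.
    involution⇒tr≡0 : ∀ A → ¬ Scalar A → Scalar (A • A) → tr A ≡ 0#
    involution⇒tr≡0 (mat a b c d) A≢ (p , r , s) with a + d ≟ 0#
    ... | yes e = e
    ... | no ne = ⊥-elim (A≢ ( cancel (≡-trans (solve 4 (λ a b c d → (a :+ d) :* (a :- d) := (a :* a :+ b :* c) :- (c :* b :+ d :* d)) ≡-refl a b c d) p)
                             , cancel (≡-trans (solve 3 (λ a b d → (a :+ d) :* b := a :* b :+ b :* d) ≡-refl a b d) r)
                             , cancel (≡-trans (solve 3 (λ a c d → (a :+ d) :* c := c :* a :+ d :* c) ≡-refl a c d) s)))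
      where cancel : ∀ {x} → (a + d) * x ≡ 0# → x ≡ 0#
            cancel {x} e with *-zero-split (a + d) x e
            ... | inj₁ z = contradiction z ne
            ... | inj₂ z = z

  opaque
    unfolding _•_

    -- Two applications of Cayley-Hamilton give A³ = ((tr A)² - det A) A - (tr A)(det A), so modulo
    -- scalars A³ is (tr A)² - det A times A.
    cube-scalar⇒tr²≡det : ∀ A → ¬ Scalar A → Scalar ((A • A) • A) → tr A * tr A ≡ det A
    cube-scalar⇒tr²≡det (mat a b c d) A≢ (p , r , s) with (a + d) * (a + d) ≟ a * d + - (b * c)
    ... | yes e = e
    ... | no ne = ⊥-elim (A≢ ( cancel (≡-trans (solve 4 (λ a b c d →
                        ((a :+ d) :* (a :+ d) :- (a :* d :+ :- (b :* c))) :* (a :- d)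
                          := ((a :* a :+ b :* c) :* a :+ (a :* b :+ b :* d) :* c) :- ((c :* a :+ d :* c) :* b :+ (c :* b :+ d :* d) :* d)) ≡-refl a b c d) p)
                      , cancel (≡-trans (solve 4 (λ a b c d →
                        ((a :+ d) :* (a :+ d) :- (a :* d :+ :- (b :* c))) :* b
                          := (a :* a :+ b :* c) :* b :+ (a :* b :+ b :* d) :* d) ≡-refl a b c d) r)
                      , cancel (≡-trans (solve 4 (λ a b c d →
                        ((a :+ d) :* (a :+ d) :- (a :* d :+ :- (b :* c))) :* c
                          := (c :* a :+ d :* c) :* a :+ (c :* b :+ d :* d) :* c) ≡-refl a b c d) s)))
      where cancel : ∀ {x} → ((a + d) * (a + d) - (a * d + - (b * c))) * x ≡ 0# → x ≡ 0#
            cancel {x} e with *-zero-split _ x e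
            ... | inj₁ z = contradiction (-≡0⇒≡ z) ne
            ... | inj₂ z = z

    tr²≡det⇒cube-scalar : ∀ A → tr A * tr A ≡ det A → Scalar ((A • A) • A)
    tr²≡det⇒cube-scalar (mat a b c d) e =
        vanish (solve 4 (λ a b c d →
          ((a :* a :+ b :* c) :* a :+ (a :* b :+ b :* d) :* c) :- ((c :* a :+ d :* c) :* b :+ (c :* b :+ d :* d) :* d)
            := ((a :+ d) :* (a :+ d) :- (a :* d :+ :- (b :* c))) :* (a :- d)) ≡-refl a b c d)
      , vanish (solve 4 (λ a b c d →
          (a :* a :+ b :* c) :* b :+ (a :* b :+ b :* d) :* d
            := ((a :+ d) :* (a :+ d) :- (a :* d :+ :- (b :* c))) :* b) ≡-refl a b c d)
      , vanish (solve 4 (λ a b c d →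
          (c :* a :+ d :* c) :* a :+ (c :* b :+ d :* d) :* c
            := ((a :+ d) :* (a :+ d) :- (a :* d :+ :- (b :* c))) :* c) ≡-refl a b c d)
      where vanish : ∀ {x y} → x ≡ ((a + d) * (a + d) - (a * d + - (b * c))) * y → x ≡ 0#
            vanish {x} {y} p = ≡-trans p (≡-trans (cong (_* y) (≡⇒-≡0 e)) (zeroˡ y))

    tr-square : ∀ A → tr (A • A) ≡ tr A * tr A - 2# * det A
    tr-square (mat a b c d) = solve 4 (λ a b c d →
      (a :* a :+ b :* c) :+ (c :* b :+ d :* d) := (a :+ d) :* (a :+ d) :- con (ℤ.+ 2) :* (a :* d :+ :- (b :* c))) ≡-refl a b c d

    -- tr (AB) = tr (BA) = - tr (AB).
    anticomm⇒2tr≡0 : ∀ A B → AntiComm A B → 2# * tr (A • B) ≡ 0#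
    anticomm⇒2tr≡0 (mat a b c d) (mat e f g h) eq = ≡-trans
      (solve 8 (λ a b c d e f g h →
         con (ℤ.+ 2) :* ((a :* e :+ b :* g) :+ (c :* f :+ d :* h))
           := (e :* a :+ f :* c :- (:- con (ℤ.+ 1) :* (a :* e :+ b :* g))) :+ (g :* b :+ h :* d :- (:- con (ℤ.+ 1) :* (c :* f :+ d :* h))))
         ≡-refl a b c d e f g h)
      (≡-trans (cong₂ _+_ (≡⇒-≡0 (≡-sym (cong M₂.a eq))) (≡⇒-≡0 (≡-sym (cong M₂.d eq)))) (+-identityˡ 0#))

    -- On traceless matrices tr (ABC) is an alternating trilinear form and tr (A²) = - 2 det A. The
    -- Gram determinant of A, B, C for the trace form is therefore a multiple of s², namely - 2 s²;
    -- this identity is that relation divided by 2.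
    gram : ∀ {x y z x′ y′ z′ x″ y″ z″} →
      let A = mat x y z (- x) ; B = mat x′ y′ z′ (- x′) ; C = mat x″ y″ z″ (- x″) ; s = tr ((A • B) • C) in
      4# * (det A * det B * det C) ≡
        s * s + tr (B • C) * tr (B • C) * det A + tr (A • B) * tr (A • B) * det C
          + tr (A • C) * (tr (A • C) * det B + tr (A • B) * tr (B • C))
    gram {x} {y} {z} {x′} {y′} {z′} {x″} {y″} {z″} = solve 9 (λ x y z x′ y′ z′ x″ y″ z″ →
      let dt = λ x y z → x :* (:- x) :+ :- (y :* z)
          t  = λ x y z x′ y′ z′ → (x :* x′ :+ y :* z′) :+ (z :* y′ :+ (:- x) :* (:- x′))
          s  = ((x :* x′ :+ y :* z′) :* x″ :+ (x :* y′ :+ y :* (:- x′)) :* z″)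
             :+ ((z :* x′ :+ (:- x) :* z′) :* y″ :+ (z :* y′ :+ (:- x) :* (:- x′)) :* (:- x″))
      in con (ℤ.+ 4) :* (dt x y z :* dt x′ y′ z′ :* dt x″ y″ z″)
           := s :* s :+ t x′ y′ z′ x″ y″ z″ :* t x′ y′ z′ x″ y″ z″ :* dt x y z
                :+ t x y z x′ y′ z′ :* t x y z x′ y′ z′ :* dt x″ y″ z″
                :+ t x y z x″ y″ z″ :* (t x y z x″ y″ z″ :* dt x′ y′ z′ :+ t x y z x′ y′ z′ :* t x′ y′ z′ x″ y″ z″))
      ≡-refl x y z x′ y′ z′ x″ y″ z″

    -- A traceless second factor kills the scalar part of the first, so only the coordinates of the
    -- first factor modulo scalars contribute.
    tr-multiple : ∀ {a b c d k x y z x′ y′ z′} → a - d ≡ k * (x - - x) → b ≡ k * y → c ≡ k * z →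
      tr (mat a b c d • mat x′ y′ z′ (- x′)) ≡ k * tr (mat x′ y′ z′ (- x′) • mat x y z (- x))
    tr-multiple {a} {b} {c} {d} {k} {x} {y} {z} {x′} {y′} {z′} p ≡-refl ≡-refl = begin
      (a * x′ + b * z′) + (c * y′ + d * - x′)   ≡⟨ solve 7 (λ a b c d x′ y′ z′ →
          (a :* x′ :+ b :* z′) :+ (c :* y′ :+ d :* :- x′) := (a :- d) :* x′ :+ (b :* z′ :+ c :* y′)) ≡-refl a b c d x′ y′ z′ ⟩
      (a - d) * x′ + (b * z′ + c * y′)          ≡⟨ cong (λ w → w * x′ + (b * z′ + c * y′)) p ⟩
      (k * (x - - x)) * x′ + (b * z′ + c * y′)  ≡⟨ solve 7 (λ k x y z x′ y′ z′ →
          (k :* (x :- :- x)) :* x′ :+ ((k :* y) :* z′ :+ (k :* z) :* y′)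
            := k :* ((x′ :* x :+ y′ :* z) :+ (z′ :* y :+ (:- x′) :* (:- x)))) ≡-refl k x y z x′ y′ z′ ⟩
      k * ((x′ * x + y′ * z) + (z′ * y + (- x′) * (- x))) ∎

  -- 4 det - tr² is - ((a - d)² + 4 b c), a quadratic form in the coordinates modulo scalars; on a
  -- traceless matrix it is 4 det.
  discriminant-multiple : ∀ {a b c d k x y z} → a - d ≡ k * (x - - x) → b ≡ k * y → c ≡ k * z →
    4# * det (mat a b c d) - tr (mat a b c d) * tr (mat a b c d) ≡ 4# * ((k * k) * det (mat x y z (- x)))
  discriminant-multiple {a} {b} {c} {d} {k} {x} {y} {z} p ≡-refl ≡-refl = begin
    4# * (a * d + - (b * c)) - (a + d) * (a + d)   ≡⟨ solve 4 (λ a b c d →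
      con (ℤ.+ 4) :* (a :* d :+ :- (b :* c)) :- (a :+ d) :* (a :+ d)
        := :- ((a :- d) :* (a :- d) :+ con (ℤ.+ 4) :* (b :* c))) ≡-refl a b c d ⟩
    - ((a - d) * (a - d) + 4# * (b * c))           ≡⟨ cong (λ w → - (w * w + 4# * (b * c))) p ⟩
    - ((k * (x - - x)) * (k * (x - - x)) + 4# * ((k * y) * (k * z))) ≡⟨ solve 4 (λ k x y z →
      :- ((k :* (x :- :- x)) :* (k :* (x :- :- x)) :+ con (ℤ.+ 4) :* ((k :* y) :* (k :* z)))
        := con (ℤ.+ 4) :* ((k :* k) :* (x :* :- x :+ :- (y :* z)))) ≡-refl k x y z ⟩
    4# * ((k * k) * (x * - x + - (y * z)))         ∎

  opaque
    unfolding _•_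

    adj : M₂ → M₂
    adj (mat a b c d) = mat d (- b) (- c) a

    adj-• : ∀ A → adj A • A ≡ scale (det A) I
    adj-• (mat a b c d) = mat-≡
      (solve 4 (λ a b c d → d :* a :+ :- b :* c := (a :* d :+ :- (b :* c)) :* con (ℤ.+ 1)) ≡-refl a b c d)
      (solve 4 (λ a b c d → d :* b :+ :- b :* d := (a :* d :+ :- (b :* c)) :* con (ℤ.+ 0)) ≡-refl a b c d)
      (solve 4 (λ a b c d → :- c :* a :+ a :* c := (a :* d :+ :- (b :* c)) :* con (ℤ.+ 0)) ≡-refl a b c d)
      (solve 4 (λ a b c d → :- c :* b :+ a :* d := (a :* d :+ :- (b :* c)) :* con (ℤ.+ 1)) ≡-refl a b c d)

  •-cancelˡ : ∀ A {B C} → det A ≢ 0# → A • B ≡ A • C → B ≡ C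
  •-cancelˡ A {B} {C} A≢0 e = scale-cancel A≢0 (≡-trans (≡-sym (lem B)) (≡-trans (cong (adj A •_) e) (lem C)))
    where lem : ∀ X → adj A • (A • X) ≡ scale (det A) X
          lem X = ≡-trans (≡-sym (•-assoc (adj A) A X)) (≡-trans (cong (_• X) (adj-• A))
                    (≡-trans (scale-•ˡ (det A) I X) (cong (scale (det A)) (•-identityˡ X))))

  ∼-det≢0 : ∀ {A B} → A ∼ B → det A ≢ 0# → det B ≢ 0#
  ∼-det≢0 {A} (k , k≢0 , ≡-refl) A≢0 e = *-≢0 (*-≢0 k≢0 k≢0) A≢0 (≡-trans (≡-sym (det-scale k A)) e)

  conjugate : ∀ {H H′ X Y} → (H′ • H) ∼ I → Comm X Y → Comm (H • X • H′) (H • Y • H′)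
  conjugate {H} {H′} {X} {Y} H′H c with ∼-sym H′H
  ... | k , _ , e = ≡-trans (product X Y) (≡-trans (cong (λ Z → scale k (H • Z • H′)) c) (≡-sym (product Y X)))
    where
    product : ∀ X Y → (H • X • H′) • (H • Y • H′) ≡ scale k (H • (X • Y) • H′)
    product X Y = begin
      (H • X • H′) • (H • Y • H′)    ≡⟨ •-assoc (H • X) H′ (H • Y • H′) ⟩
      (H • X) • (H′ • (H • Y • H′))  ≡⟨ cong (λ Z → (H • X) • (H′ • Z)) (•-assoc H Y H′) ⟩
      (H • X) • (H′ • (H • (Y • H′))) ≡⟨ cong ((H • X) •_) (•-assoc H′ H (Y • H′)) ⟨
      (H • X) • ((H′ • H) • (Y • H′)) ≡⟨ cong (λ Z → (H • X) • (Z • (Y • H′))) e ⟨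
      (H • X) • (scale k I • (Y • H′)) ≡⟨ cong ((H • X) •_) (≡-trans (scale-•ˡ k I (Y • H′)) (cong (scale k) (•-identityˡ (Y • H′)))) ⟩
      (H • X) • scale k (Y • H′)     ≡⟨ scale-•ʳ k (H • X) (Y • H′) ⟩
      scale k ((H • X) • (Y • H′))   ≡⟨ cong (scale k) (•-assoc (H • X) Y H′) ⟨
      scale k ((H • X) • Y • H′)     ≡⟨ cong (λ Z → scale k (Z • H′)) (•-assoc H X Y) ⟩
      scale k (H • (X • Y) • H′)     ∎

  tr≡0⇒d≡-a : ∀ {a d} → a + d ≡ 0# → d ≡ - a
  tr≡0⇒d≡-a {a} {d} e = -≡0⇒≡ (≡-trans (solve 2 (λ a d → d :- :- a := a :+ d) ≡-refl a d) e)

  -- Traceless matrices and the trace computation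

  module OddCharacteristic (2≢0 : 2# ≢ 0#) where

    -- When 2 is invertible, (a - d , b , c) determines a traceless matrix, so parallel coordinates
    -- make X and Y proportional. Hence a torus contains only one involution.
    comm-involutions : ∀ {X Y} → ¬ Scalar X → ¬ Scalar Y → tr X ≡ 0# → tr Y ≡ 0# → Comm X Y → X ∼ Y
    comm-involutions {mat x y z w} {mat x′ y′ z′ w′} X≢ Y≢ trX trY c =
      coordinates (tr≡0⇒d≡-a trX) (tr≡0⇒d≡-a trY) (parallel⇒multiple _ _ _ _ _ _ X≢ (comm⇒parallel c))
      where
      coordinates : w ≡ - x → w′ ≡ - x′ → (∃ λ k → x′ - w′ ≡ k * (x - w) × y′ ≡ k * y × z′ ≡ k * z) →
                    mat x y z w ∼ mat x′ y′ z′ w′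
      coordinates ≡-refl ≡-refl (k , p₁ , p₂ , p₃) = k , k≢0 ,
        mat-≡ (≡-sym x′≡) (≡-sym p₂) (≡-sym p₃) (≡-trans (solve 2 (λ k x → k :* :- x := :- (k :* x)) ≡-refl k x) (cong -_ (≡-sym x′≡)))
        where
        x′≡ : x′ ≡ k * x
        x′≡ = *-cancelˡ x′ (k * x) 2≢0 (≡-trans (solve 1 (λ x′ → con (ℤ.+ 2) :* x′ := x′ :- :- x′) ≡-refl x′)
          (≡-trans p₁ (solve 2 (λ k x → k :* (x :- :- x) := con (ℤ.+ 2) :* (k :* x)) ≡-refl k x)))
        k≢0 : k ≢ 0#
        k≢0 ≡-refl = Y≢ (≡-trans p₁ (zeroˡ _) , ≡-trans p₂ (zeroˡ _) , ≡-trans p₃ (zeroˡ _))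

    tr≡0⇒¬scalar : ∀ A → tr A ≡ 0# → det A ≢ 0# → ¬ Scalar A
    tr≡0⇒¬scalar (mat a b c d) t D≢0 (e , ≡-refl , ≡-refl) = D≢0 (≡-trans
      (cong₂ (λ u v → u * v + - (0# * 0#)) a≡0 (≡-trans (≡-sym (-≡0⇒≡ e)) a≡0))
      (solve 0 (con (ℤ.+ 0) :* con (ℤ.+ 0) :+ :- (con (ℤ.+ 0) :* con (ℤ.+ 0)) := con (ℤ.+ 0)) ≡-refl))
      where
      a≡0 : a ≡ 0#
      a≡0 = *-cancelˡ a 0# 2≢0 (≡-trans (solve 1 (λ a → con (ℤ.+ 2) :* a := a :+ a) ≡-refl a)
              (≡-trans (cong (λ u → a + u) (-≡0⇒≡ e)) (≡-trans t (≡-sym (zeroʳ 2#)))))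

    -- Since A₃ commutes with P = A₀A₁, the traceless part of P is a multiple k A₃, so that
    -- 4 det P - (tr P)² = 4 k² det A₃ and tr (P A₂) = k tr (A₂A₃).
    module _ (A₀ A₁ A₂ A₃ : M₂)
      (tr₀ : tr A₀ ≡ 0#) (tr₁ : tr A₁ ≡ 0#) (tr₂ : tr A₂ ≡ 0#) (tr₃ : tr A₃ ≡ 0#)
      (det₀ : det A₀ ≢ 0#) (det₁ : det A₁ ≢ 0#) (det₂ : det A₂ ≢ 0#) (det₃ : det A₃ ≢ 0#)
      (tr₀₂ : tr (A₀ • A₂) ≡ 0#) (comm : Comm A₃ (A₀ • A₁))
      (P≢ : ¬ Scalar (A₀ • A₁)) (P³ : tr (A₀ • A₁) * tr (A₀ • A₁) ≡ det (A₀ • A₁))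
      (R³ : tr (A₂ • A₃) * tr (A₂ • A₃) ≡ det (A₂ • A₃)) where

      P N : M₂
      P = A₀ • A₁
      N = P • A₂
      t s : Carrier
      t = tr P
      s = tr N

      A₃∥P : ∃ λ k → k ≢ 0# × 3# * det P ≡ 4# * ((k * k) * det A₃) × s ≡ k * tr (A₂ • A₃)
      A₃∥P = lemma P A₂ A₃ tr₂ tr₃ (tr≡0⇒¬scalar A₃ tr₃ det₃) P≢ comm P³
        where
        lemma : ∀ P A₂ A₃ → tr A₂ ≡ 0# → tr A₃ ≡ 0# → ¬ Scalar A₃ → ¬ Scalar P → Comm A₃ P → tr P * tr P ≡ det P →
          ∃ λ k → k ≢ 0# × 3# * det P ≡ 4# * ((k * k) * det A₃) × tr (P • A₂) ≡ k * tr (A₂ • A₃)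
        lemma (mat a b c d) (mat x′ y′ z′ w′) (mat x y z w) tr₂ tr₃ A₃≢ P≢ comm P³ =
          coordinates (tr≡0⇒d≡-a tr₂) (tr≡0⇒d≡-a tr₃) (parallel⇒multiple _ _ _ _ _ _ A₃≢ (comm⇒parallel comm))
          where
          coordinates : w′ ≡ - x′ → w ≡ - x → (∃ λ k → a - d ≡ k * (x - w) × b ≡ k * y × c ≡ k * z) →
            ∃ λ k → k ≢ 0# × 3# * det (mat a b c d) ≡ 4# * ((k * k) * det (mat x y z w))
              × tr (mat a b c d • mat x′ y′ z′ w′) ≡ k * tr (mat x′ y′ z′ w′ • mat x y z w)
          coordinates ≡-refl ≡-refl (k , p₁ , p₂ , p₃) = k
            , (λ k≡0 → P≢ (zero-multiple k≡0 p₁ , zero-multiple k≡0 p₂ , zero-multiple k≡0 p₃))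
            -- As (tr P)² = det P, the quantity 4 det P - (tr P)² is 3 det P.
            , ≡-trans (solve 1 (λ D → con (ℤ.+ 3) :* D := con (ℤ.+ 4) :* D :- D) ≡-refl D)
                (≡-trans (cong (λ u → 4# * D - u) (≡-sym P³)) (discriminant-multiple p₁ p₂ p₃))
            , tr-multiple p₁ p₂ p₃
            where
            D : Carrier
            D = det (mat a b c d)
            zero-multiple : ∀ {k u v} → k ≡ 0# → v ≡ k * u → v ≡ 0#
            zero-multiple ≡-refl e = ≡-trans e (zeroˡ _)

      P-det : det P ≢ 0#
      P-det = •-det≢0 det₀ det₁

      N-det : det N ≢ 0#
      N-det = •-det≢0 P-det det₂

      4s²≡3det : 4# * (s * s) ≡ 3# * det N
      4s²≡3det with A₃∥P
      ... | k , _ , e , s≡ = begin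
        4# * (s * s)                                ≡⟨ cong (λ u → 4# * (u * u)) s≡ ⟩
        4# * ((k * r) * (k * r))                    ≡⟨ solve 3 (λ f k r → f :* ((k :* r) :* (k :* r)) := f :* ((k :* k) :* (r :* r))) ≡-refl 4# k r ⟩
        4# * ((k * k) * (r * r))                    ≡⟨ cong (λ u → 4# * ((k * k) * u)) (≡-trans R³ (det-• A₂ A₃)) ⟩
        4# * ((k * k) * (det A₂ * det A₃))          ≡⟨ solve 4 (λ f k a b → f :* ((k :* k) :* (a :* b)) := f :* ((k :* k) :* b) :* a) ≡-refl 4# k (det A₂) (det A₃) ⟩
        4# * ((k * k) * det A₃) * det A₂            ≡⟨ cong (_* det A₂) e ⟨
        3# * det P * det A₂                         ≡⟨ *-assoc 3# (det P) (det A₂) ⟩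
        3# * (det P * det A₂)                       ≡⟨ cong (3# *_) (det-• P A₂) ⟨
        3# * det N                                  ∎
        where r = tr (A₂ • A₃)

      4≢0 : 4# ≢ 0#
      4≢0 e = *-≢0 2≢0 2≢0 (≡-trans (solve 0 (con (ℤ.+ 2) :* con (ℤ.+ 2) := con (ℤ.+ 4)) ≡-refl) e)

      -- In characteristic 3 an element P of order 3 would be unipotent, hence in no torus; here 3 =
      -- 0 would make 4 k² det A₃ vanish.
      3≢0 : 3# ≢ 0#
      3≢0 3≡0 with A₃∥P
      ... | k , k≢0 , e , _ = *-≢0 4≢0 (*-≢0 (*-≢0 k≢0 k≢0) det₃) (≡-trans (≡-sym e) (≡-trans (cong (_* det P) 3≡0) (zeroˡ _)))

      module _ (N≢ : ¬ Scalar N) (N⁴ : Scalar ((N • N) • (N • N))) where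

        -- N² is an involution modulo scalars, hence traceless, and tr (N²) = s² - 2 det N.
        s²≡2det : s * s ≡ 2# * det N
        s²≡2det = -≡0⇒≡ (≡-trans (≡-sym (tr-square N)) (involution⇒tr≡0 (N • N) N²≢ N⁴))
          where
          -- If N² were scalar, then s = 0, and `4s²≡3det` would give 3 det N = 0.
          N²≢ : ¬ Scalar (N • N)
          N²≢ N² = *-≢0 3≢0 N-det (≡-trans (≡-sym 4s²≡3det) (≡-trans (cong (λ u → 4# * (u * u)) (involution⇒tr≡0 N N≢ N²))
            (solve 1 (λ f → f :* (con (ℤ.+ 0) :* con (ℤ.+ 0)) := con (ℤ.+ 0)) ≡-refl 4#)))

        -- Comparing 4 s² = 3 det N with s² = 2 det N leaves (4 · 2 - 3) det N = 0.
        5≡0 : 5# ≡ 0#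
        5≡0 = *-cancelʳ-0 N-det (begin
            5# * det N                           ≡⟨ solve 1 (λ d → con (ℤ.+ 5) :* d := con (ℤ.+ 4) :* (con (ℤ.+ 2) :* d) :- con (ℤ.+ 3) :* d) ≡-refl (det N) ⟩
            4# * (2# * det N) - 3# * det N       ≡⟨ cong (λ u → 4# * u - 3# * det N) s²≡2det ⟨
            4# * (s * s) - 3# * det N            ≡⟨ ≡⇒-≡0 4s²≡3det ⟩
            0#                                   ∎)

        -- With a, b, c the three determinants, s² = 2 a b c, t² = a b and tr (A₀A₂) = 0, so `gram`
        -- reduces to 4 a b c = 2 a b c + a u² + a b c for u = tr (A₁A₂). Thus u² = b c, the trace
        -- criterion for (A₁A₂)³ to be scalar.
        tr₁₂² : tr (A₁ • A₂) * tr (A₁ • A₂) ≡ det (A₁ • A₂)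
        tr₁₂² = ≡-trans (eliminate (det A₀) (det A₁) (det A₂) s t (tr (A₁ • A₂)) (tr (A₀ • A₂)) det₀
                    (gram′ A₀ A₁ A₂ tr₀ tr₁ tr₂)
                    (≡-trans s²≡2det (cong (2# *_) (≡-trans (det-• P A₂) (cong (_* det A₂) (det-• A₀ A₁)))))
                    (≡-trans P³ (det-• A₀ A₁)) tr₀₂)
                  (≡-sym (det-• A₁ A₂))
          where
          eliminate : ∀ a b c s t u v → a ≢ 0# →
            4# * (a * b * c) ≡ s * s + u * u * a + t * t * c + v * (v * b + t * u) →
            s * s ≡ 2# * (a * b * c) → t * t ≡ a * b → v ≡ 0# → u * u ≡ b * c
          eliminate a b c s t u v a≢0 g s² t² ≡-refl = *-cancelˡ _ _ a≢0 (begin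
            a * (u * u)                                     ≡⟨ solve 6 (λ s² t² a b c u →
              a :* u := (s² :+ u :* a :+ t² :* c :+ con (ℤ.+ 0) :* (con (ℤ.+ 0) :* b :+ con (ℤ.+ 0))) :- s² :- t² :* c) ≡-refl (s * s) (t * t) a b c (u * u) ⟩
            (s * s + u * u * a + t * t * c + 0# * (0# * b + 0#)) - s * s - t * t * c
              ≡⟨ cong (λ w → (s * s + u * u * a + t * t * c + w) - s * s - t * t * c) (≡-trans (zeroˡ _) (≡-sym (zeroˡ _))) ⟩
            (s * s + u * u * a + t * t * c + 0# * (0# * b + t * u)) - s * s - t * t * c
              ≡⟨ cong₂ _-_ (cong₂ _-_ (≡-sym g) s²) (cong (_* c) t²) ⟩
            4# * (a * b * c) - 2# * (a * b * c) - a * b * c ≡⟨ solve 3 (λ a b c →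
              con (ℤ.+ 4) :* (a :* b :* c) :- con (ℤ.+ 2) :* (a :* b :* c) :- a :* b :* c := a :* (b :* c)) ≡-refl a b c ⟩
            a * (b * c)                                     ∎)
          gram′ : ∀ A B C → tr A ≡ 0# → tr B ≡ 0# → tr C ≡ 0# →
            4# * (det A * det B * det C) ≡
              tr ((A • B) • C) * tr ((A • B) • C) + tr (B • C) * tr (B • C) * det A + tr (A • B) * tr (A • B) * det C
                + tr (A • C) * (tr (A • C) * det B + tr (A • B) * tr (B • C))
          gram′ (mat x y z w) (mat x′ y′ z′ w′) (mat x″ y″ z″ w″) e e′ e″ =
            coordinates (tr≡0⇒d≡-a e) (tr≡0⇒d≡-a e′) (tr≡0⇒d≡-a e″)
            where
            coordinates : w ≡ - x → w′ ≡ - x′ → w″ ≡ - x″ →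
              let A = mat x y z w ; B = mat x′ y′ z′ w′ ; C = mat x″ y″ z″ w″ in
              4# * (det A * det B * det C) ≡
                tr ((A • B) • C) * tr ((A • B) • C) + tr (B • C) * tr (B • C) * det A + tr (A • B) * tr (A • B) * det C
                  + tr (A • C) * (tr (A • C) * det B + tr (A • B) * tr (B • C))
            coordinates ≡-refl ≡-refl ≡-refl = gram

-- PGL₂ over a finite field of odd characteristic

injective⇒surjective : ∀ {n} (f : Fin n → Fin n) → Injective _≡_ _≡_ f → ∀ y → ∃ λ x → f x ≡ y
injective⇒surjective {zero} f inj ()
injective⇒surjective {suc n} f inj y with Fin.any? (λ x → f x Fin.≟ y)
... | yes p = p
... | no ∄x = contradiction (Fin.injective⇒≤ {f = λ x → punchOut (y≢ x)} λ {x} {x′} e → inj (Fin.punchOut-injective (y≢ x) (y≢ x′) e)) ℕ.1+n≰n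
  where y≢ : ∀ x → y ≢ f x
        y≢ x e = ∄x (x , ≡-sym e)

Involution : ∀ {c ℓ} (G : Group c ℓ) → Group.Carrier G → Set ℓ
Involution G x = x ∙ x ≈ ε × ¬ (x ≈ ε)
  where open Group G

-- The abstract features of PGL₂(q), q odd, on which the counting argument rests.  T x g says that g
-- lies in the maximal torus whose unique involution is x, and Sq g that det g is a square.
record TorusGroup {c ℓ} (G : Group c ℓ) : Set (c ⊔ ℓ ⊔ lsuc 0ℓ) where
  open Group G
  field
    _≈?_      : ∀ x y → Dec (x ≈ y)
    elements  : List Carrier
    complete  : ∀ g → Any (_≈ g) elements
    T         : Carrier → Carrier → Set
    T?        : ∀ x g → Dec (T x g)
    T-resp    : ∀ {x y g h} → x ≈ y → g ≈ h → T x g → T y h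
    T-refl    : ∀ x → T x x
    T-sym     : ∀ {x g} → T x g → T g x
    T-ε       : ∀ x → T x ε
    T-∙       : ∀ {x g h} → T x g → T x h → T x (g ∙ h)
    T⇒comm    : ∀ {x g} → T x g → x ∙ g ≈ g ∙ x
    T-anti    : ∀ {x g h} → x ∙ g ≈ g ∙ x → x ∙ h ≈ h ∙ x → ¬ T x g → ¬ T x h → T x (g ∙ h)
    T-unique  : ∀ {x y g} → Involution G x → Involution G y → ¬ (g ≈ ε) → T x g → T y g → x ≈ y
    T-conj    : ∀ {x g} h → T x g → T (h ∙ x ∙ h ⁻¹) (h ∙ g ∙ h ⁻¹)
    Sq        : Carrier → Set
    Sq?       : ∀ g → Dec (Sq g)
    Sq-resp   : ∀ {g h} → g ≈ h → Sq g → Sq h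
    Sq-∙      : ∀ {g h} → Sq g → Sq h → Sq (g ∙ h)
    Sq-square : ∀ g → Sq (g ∙ g)
    ¬Sq-∙     : ∀ {g h} → ¬ Sq g → ¬ Sq h → Sq (g ∙ h)
    ∃¬Sq      : ∃ λ g → ¬ Sq g

-- Squares and nonsquares in a finite field

module Squares {q : ℕ} (F : FiniteField q) where
  open FieldTheory F
  open MatrixTheory F using (2#; module OddCharacteristic)
  open FiniteField F using (enumeration)

  index : Carrier → Fin q
  index = Inverse.from enumeration

  index-injective : ∀ {x y} → index x ≡ index y → x ≡ y
  index-injective {x} {y} e = ≡-trans (≡-sym (Inverse.strictlyInverseˡ enumeration x))
    (≡-trans (cong (Inverse.to enumeration) e) (Inverse.strictlyInverseˡ enumeration y))

  to-injective : ∀ i j → Inverse.to enumeration i ≡ Inverse.to enumeration j → i ≡ j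
  to-injective i j e = ≡-trans (≡-sym (Inverse.strictlyInverseʳ enumeration i))
    (≡-trans (cong index e) (Inverse.strictlyInverseʳ enumeration j))

  endo-injective⇒surjective : (f : Carrier → Carrier) → Injective _≡_ _≡_ f → ∀ y → ∃ λ x → f x ≡ y
  endo-injective⇒surjective f inj y
    with injective⇒surjective (λ i → index (f (Inverse.to enumeration i)))
           (λ {i} {j} e → to-injective i j (inj (index-injective e))) (index y)
  ... | i , e = Inverse.to enumeration i , index-injective e

  Square : Carrier → Set
  Square x = ∃ λ r → x ≡ r * r

  Square? : ∀ x → Dec (Square x)
  Square? x = ∃? λ r → x ≟ r * r

  Square-* : ∀ {x y} → Square x → Square y → Square (x * y)
  Square-* (r , ≡-refl) (s , ≡-refl) = r * s , solve 2 (λ r s → (r :* r) :* (s :* s) := (r :* s) :* (r :* s)) ≡-refl r s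

  module _ (2≢0 : 2# ≢ 0#) where

    x≡-x⇒x≡0 : ∀ {x} → x ≡ - x → x ≡ 0#
    x≡-x⇒x≡0 {x} e = *-cancelˡ x 0# 2≢0 (≡-trans (solve 1 (λ x → con (ℤ.+ 2) :* x := x :- :- x) ≡-refl x)
      (≡-trans (≡⇒-≡0 e) (≡-sym (zeroʳ _))))

    -- If every element had a root, choosing roots would be injective, hence surjective. Then 1 and
    -- - 1 would both be chosen roots, necessarily of the same element 1.
    ∃-nonsquare : ∃ λ ν → ¬ Square ν
    ∃-nonsquare = decidable-stable (∃? λ ν → ¬? (Square? ν)) λ ∄ν →
      let sqrt : ∀ x → Square x
          sqrt x = decidable-stable (Square? x) λ n → ∄ν (x , n)
          sqrt-injective : Injective _≡_ _≡_ (λ x → proj₁ (sqrt x))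
          sqrt-injective {x} {y} e = ≡-trans (proj₂ (sqrt x)) (≡-trans (cong (λ r → r * r) e) (≡-sym (proj₂ (sqrt y))))
          x , x↦1  = endo-injective⇒surjective _ sqrt-injective 1#
          y , y↦-1 = endo-injective⇒surjective _ sqrt-injective (- 1#)
          x≡y : x ≡ y
          x≡y = ≡-trans (proj₂ (sqrt x)) (≡-trans (cong (λ r → r * r) x↦1) (≡-trans
                  (solve 0 (con (ℤ.+ 1) :* con (ℤ.+ 1) := (:- con (ℤ.+ 1)) :* (:- con (ℤ.+ 1))) ≡-refl)
                  (≡-trans (cong (λ r → r * r) (≡-sym y↦-1)) (≡-sym (proj₂ (sqrt y))))))
      in 1≢0 (x≡-x⇒x≡0 (≡-trans (≡-sym x↦1) (≡-trans (cong (λ z → proj₁ (sqrt z)) x≡y) y↦-1)))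

    -- Choosing one of x and -x, the map sending the chosen elements to x² and the others to ν x²
    -- is injective, hence surjective.
    nonsquare-coset : ∀ {ν} → ¬ Square ν → ∀ {y} → ¬ Square y → ∃ λ x → y ≡ ν * (x * x)
    nonsquare-coset {ν} ν≢ {y} y≢ = preimage (endo-injective⇒surjective f f-injective y)
      where
      Chosen : Carrier → Set
      Chosen x = toℕ (index x) ≤ toℕ (index (- x))
      Chosen? : ∀ x → Dec (Chosen x)
      Chosen? x = toℕ (index x) ℕ.≤? toℕ (index (- x))
      value : ∀ x → Dec (Chosen x) → Carrier
      value x (yes _) = x * x
      value x (no _)  = ν * (x * x)
      f : Carrier → Carrier
      f x = value x (Chosen? x)
      neg-neg : ∀ x → - - x ≡ x
      neg-neg = solve 1 (λ x → :- :- x := x) ≡-refl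
      both-chosen : ∀ {x} → Chosen x → Chosen (- x) → x ≡ - x
      both-chosen {x} c c′ = index-injective (Fin.toℕ-injective (ℕ.≤-antisym c (subst (λ z → toℕ (index (- x)) ≤ toℕ (index z)) (neg-neg x) c′)))
      neither-chosen : ∀ {x} → ¬ Chosen x → ¬ Chosen (- x) → x ≡ - x
      neither-chosen {x} c c′ = ⊥-elim (c′ (subst (λ z → toℕ (index (- x)) ≤ toℕ (index z)) (≡-sym (neg-neg x)) (ℕ.<⇒≤ (ℕ.≰⇒> c))))
      mixed : ∀ x z → ¬ Chosen z → x * x ≡ ν * (z * z) → x ≡ z
      mixed x z ¬c e = ⊥-elim (ν≢ (x * i , (begin
          ν                       ≡⟨ *-identityʳ ν ⟨
          ν * 1#                  ≡⟨ cong (ν *_) (≡-trans (≡-sym (*-identityˡ 1#)) (cong (λ w → w * w) (≡-sym (*-inverseʳ z z≢0)))) ⟩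
          ν * ((z * i) * (z * i)) ≡⟨ solve 3 (λ ν z i → ν :* ((z :* i) :* (z :* i)) := (ν :* (z :* z)) :* (i :* i)) ≡-refl ν z i ⟩
          (ν * (z * z)) * (i * i) ≡⟨ cong (_* (i * i)) e ⟨
          (x * x) * (i * i)       ≡⟨ solve 2 (λ x i → (x :* x) :* (i :* i) := (x :* i) :* (x :* i)) ≡-refl x i ⟩
          (x * i) * (x * i)       ∎)))
        where
        open ≡-Reasoning
        z≢0 : z ≢ 0#
        -- 0 is its own negative and therefore chosen.
        z≢0 ≡-refl = ¬c (subst (λ w → toℕ (index 0#) ≤ toℕ (index w)) (solve 0 (con (ℤ.+ 0) := :- con (ℤ.+ 0)) ≡-refl) ℕ.≤-refl)
        i = z ⁻¹[ z≢0 ]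
      ν≢0 : ν ≢ 0#
      ν≢0 ≡-refl = ν≢ (0# , ≡-sym (zeroˡ 0#))
      injective : ∀ {x z} (p : Dec (Chosen x)) (r : Dec (Chosen z)) → value x p ≡ value z r → x ≡ z
      injective {x} {z} (yes c) (yes c′) e with square-root-unique x z e
      ... | inj₁ p    = p
      ... | inj₂ ≡-refl = ≡-sym (both-chosen c′ c)
      injective {x} {z} (no c) (no c′) e with square-root-unique x z (*-cancelˡ _ _ ν≢0 e)
      ... | inj₁ p    = p
      ... | inj₂ ≡-refl = ≡-sym (neither-chosen c′ c)
      injective {x} {z} (yes _) (no c′) e = mixed x z c′ e
      injective {x} {z} (no c) (yes _) e = ≡-sym (mixed z x c (≡-sym e))
      f-injective : Injective _≡_ _≡_ f
      f-injective {x} {z} = injective (Chosen? x) (Chosen? z)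
      preimage : (∃ λ x → f x ≡ y) → ∃ λ x → y ≡ ν * (x * x)
      preimage (x , e) = by (Chosen? x) e
        where by : (p : Dec (Chosen x)) → value x p ≡ y → ∃ λ x → y ≡ ν * (x * x)
              by (yes _) e = contradiction (x , ≡-sym e) y≢
              by (no _)  e = x , ≡-sym e

    ¬Square-* : ∀ {x y} → ¬ Square x → ¬ Square y → Square (x * y)
    ¬Square-* {x} {y} x≢ y≢ with nonsquare-coset x≢ y≢
    ... | r , ≡-refl = x * r , solve 2 (λ x r → x :* (x :* (r :* r)) := (x :* r) :* (x :* r)) ≡-refl x r

module PGL₂ {q : ℕ} (F : FiniteField q) {c ℓ} (G : Group c ℓ) (iso : Matrices.IsoPGL₂ F G) where
  open FieldTheory F hiding (_≟_)
  open MatrixTheory F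
  open Matrices F
  open IsoPGL₂ iso
  open Group G renaming (Carrier to |G|; refl to ≈-refl; sym to ≈-sym; trans to ≈-trans)
    using (_≈_; _∙_; ε; _⁻¹; identityˡ; inverseˡ; inverseʳ; assoc; ∙-congˡ; ∙-congʳ; ∙-cong)
  open Squares F using (Square; Square?; Square-*; ¬Square-*; ∃-nonsquare)

  M : |G| → M₂
  M g = proj₁ (φ g)

  M-det : ∀ g → det (M g) ≢ 0#
  M-det g = proj₂ (φ g)

  M-∙ : ∀ g h → M (g ∙ h) ∼ (M g • M h)
  M-∙ g h = ∼-trans (φ-hom g h) (∼-reflexive (≡-sym (•≡· (M g) (M h))))

  M-ε : M ε ∼ I
  M-ε = cancel (∼-trans (∼-sym (φ-cong (identityˡ ε))) (M-∙ ε ε))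
    where
    cancel : M ε ∼ (M ε • M ε) → M ε ∼ I
    cancel (k , k≢0 , e) = ∼-sym (k , k≢0 , •-cancelˡ (M ε) (M-det ε)
      (≡-trans (scale-•ʳ k (M ε) I) (≡-trans (cong (scale k) (•-identityʳ (M ε))) e)))

  _≈?_ : ∀ x y → Dec (x ≈ y)
  x ≈? y = map′ (φ-inj x y) φ-cong (M x ∼? M y)

  M-scalar⇒≈ε : ∀ {g} → Scalar (M g) → g ≈ ε
  M-scalar⇒≈ε {g} s = φ-inj g ε (∼-trans (scalar⇒∼I (M g) (M-det g) s) (∼-sym M-ε))

  ∼M⇒scalar : ∀ {g A} → M g ∼ A → g ≈ ε → Scalar A
  ∼M⇒scalar {g} {A} g∼A g≈ε = ∼I⇒scalar A (∼-trans (∼-sym g∼A) (∼-trans (φ-cong g≈ε) M-ε))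

  scalar⇒≈ε : ∀ {g A} → M g ∼ A → Scalar A → g ≈ ε
  scalar⇒≈ε {g} {A} g∼A s = φ-inj g ε (∼-trans g∼A (∼-trans (scalar⇒∼I A A-det s) (∼-sym M-ε)))
    where A-det : det A ≢ 0#
          A-det = ∼-det≢0 g∼A (M-det g)

  ¬≈ε⇒¬scalar : ∀ {g} → ¬ (g ≈ ε) → ¬ Scalar (M g)
  ¬≈ε⇒¬scalar g≢ s = g≢ (M-scalar⇒≈ε s)

  involution-trace : ∀ {x} → Involution G x → tr (M x) ≡ 0#
  involution-trace {x} (x² , x≢ε) = involution⇒tr≡0 (M x) (¬≈ε⇒¬scalar x≢ε) (∼M⇒scalar (M-∙ x x) x²)

  commute⇒∼ : ∀ {x g} → x ∙ g ≈ g ∙ x → (M x • M g) ∼ (M g • M x)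
  commute⇒∼ {x} {g} e = ∼-trans (∼-sym (M-∙ x g)) (∼-trans (φ-cong e) (M-∙ g x))

  commute⇒split : ∀ {x g} → x ∙ g ≈ g ∙ x → Comm (M x) (M g) ⊎ AntiComm (M x) (M g)
  commute⇒split {x} {g} e = ∼-comm-split (M x) (M g) (M-det x) (M-det g) (commute⇒∼ e)

  -- The matrices commute exactly, not merely up to a scalar; this does not depend on the
  -- representatives, as both products scale alike. The matrices commuting with that of an
  -- involution x are spanned by I and `M x`, and the invertible ones form its torus.
  T : |G| → |G| → Set
  T x g = Comm (M x) (M g)

  T⇒comm : ∀ {x g} → T x g → x ∙ g ≈ g ∙ x
  T⇒comm {x} {g} t = φ-inj _ _ (∼-trans (M-∙ x g) (∼-trans (∼-reflexive t) (∼-sym (M-∙ g x))))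

  T-resp : ∀ {x y g h} → x ≈ y → g ≈ h → T x g → T y h
  T-resp x≈y g≈h = Comm-resp-∼ (φ-cong x≈y) (φ-cong g≈h)

  T-ε : ∀ x → T x ε
  T-ε x = Comm-resp-∼ ∼-refl (∼-sym M-ε) (Comm-I (M x))

  T-∙ : ∀ {x g h} → T x g → T x h → T x (g ∙ h)
  T-∙ {x} {g} {h} a b = Comm-resp-∼ ∼-refl (∼-sym (M-∙ g h)) (Comm-• a b)

  Sq : |G| → Set
  Sq g = Square (det (M g))

  Square-∼ : ∀ {A B} → A ∼ B → Square (det A) → Square (det B)
  Square-∼ {A} (k , _ , ≡-refl) s = subst Square (≡-sym (det-scale k A)) (Square-* (k , ≡-refl) s)

  -- Each group element is listed once for every matrix representing it; `nub` removes these
  -- repetitions before anything is counted.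
  elements : List |G|
  elements = concatMap (λ a → concatMap (λ b → concatMap (λ c → concatMap (λ d → preimage (mat a b c d)) scalars) scalars) scalars) scalars
    module Enumeration where
    scalars : List Carrier
    scalars = tabulate (Inverse.to (FiniteField.enumeration F))
    preimage : M₂ → List |G|
    preimage A with FieldTheory._≟_ F (det A) 0#
    ... | yes _ = []
    ... | no A≢0 = proj₁ (φ-surj (A , A≢0)) ∷ []
    scalars-complete : ∀ {p} {P : Carrier → Set p} x → P x → Any P scalars
    scalars-complete {P = P} x p = Any.tabulate⁺ (Inverse.from (FiniteField.enumeration F) x)
      (subst P (≡-sym (Inverse.strictlyInverseˡ (FiniteField.enumeration F) x)) p)
    preimage-complete : ∀ g A → M g ≡ A → Any (_≈ g) (preimage A)
    preimage-complete g A e with FieldTheory._≟_ F (det A) 0#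
    ... | yes A≡0 = contradiction (≡-trans (cong det e) A≡0) (M-det g)
    ... | no A≢0 = here (φ-inj _ g (∼-trans (proj₂ (φ-surj (A , A≢0))) (∼-reflexive (≡-sym e))))

  complete : ∀ g → Any (_≈ g) elements
  complete g = Any.concatMap⁺ _ (scalars-complete (M₂.a A) (Any.concatMap⁺ _ (scalars-complete (M₂.b A)
    (Any.concatMap⁺ _ (scalars-complete (M₂.c A) (Any.concatMap⁺ _ (scalars-complete (M₂.d A) (preimage-complete g A ≡-refl))))))))
    where open Enumeration
          A = M g

  module _ (2≢0 : 2# ≢ 0#) where
    open OddCharacteristic 2≢0

    T-unique : ∀ {x y g} → Involution G x → Involution G y → ¬ (g ≈ ε) → T x g → T y g → x ≈ y
    T-unique {x} {y} {g} ix iy g≢ε tx ty = φ-inj x y (comm-involutions {M x} {M y} (¬≈ε⇒¬scalar (proj₂ ix)) (¬≈ε⇒¬scalar (proj₂ iy))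
      (involution-trace ix) (involution-trace iy) (comm-trans {M x} {M g} {M y} (¬≈ε⇒¬scalar g≢ε) (≡-sym tx) (≡-sym ty)))

    T-anti : ∀ {x g h} → x ∙ g ≈ g ∙ x → x ∙ h ≈ h ∙ x → ¬ T x g → ¬ T x h → T x (g ∙ h)
    T-anti {x} {g} {h} xg xh ¬tg ¬th = split (commute⇒split xg) (commute⇒split xh)
      where
      split : Comm (M x) (M g) ⊎ AntiComm (M x) (M g) → Comm (M x) (M h) ⊎ AntiComm (M x) (M h) → T x (g ∙ h)
      split (inj₁ t) _        = contradiction t ¬tg
      split (inj₂ _) (inj₁ t) = contradiction t ¬th
      split (inj₂ a) (inj₂ b) = Comm-resp-∼ ∼-refl (∼-sym (M-∙ g h)) (AntiComm-• {M x} {M g} {M h} a b)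

    T-conj : ∀ {x g} h → T x g → T (h ∙ x ∙ h ⁻¹) (h ∙ g ∙ h ⁻¹)
    T-conj {x} {g} h t = Comm-resp-∼ (∼-sym (conj x)) (∼-sym (conj g)) (conjugate (∼-trans (∼-sym (M-∙ (h ⁻¹) h)) (∼-trans (φ-cong (inverseˡ h)) M-ε)) t)
      where
      conj : ∀ y → M (h ∙ y ∙ h ⁻¹) ∼ (M h • M y • M (h ⁻¹))
      conj y = ∼-trans (M-∙ (h ∙ y) (h ⁻¹)) (•-cong-∼ (M-∙ h y) ∼-refl)

    torusGroup : TorusGroup G
    torusGroup = record
      { _≈?_ = _≈?_
      ; elements = elements
      ; complete = complete
      ; T = T
      ; T? = λ x g → _ ≟ᴹ _
      ; T-resp = T-resp
      ; T-refl = λ _ → ≡-refl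
      ; T-sym = ≡-sym
      ; T-ε = T-ε
      ; T-∙ = T-∙
      ; T⇒comm = T⇒comm
      ; T-anti = T-anti
      ; T-unique = T-unique
      ; T-conj = T-conj
      ; Sq = Sq
      ; Sq? = λ g → Square? (det (M g))
      ; Sq-resp = λ e → Square-∼ (φ-cong e)
      ; Sq-∙ = λ {g} {h} a b → Square-∼ (∼-sym (M-∙ g h)) (subst Square (≡-sym (det-• (M g) (M h))) (Square-* a b))
      ; Sq-square = λ g → Square-∼ (∼-sym (M-∙ g g)) (det (M g) , det-• (M g) (M g))
      ; ¬Sq-∙ = λ {g} {h} a b → Square-∼ (∼-sym (M-∙ g h)) (subst Square (≡-sym (det-• (M g) (M h))) (¬Square-* 2≢0 a b))
      ; ∃¬Sq = nonsquare (∃-nonsquare 2≢0)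
      }
      where
      nonsquare : (∃ λ ν → ¬ Square ν) → ∃ λ g → ¬ Sq g
      nonsquare (ν , ν≢) = proj₁ g , λ s → ν≢ (subst Square det≡ν (Square-∼ (proj₂ g) s))
        where
        det≡ν : det (mat ν 0# 0# 1#) ≡ ν
        det≡ν = solve 1 (λ ν → ν :* con (ℤ.+ 1) :+ :- (con (ℤ.+ 0) :* con (ℤ.+ 0)) := ν) ≡-refl ν
        g = φ-surj (mat ν 0# 0# 1# , λ e → ν≢ (0# , ≡-trans (≡-trans (≡-sym det≡ν) e) (≡-sym (zeroˡ 0#))))

-- Counting

module FiniteSums where
  open import Data.Nat using (_+_; _*_; _⊓_)
  open import Data.Nat.Properties using (≤-refl; ≤-trans; ≤-reflexive; ≤-antisym; +-mono-≤; +-assoc; +-comm; *-comm; *-zeroʳ; *-identityʳ; *-distribˡ-+; +-identityʳ; m≤m+n; m≤n+m; module ≤-Reasoning)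

  private variable
    p r : Level
    P : Set p
    R : Set r

  𝟙 : Dec P → ℕ
  𝟙 (yes _) = 1
  𝟙 (no _)  = 0

  𝟙-mono : (P? : Dec P) (R? : Dec R) → (P → R) → 𝟙 P? ≤ 𝟙 R?
  𝟙-mono (no _)  _       f = z≤n
  𝟙-mono (yes _) (yes _) f = ≤-refl
  𝟙-mono (yes p) (no ¬r) f = contradiction (f p) ¬r

  𝟙-true : (P? : Dec P) → P → 𝟙 P? ≡ 1
  𝟙-true (yes _) p = ≡-refl
  𝟙-true (no ¬p) p = contradiction p ¬p

  𝟙-false : (P? : Dec P) → ¬ P → 𝟙 P? ≡ 0
  𝟙-false (yes p) ¬p = contradiction p ¬p
  𝟙-false (no _)  ¬p = ≡-refl

  𝟙-cong : (P? : Dec P) (R? : Dec R) → (P → R) → (R → P) → 𝟙 P? ≡ 𝟙 R?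
  𝟙-cong P? R? f g = ≤-antisym (𝟙-mono P? R? f) (𝟙-mono R? P? g)

  𝟙-positive : (P? : Dec P) → 1 ≤ 𝟙 P? → P
  𝟙-positive (yes p) _ = p

  module _ {a} {A : Set a} where

    ∑ : List A → (A → ℕ) → ℕ
    ∑ []       f = 0
    ∑ (x ∷ xs) f = f x + ∑ xs f

    ∑-mono : ∀ xs {f g} → (∀ x → f x ≤ g x) → ∑ xs f ≤ ∑ xs g
    ∑-mono []       f≤g = z≤n
    ∑-mono (x ∷ xs) f≤g = +-mono-≤ (f≤g x) (∑-mono xs f≤g)

    ∑-cong : ∀ xs {f g} → (∀ x → f x ≡ g x) → ∑ xs f ≡ ∑ xs g
    ∑-cong []       f≡g = ≡-refl
    ∑-cong (x ∷ xs) f≡g = cong₂ _+_ (f≡g x) (∑-cong xs f≡g)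

    ∑-+ : ∀ xs f g → ∑ xs (λ x → f x + g x) ≡ ∑ xs f + ∑ xs g
    ∑-+ []       f g = ≡-refl
    ∑-+ (x ∷ xs) f g = begin
      (f x + g x) + ∑ xs (λ y → f y + g y)  ≡⟨ cong ((f x + g x) +_) (∑-+ xs f g) ⟩
      (f x + g x) + (∑ xs f + ∑ xs g)       ≡⟨ +-assoc (f x) (g x) _ ⟩
      f x + (g x + (∑ xs f + ∑ xs g))       ≡⟨ cong (f x +_) (≡-trans (≡-sym (+-assoc (g x) _ _)) (≡-trans (cong (_+ ∑ xs g) (+-comm (g x) _)) (+-assoc (∑ xs f) _ _))) ⟩
      f x + (∑ xs f + (g x + ∑ xs g))       ≡⟨ +-assoc (f x) _ _ ⟨
      (f x + ∑ xs f) + (g x + ∑ xs g)       ∎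
      where open ≡-Reasoning

    ∑-* : ∀ xs k f → ∑ xs (λ x → k * f x) ≡ k * ∑ xs f
    ∑-* []       k f = ≡-sym (*-zeroʳ k)
    ∑-* (x ∷ xs) k f = ≡-trans (cong (k * f x +_) (∑-* xs k f)) (≡-sym (*-distribˡ-+ k (f x) _))

    ∑-zero : ∀ xs {f} → (∀ x → f x ≡ 0) → ∑ xs f ≡ 0
    ∑-zero []       f≡0 = ≡-refl
    ∑-zero (x ∷ xs) f≡0 = cong₂ _+_ (f≡0 x) (∑-zero xs f≡0)

    ∑-positive : ∀ xs f → 1 ≤ ∑ xs f → ∃ λ x → 1 ≤ f x
    ∑-positive (x ∷ xs) f p with f x in eq
    ... | zero  = ∑-positive xs f p
    ... | suc n = x , subst (1 ≤_) (≡-sym eq) (s≤s z≤n)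

  ∑-swap : ∀ {a b} {A : Set a} {B : Set b} (xs : List A) (ys : List B) (f : A → B → ℕ) →
           ∑ xs (λ x → ∑ ys (f x)) ≡ ∑ ys (λ y → ∑ xs (λ x → f x y))
  ∑-swap []       ys f = ≡-sym (∑-zero ys λ _ → ≡-refl)
  ∑-swap (x ∷ xs) ys f = ≡-trans (cong (∑ ys (f x) +_) (∑-swap xs ys f)) (≡-sym (∑-+ ys (f x) _))

  module Counting {a ℓ} (S : DecSetoid a ℓ) where
    open DecSetoid S renaming (Carrier to A; refl to ≈-refl; sym to ≈-sym; trans to ≈-trans)

    count : A → List A → ℕ
    count y xs = ∑ xs λ x → 𝟙 (x ≟ y)

    count-cong : ∀ {y z} xs → y ≈ z → count y xs ≡ count z xs
    count-cong {y} {z} xs y≈z = ∑-cong xs λ x → 𝟙-cong (x ≟ y) (x ≟ z) (λ e → ≈-trans e y≈z) (λ e → ≈-trans e (≈-sym y≈z))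

    -- Separate from `nub`, so that abstracting the count in a `with` lets `nub (x ∷ xs)` reduce.
    nub-step : A → List A → ℕ → List A
    nub-step x xs zero    = x ∷ xs
    nub-step x xs (suc _) = xs

    nub : List A → List A
    nub []       = []
    nub (x ∷ xs) = nub-step x (nub xs) (count x (nub xs))

    count-nub≤1 : ∀ xs y → count y (nub xs) ≤ 1
    count-nub≤1 []       y = z≤n
    count-nub≤1 (x ∷ xs) y with count x (nub xs) in eq
    ... | suc _ = count-nub≤1 xs y
    ... | zero with x ≟ y
    ...   | yes x≈y = ≤-reflexive (cong suc (≡-trans (≡-sym (count-cong (nub xs) x≈y)) eq))
    ...   | no  _   = count-nub≤1 xs y

    count-nub≥1 : ∀ xs {y} → Any (_≈ y) xs → 1 ≤ count y (nub xs)
    count-nub≥1 (x ∷ xs) {y} (here x≈y) with count x (nub xs) in eq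
    ... | suc _ = subst (1 ≤_) (≡-trans (≡-sym eq) (count-cong (nub xs) x≈y)) (s≤s z≤n)
    ... | zero  = ≤-trans (≤-reflexive (≡-sym (𝟙-true (x ≟ y) x≈y))) (m≤m+n _ _)
    count-nub≥1 (x ∷ xs) {y} (there y∈xs) with count x (nub xs)
    ... | suc _ = count-nub≥1 xs y∈xs
    ... | zero  = ≤-trans (count-nub≥1 xs y∈xs) (m≤n+m _ _)

    module Finite (elements : List A) (complete : ∀ y → Any (_≈ y) elements) where

      all : List A
      all = nub elements

      count-all : ∀ y → count y all ≡ 1
      count-all y = ≤-antisym (count-nub≤1 elements y) (count-nub≥1 elements (complete y))

      # : (A → ℕ) → ℕ
      # = ∑ all

      #-at : ∀ a (f : A → ℕ) → (∀ {x} → x ≈ a → f x ≡ f a) → # (λ x → 𝟙 (x ≟ a) * f x) ≡ f a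
      #-at a f f-cong = begin
        # (λ x → 𝟙 (x ≟ a) * f x)    ≡⟨ ∑-cong all pointwise ⟩
        # (λ x → f a * 𝟙 (x ≟ a))    ≡⟨ ∑-* all (f a) _ ⟩
        f a * count a all            ≡⟨ cong (f a *_) (count-all a) ⟩
        f a * 1                      ≡⟨ *-identityʳ (f a) ⟩
        f a                          ∎
        where
        open ≡-Reasoning
        pointwise : ∀ x → 𝟙 (x ≟ a) * f x ≡ f a * 𝟙 (x ≟ a)
        pointwise x with x ≟ a
        ... | yes x≈a = ≡-trans (+-identityʳ _) (≡-trans (f-cong x≈a) (≡-sym (*-identityʳ _)))
        ... | no _    = ≡-sym (*-zeroʳ (f a))

      -- σ need not permute the list `all` literally, only up to ≈. The change of variables
      -- therefore expands f (σ x) as the sum over y of [y ≈ σ x] f y and exchanges the two sums.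
      #-reindex : ∀ (σ τ : A → A) → (∀ {x y} → y ≈ σ x → x ≈ τ y) → (∀ {x y} → x ≈ τ y → y ≈ σ x) →
                  ∀ (f : A → ℕ) → (∀ {x y} → x ≈ y → f x ≡ f y) → # (λ x → f (σ x)) ≡ # f
      #-reindex σ τ to from f f-cong = begin
        # (λ x → f (σ x))                             ≡⟨ ∑-cong all (λ x → #-at (σ x) f f-cong) ⟨
        # (λ x → # (λ y → 𝟙 (y ≟ σ x) * f y))         ≡⟨ ∑-swap all all _ ⟩
        # (λ y → # (λ x → 𝟙 (y ≟ σ x) * f y))         ≡⟨ ∑-cong all (λ y → ∑-cong all (λ x →
             cong (_* f y) (𝟙-cong (y ≟ σ x) (x ≟ τ y) to from))) ⟩
        # (λ y → # (λ x → 𝟙 (x ≟ τ y) * f y))         ≡⟨ ∑-cong all (λ y → #-at (τ y) (λ _ → f y) (λ _ → ≡-refl)) ⟩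
        # f                                           ∎
        where open ≡-Reasoning

      module _ {p} {P : A → Set p} (P? : ∀ x → Dec (P x)) (P-resp : ∀ {x y} → x ≈ y → P y → P x) where

        -- Double counting of the coincidences between elements x of `all` and entries e of xs: each
        -- e meets exactly one x, and each x at most one e.
        distinct≤# : ∀ xs → All P xs → AllPairs (λ x y → ¬ (x ≈ y)) xs → length xs ≤ # (λ x → 𝟙 (P? x))
        distinct≤# xs Pxs distinct = begin
          length xs                                ≡⟨ ones xs ⟨
          ∑ xs (λ e → count e all)                 ≡⟨ ∑-swap all xs _ ⟨
          # (λ x → ∑ xs (λ e → 𝟙 (x ≟ e)))         ≤⟨ ∑-mono all (λ x → at-most x xs Pxs distinct) ⟩
          # (λ x → 𝟙 (P? x))                       ∎
          where
          open ≤-Reasoning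
          ones : ∀ xs → ∑ xs (λ e → count e all) ≡ length xs
          ones []       = ≡-refl
          ones (x ∷ xs) = cong₂ _+_ (count-all x) (ones xs)
          absent : ∀ {x e} xs → x ≈ e → All (λ y → ¬ (e ≈ y)) xs → ∑ xs (λ y → 𝟙 (x ≟ y)) ≡ 0
          absent []       _   []       = ≡-refl
          absent {x} (y ∷ xs) x≈e (e≉y ∷ ps) = cong₂ _+_ (𝟙-false (x ≟ y) λ x≈y → e≉y (≈-trans (≈-sym x≈e) x≈y)) (absent xs x≈e ps)
          at-most : ∀ x xs → All P xs → AllPairs (λ x y → ¬ (x ≈ y)) xs → ∑ xs (λ e → 𝟙 (x ≟ e)) ≤ 𝟙 (P? x)
          at-most x []       _          _        = z≤n
          at-most x (e ∷ xs) (Pe ∷ Pxs) (d ∷ ds) with x ≟ e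
          ... | yes x≈e = ≤-reflexive (≡-trans (cong suc (absent xs x≈e d)) (≡-sym (𝟙-true (P? x) (P-resp x≈e Pe))))
          ... | no  _   = at-most x xs Pxs ds

-- Counting a subgroup by its tori

module TorusCounting {c ℓ h} (G : Group c ℓ) (TG : TorusGroup G)
  (H : Group.Carrier G → Set h) (H? : ∀ g → Dec (H g))
  (H-resp : ∀ {x y} → Group._≈_ G x y → H x → H y)
  (H-ε : H (Group.ε G)) (H-∙ : ∀ {x y} → H x → H y → H (Group._∙_ G x y)) (H-⁻¹ : ∀ {x} → H x → H (Group._⁻¹ G x)) where
  open FiniteSums
  open import Data.Nat using (_+_; _*_; _<_; _⊓_)
  open import Data.Nat.Properties using (≤-refl; ≤-trans; ≤-reflexive; +-mono-≤; +-monoˡ-≤; +-monoʳ-≤; *-monoʳ-≤; *-monoˡ-≤; *-cancelˡ-≤; m≤m+n; m≤n+m; +-identityʳ; *-identityʳ; *-zeroʳ; module ≤-Reasoning; <⇒≱)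
  open Group G renaming (Carrier to |G|)
  open Algebra.Properties.Group G
  open TorusGroup TG

  decSetoid : DecSetoid c ℓ
  decSetoid = record { isDecEquivalence = record { isEquivalence = isEquivalence ; _≟_ = _≈?_ } }

  open Counting decSetoid
  open Finite elements complete
  open import Relation.Binary.Reasoning.Setoid setoid using (begin_; step-≈-⟩; step-≈-⟨; _∎)

  conj : |G| → |G| → |G|
  conj h x = h ∙ x ∙ h ⁻¹

  conj⁻¹ : |G| → |G| → |G|
  conj⁻¹ h x = h ⁻¹ ∙ (x ∙ h)

  conj-inverse : ∀ h {x y} → y ≈ conj h x → x ≈ conj⁻¹ h y
  conj-inverse h {x} {y} e = sym (begin
    h ⁻¹ ∙ (y ∙ h)                   ≈⟨ ∙-congˡ (∙-congʳ e) ⟩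
    h ⁻¹ ∙ (h ∙ x ∙ h ⁻¹ ∙ h)        ≈⟨ ∙-congˡ (assoc _ _ _) ⟩
    h ⁻¹ ∙ (h ∙ x ∙ (h ⁻¹ ∙ h))      ≈⟨ ∙-congˡ (trans (∙-congˡ (inverseˡ h)) (identityʳ _)) ⟩
    h ⁻¹ ∙ (h ∙ x)                   ≈⟨ ⁻¹-cancelˡ ⟩
    x                                ∎)
    where ⁻¹-cancelˡ : h ⁻¹ ∙ (h ∙ x) ≈ x
          ⁻¹-cancelˡ = trans (sym (assoc _ _ _)) (trans (∙-congʳ (inverseˡ h)) (identityˡ x))

  conj-inverse′ : ∀ h {x y} → x ≈ conj⁻¹ h y → y ≈ conj h x
  conj-inverse′ h {x} {y} e = sym (begin
    h ∙ x ∙ h ⁻¹                     ≈⟨ ∙-congʳ (∙-congˡ e) ⟩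
    h ∙ (h ⁻¹ ∙ (y ∙ h)) ∙ h ⁻¹      ≈⟨ ∙-congʳ (trans (sym (assoc _ _ _)) (trans (∙-congʳ (inverseʳ h)) (identityˡ _))) ⟩
    y ∙ h ∙ h ⁻¹                     ≈⟨ assoc _ _ _ ⟩
    y ∙ (h ∙ h ⁻¹)                   ≈⟨ trans (∙-congˡ (inverseʳ h)) (identityʳ y) ⟩
    y                                ∎)

  conj-cong : ∀ h {x y} → x ≈ y → conj h x ≈ conj h y
  conj-cong h e = ∙-congʳ (∙-congˡ e)

  conj-ε : ∀ h → conj h ε ≈ ε
  conj-ε h = trans (∙-congʳ (identityʳ h)) (inverseʳ h)

  conj-injective : ∀ h {x y} → conj h x ≈ conj h y → x ≈ y
  conj-injective h e = ∙-cancelˡ h _ _ (∙-cancelʳ (h ⁻¹) _ _ e)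

  conj-∙ : ∀ h x y → conj h x ∙ conj h y ≈ conj h (x ∙ y)
  conj-∙ h x y = begin
    (h ∙ x ∙ h ⁻¹) ∙ (h ∙ y ∙ h ⁻¹)    ≈⟨ assoc _ _ _ ⟩
    h ∙ x ∙ (h ⁻¹ ∙ (h ∙ y ∙ h ⁻¹))    ≈⟨ ∙-congˡ (sym (assoc _ _ _)) ⟩
    h ∙ x ∙ (h ⁻¹ ∙ (h ∙ y) ∙ h ⁻¹)    ≈⟨ ∙-congˡ (∙-congʳ (trans (sym (assoc _ _ _)) (trans (∙-congʳ (inverseˡ h)) (identityˡ y)))) ⟩
    h ∙ x ∙ (y ∙ h ⁻¹)                 ≈⟨ sym (assoc _ _ _) ⟩
    h ∙ x ∙ y ∙ h ⁻¹                   ≈⟨ ∙-congʳ (assoc _ _ _) ⟩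
    h ∙ (x ∙ y) ∙ h ⁻¹                 ∎

  H-conj : ∀ {h x} → H h → H x → H (conj h x)
  H-conj Hh Hx = H-∙ (H-∙ Hh Hx) (H-⁻¹ Hh)

  conj-involution : ∀ h {x} → Involution G x → Involution G (conj h x)
  conj-involution h {x} (x² , x≉ε) = trans (conj-∙ h x x) (trans (conj-cong h x²) (conj-ε h))
                                   , λ e → x≉ε (conj-injective h (trans e (sym (conj-ε h))))

  -- Only y is required to lie in H: the count is also applied to an involution x outside H whose
  -- torus meets H.
  Torus : |G| → |G| → Set _
  Torus x y = H y × T x y

  Torus? : ∀ x y → Dec (Torus x y)
  Torus? x y = H? y ×-dec T? x y

  Torus-resp : ∀ {x y z} → y ≈ z → Torus x z → Torus x y
  Torus-resp e (Hz , t) = H-resp (sym e) Hz , T-resp refl (sym e) t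

  Torus⁺ : |G| → |G| → Set _
  Torus⁺ x y = ¬ (y ≈ ε) × Torus x y

  Torus⁺? : ∀ x y → Dec (Torus⁺ x y)
  Torus⁺? x y = ¬? (y ≈? ε) ×-dec Torus? x y

  Torus⁺-resp : ∀ {x y z} → y ≈ z → Torus⁺ x z → Torus⁺ x y
  Torus⁺-resp e (z≉ε , t) = (λ y≈ε → z≉ε (trans (sym e) y≈ε)) , Torus-resp e t

  Centralizer : |G| → |G| → Set _
  Centralizer x y = H y × x ∙ y ≈ y ∙ x

  Centralizer? : ∀ x y → Dec (Centralizer x y)
  Centralizer? x y = H? y ×-dec ((x ∙ y) ≈? (y ∙ x))

  Outer : |G| → |G| → Set _
  Outer x y = Centralizer x y × ¬ T x y

  Outer? : ∀ x y → Dec (Outer x y)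
  Outer? x y = Centralizer? x y ×-dec ¬? (T? x y)

  order : ℕ
  order = # λ y → 𝟙 (H? y)

  torus⁺-size centralizer-size : |G| → ℕ
  torus⁺-size x = # λ y → 𝟙 (Torus⁺? x y)
  centralizer-size x = # λ y → 𝟙 (Centralizer? x y)

  ≤-cases : ∀ {p r s} {P : Set p} {R : Set r} {S : Set s} (P? : Dec P) (R? : Dec R) (S? : Dec S) →
            (P → R ⊎ S) → 𝟙 P? ≤ 𝟙 R? + 𝟙 S?
  ≤-cases (no _)  R? S? f = z≤n
  ≤-cases (yes p) R? S? f with f p
  ... | inj₁ r = ≤-trans (≤-reflexive (≡-sym (𝟙-true R? r))) (m≤m+n _ _)
  ... | inj₂ s = ≤-trans (≤-reflexive (≡-sym (𝟙-true S? s))) (m≤n+m _ _)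

  translate-≈ : ∀ n {x y} → y ≈ n ∙ x → x ≈ n ⁻¹ ∙ y
  translate-≈ n {x} {y} e = sym (trans (∙-congˡ e) (trans (sym (assoc _ _ _)) (trans (∙-congʳ (inverseˡ n)) (identityˡ x))))

  translate-≈′ : ∀ n {x y} → x ≈ n ⁻¹ ∙ y → y ≈ n ∙ x
  translate-≈′ n {x} {y} e = sym (trans (∙-congˡ e) (trans (sym (assoc _ _ _)) (trans (∙-congʳ (inverseʳ n)) (identityˡ y))))

  #-translate : ∀ n f → (∀ {x y} → x ≈ y → f x ≡ f y) → # (λ x → f (n ∙ x)) ≡ # f
  #-translate n = #-reindex (n ∙_) (n ⁻¹ ∙_) (translate-≈ n) (translate-≈′ n)

  -- If some n centralizes x outside the torus, then multiplication by n carries all such elements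
  -- into the torus, by `T-anti`.
  centralizer-size≤ : ∀ x → centralizer-size x ≤ 2 * (1 + torus⁺-size x)
  centralizer-size≤ x = ≤-begin
    centralizer-size x                                        ≤⟨ ∑-mono all (λ y → ≤-cases (Centralizer? x y) (Torus? x y) (Outer? x y) (split y)) ⟩
    # (λ y → 𝟙 (Torus? x y) + 𝟙 (Outer? x y))                 ≡⟨ ∑-+ all _ _ ⟩
    torus + outer                                             ≤⟨ +-monoʳ-≤ torus outer≤torus ⟩
    torus + torus                                             ≤⟨ +-mono-≤ torus≤ torus≤ ⟩
    (1 + torus⁺-size x) + (1 + torus⁺-size x)                 ≡⟨ cong ((1 + torus⁺-size x) +_) (≡-sym (+-identityʳ _)) ⟩
    2 * (1 + torus⁺-size x)                                   ≤-∎
    where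
    open ≤-Reasoning renaming (begin_ to ≤-begin_; _∎ to _≤-∎)
    torus = # λ y → 𝟙 (Torus? x y)
    outer = # λ y → 𝟙 (Outer? x y)
    split : ∀ y → Centralizer x y → Torus x y ⊎ Outer x y
    split y (Hy , comm) with T? x y
    ... | yes t = inj₁ (Hy , t)
    ... | no ¬t = inj₂ ((Hy , comm) , ¬t)
    torus≤ : torus ≤ 1 + torus⁺-size x
    torus≤ = ≤-begin
      torus                                                   ≤⟨ ∑-mono all (λ y → ≤-cases (Torus? x y) (y ≈? ε) (Torus⁺? x y) (λ t → trivial? t (y ≈? ε))) ⟩
      # (λ y → 𝟙 (y ≈? ε) + 𝟙 (Torus⁺? x y))                  ≡⟨ ∑-+ all _ _ ⟩
      count ε all + torus⁺-size x                             ≡⟨ cong (_+ torus⁺-size x) (count-all ε) ⟩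
      1 + torus⁺-size x                                       ≤-∎
      where
      trivial? : ∀ {y} → Torus x y → Dec (y ≈ ε) → y ≈ ε ⊎ Torus⁺ x y
      trivial? t (yes e) = inj₁ e
      trivial? t (no ne) = inj₂ (ne , t)
    outer≤ : ∀ n → Outer x n → outer ≤ torus
    outer≤ n ((Hn , xn) , ¬t) = ≤-begin
      outer                                                   ≤⟨ ∑-mono all (λ y → 𝟙-mono (Outer? x y) (Torus? x (n ∙ y))
                                                                   λ ((Hy , xy) , ¬u) → H-∙ Hn Hy , T-anti xn xy ¬t ¬u) ⟩
      # (λ y → 𝟙 (Torus? x (n ∙ y)))                          ≡⟨ #-translate n (λ y → 𝟙 (Torus? x y))
                                                                   (λ e → 𝟙-cong (Torus? x _) (Torus? x _) (Torus-resp (sym e)) (Torus-resp e)) ⟩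
      torus                                                   ≤-∎
    outer≤torus : outer ≤ torus
    outer≤torus = by outer ≡-refl
      where by : ∀ k → outer ≡ k → outer ≤ torus
            by zero    e = subst (_≤ torus) (≡-sym e) z≤n
            by (suc k) e with ∑-positive all _ (subst (1 ≤_) (≡-sym e) (s≤s z≤n))
            ... | n , p = outer≤ n (𝟙-positive (Outer? x n) p)

  -- The incidence relation that is counted twice: h selects a conjugate of x, and y is a nontrivial
  -- element of the corresponding torus.
  Axis : |G| → |G| → |G| → Set _
  Axis x h y = H h × Torus⁺ (conj h x) y

  Axis? : ∀ x h y → Dec (Axis x h y)
  Axis? x h y = H? h ×-dec Torus⁺? (conj h x) y

  axes : |G| → |G| → ℕ
  axes x y = # λ h → 𝟙 (Axis? x h y)

  -- As tori meet trivially, y determines the conjugate of x whose torus contains it, so the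
  -- possible h form part of a single coset of the centralizer of x.
  axes≤ : ∀ {x} → Involution G x → ∀ h₀ y → Axis x h₀ y → axes x y ≤ centralizer-size x
  axes≤ {x} ix h₀ y (H₀ , y≉ε , Hy , t₀) = ≤-begin
    axes x y                                              ≤⟨ ∑-mono all (λ h → 𝟙-mono (Axis? x h y) (Centralizer? x (h₀ ⁻¹ ∙ h)) coset) ⟩
    # (λ h → 𝟙 (Centralizer? x (h₀ ⁻¹ ∙ h)))              ≡⟨ #-translate (h₀ ⁻¹) (λ y → 𝟙 (Centralizer? x y))
                                                               (λ e → 𝟙-cong (Centralizer? x _) (Centralizer? x _) (resp e) (resp (sym e))) ⟩
    centralizer-size x                                    ≤-∎
    where
    open ≤-Reasoning renaming (begin_ to ≤-begin_; _∎ to _≤-∎)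
    resp : ∀ {y z} → y ≈ z → Centralizer x y → Centralizer x z
    resp e (Hy , xy) = H-resp e Hy , trans (∙-congˡ (sym e)) (trans xy (∙-congʳ e))
    coset : ∀ {h} → Axis x h y → Centralizer x (h₀ ⁻¹ ∙ h)
    coset {h} (Hh , _ , _ , t) = H-∙ (H-⁻¹ H₀) Hh , sym (begin
      h₀ ⁻¹ ∙ h ∙ x                      ≈⟨ assoc _ _ _ ⟩
      h₀ ⁻¹ ∙ (h ∙ x)                    ≈⟨ ∙-congˡ (trans (sym (identityʳ _)) (trans (∙-congˡ (sym (inverseˡ h))) (sym (assoc _ _ _)))) ⟩
      h₀ ⁻¹ ∙ (conj h x ∙ h)             ≈⟨ ∙-congˡ (∙-congʳ (T-unique (conj-involution h ix) (conj-involution h₀ ix) y≉ε t t₀)) ⟩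
      h₀ ⁻¹ ∙ (h₀ ∙ x ∙ h₀ ⁻¹ ∙ h)       ≈⟨ ∙-congˡ (assoc _ _ _) ⟩
      h₀ ⁻¹ ∙ (h₀ ∙ x ∙ (h₀ ⁻¹ ∙ h))     ≈⟨ ∙-congˡ (assoc _ _ _) ⟩
      h₀ ⁻¹ ∙ (h₀ ∙ (x ∙ (h₀ ⁻¹ ∙ h)))   ≈⟨ trans (sym (assoc _ _ _)) (trans (∙-congʳ (inverseˡ h₀)) (identityˡ _)) ⟩
      x ∙ (h₀ ⁻¹ ∙ h)                    ∎)

  -- The indicator function of the union of the punctured tori of all H-conjugates of x.
  covered : |G| → |G| → ℕ
  covered x y = 1 ⊓ axes x y

  covered-cases : ∀ x y → covered x y ≡ 0 × axes x y ≡ 0 ⊎ covered x y ≡ 1 × ∃ λ h → Axis x h y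
  covered-cases x y with axes x y in eq
  ... | zero  = inj₁ (≡-refl , ≡-refl)
  ... | suc n with ∑-positive all _ (subst (1 ≤_) (≡-sym eq) (s≤s z≤n))
  ...   | h , p = inj₂ (≡-refl , h , 𝟙-positive (Axis? x h y) p)

  cover-size : |G| → ℕ
  cover-size x = # (covered x)

  torus⁺-conj : ∀ {x h} → H h → torus⁺-size x ≤ # λ y → 𝟙 (Axis? x h y)
  torus⁺-conj {x} {h} Hh = ≤-begin
    torus⁺-size x                            ≤⟨ ∑-mono all (λ y → 𝟙-mono (Torus⁺? x y) (Axis? x h (conj h y)) λ (y≉ε , Hy , t) →
                                                  Hh , (λ e → y≉ε (conj-injective h (trans e (sym (conj-ε h))))) , H-conj Hh Hy , T-conj h t) ⟩
    # (λ y → 𝟙 (Axis? x h (conj h y)))       ≡⟨ #-reindex (conj h) (conj⁻¹ h) (conj-inverse h) (conj-inverse′ h) (λ y → 𝟙 (Axis? x h y))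
                                                  (λ e → 𝟙-cong (Axis? x h _) (Axis? x h _) (λ (a , b) → a , Torus⁺-resp (sym e) b) (λ (a , b) → a , Torus⁺-resp e b)) ⟩
    # (λ y → 𝟙 (Axis? x h y))                ≤-∎
    where open ≤-Reasoning renaming (begin_ to ≤-begin_; _∎ to _≤-∎)

  -- Counting the pairs of `Axis`: each h in H contributes at least t of them, each covered y at
  -- most the order of the centralizer, which is at most 2 (1 + t).
  cover-bound : ∀ {x} → Involution G x → torus⁺-size x * order ≤ (2 * (1 + torus⁺-size x)) * cover-size x
  cover-bound {x} ix = ≤-begin
    t * order                                ≡⟨ ∑-* all t _ ⟨
    # (λ h → t * 𝟙 (H? h))                   ≤⟨ ∑-mono all (λ h → per-element h (H? h)) ⟩
    # (λ h → # (λ y → 𝟙 (Axis? x h y)))      ≡⟨ ∑-swap all all _ ⟩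
    # (axes x)                               ≤⟨ ∑-mono all (λ y → per-point y (covered-cases x y)) ⟩
    # (λ y → N * covered x y)                ≡⟨ ∑-* all N _ ⟩
    N * cover-size x                         ≤-∎
    where
    open ≤-Reasoning renaming (begin_ to ≤-begin_; _∎ to _≤-∎)
    t = torus⁺-size x
    N = 2 * (1 + t)
    per-element : ∀ h (p : Dec (H h)) → t * 𝟙 p ≤ # (λ y → 𝟙 (Axis? x h y))
    per-element h (yes Hh) = ≤-trans (≤-reflexive (*-identityʳ t)) (torus⁺-conj Hh)
    per-element h (no _)   = ≤-trans (≤-reflexive (*-zeroʳ t)) z≤n
    per-point : ∀ y → covered x y ≡ 0 × axes x y ≡ 0 ⊎ covered x y ≡ 1 × (∃ λ h → Axis x h y) → axes x y ≤ N * covered x y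
    per-point y (inj₁ (_ , e)) = subst (_≤ N * covered x y) (≡-sym e) z≤n
    per-point y (inj₂ (e , h₀ , ax)) = ≤-trans (axes≤ ix h₀ y ax) (≤-trans (centralizer-size≤ x)
      (≤-reflexive (≡-trans (≡-sym (*-identityʳ N)) (cong (N *_) (≡-sym e)))))

  -- The covered proportion t / (2 (1 + t)) increases with t, so a lower bound for t may replace it;
  -- the inequality is cleared of denominators.
  cover-bound′ : ∀ {x} → Involution G x → ∀ k → k ≤ torus⁺-size x → k * order ≤ (2 * (1 + k)) * cover-size x
  cover-bound′ {x} ix k k≤t = *-cancelˡ-≤ (1 + t) (≤-begin
    (1 + t) * (k * order)                    ≡⟨ solve 3 (λ t k g → (con 1 :+ t) :* (k :* g) := (k :+ t :* k) :* g) ≡-refl t k order ⟩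
    (k + t * k) * order                      ≤⟨ *-monoˡ-≤ order (+-monoˡ-≤ (t * k) k≤t) ⟩
    (t + t * k) * order                      ≡⟨ solve 3 (λ t k g → (t :+ t :* k) :* g := (con 1 :+ k) :* (t :* g)) ≡-refl t k order ⟩
    (1 + k) * (t * order)                    ≤⟨ *-monoʳ-≤ (1 + k) (cover-bound ix) ⟩
    (1 + k) * ((2 * (1 + t)) * E)            ≡⟨ solve 3 (λ t k e → (con 1 :+ k) :* ((con 2 :* (con 1 :+ t)) :* e) := (con 1 :+ t) :* ((con 2 :* (con 1 :+ k)) :* e)) ≡-refl t k E ⟩
    (1 + t) * ((2 * (1 + k)) * E)            ≤-∎)
    where
    open ≤-Reasoning renaming (begin_ to ≤-begin_; _∎ to _≤-∎)
    open +-*-Solver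
    t = torus⁺-size x
    E = cover-size x

  NonConjugate : |G| → |G| → Set _
  NonConjugate x y = ∀ {h k} → H h → H k → ¬ (conj h x ≈ conj k y)

  module _ {x y z} (ix : Involution G x) (iy : Involution G y) (iz : Involution G z)
           (xy : NonConjugate x y) (xz : NonConjugate x z) (yz : NonConjugate y z) where

    -- The extra 1 counts the identity, which lies in no punctured torus. An element common to two
    -- covers would identify a conjugate of one involution with a conjugate of another.
    disjoint-covers : 1 + (cover-size x + (cover-size y + cover-size z)) ≤ order
    disjoint-covers = ≤-begin
      1 + (cover-size x + (cover-size y + cover-size z))                            ≡⟨ cong₂ _+_ (count-all ε) (≡-trans (∑-+ all _ _) (cong (cover-size x +_) (∑-+ all _ _))) ⟨
      count ε all + # (λ g → covered x g + (covered y g + covered z g))             ≡⟨ ∑-+ all _ _ ⟨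
      # (λ g → 𝟙 (g ≈? ε) + (covered x g + (covered y g + covered z g)))            ≤⟨ ∑-mono all (λ g → pointwise g (g ≈? ε) (covered-cases x g) (covered-cases y g) (covered-cases z g)) ⟩
      order                                                                         ≤-∎
      where
      open ≤-Reasoning renaming (begin_ to ≤-begin_; _∎ to _≤-∎)
      apart : ∀ {x y g h k} → Involution G x → Involution G y → NonConjugate x y → Axis x h g → Axis y k g → ⊥
      apart {h = h} {k} ix iy n (Hh , g≉ε , _ , t) (Hk , _ , _ , t′) =
        n Hh Hk (T-unique (conj-involution h ix) (conj-involution k iy) g≉ε t t′)
      member : ∀ {g h x} → Axis x h g → 1 ≤ 𝟙 (H? g)
      member {g} (_ , _ , Hg , _) = ≤-reflexive (≡-sym (𝟙-true (H? g) Hg))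
      Cases : |G| → |G| → Set _
      Cases x g = covered x g ≡ 0 × axes x g ≡ 0 ⊎ covered x g ≡ 1 × ∃ λ h → Axis x h g
      pointwise : ∀ g (p : Dec (g ≈ ε)) → Cases x g → Cases y g → Cases z g →
                  𝟙 p + (covered x g + (covered y g + covered z g)) ≤ 𝟙 (H? g)
      pointwise g (yes e) (inj₂ (_ , _ , _ , ne , _)) _ _ = contradiction e ne
      pointwise g (yes e) _ (inj₂ (_ , _ , _ , ne , _)) _ = contradiction e ne
      pointwise g (yes e) _ _ (inj₂ (_ , _ , _ , ne , _)) = contradiction e ne
      pointwise g (yes e) (inj₁ (a , _)) (inj₁ (b , _)) (inj₁ (c , _)) rewrite a | b | c =
        ≤-reflexive (≡-sym (𝟙-true (H? g) (H-resp (sym e) H-ε)))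
      pointwise g (no _) (inj₁ (a , _)) (inj₁ (b , _)) (inj₁ (c , _)) rewrite a | b | c = z≤n
      pointwise g (no _) (inj₂ (a , _ , α)) (inj₁ (b , _)) (inj₁ (c , _)) rewrite a | b | c = member α
      pointwise g (no _) (inj₁ (a , _)) (inj₂ (b , _ , β)) (inj₁ (c , _)) rewrite a | b | c = member β
      pointwise g (no _) (inj₁ (a , _)) (inj₁ (b , _)) (inj₂ (c , _ , γ)) rewrite a | b | c = member γ
      pointwise g (no _) (inj₂ (_ , _ , α)) (inj₂ (_ , _ , β)) _ = ⊥-elim (apart ix iy xy α β)
      pointwise g (no _) (inj₂ (_ , _ , α)) _ (inj₂ (_ , _ , γ)) = ⊥-elim (apart ix iz xz α γ)
      pointwise g (no _) _ (inj₂ (_ , _ , β)) (inj₂ (_ , _ , γ)) = ⊥-elim (apart iy iz yz β γ)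

    -- With dₓ = 1 + kₓ etc., the sum of (1 - 1/d)/2 over the three classes is below 1: each class covers
    -- at least that fraction of H, and the identity is not covered.
    packing : ∀ kx ky kz a b c L →
      a * (2 * (1 + kx)) ≡ L → b * (2 * (1 + ky)) ≡ L → c * (2 * (1 + kz)) ≡ L → 1 ≤ L → L ≤ a * kx + b * ky + c * kz →
      kx ≤ torus⁺-size x → ky ≤ torus⁺-size y → kz ≤ torus⁺-size z → ⊥
    packing kx ky kz a b c L ea eb ec L≥1 L≤ px py pz = <⇒≱ covers-short (≤-begin
      L * order                                                   ≤⟨ *-monoˡ-≤ order L≤ ⟩
      (a * kx + b * ky + c * kz) * order                          ≡⟨ solve 7 (λ a b c x y z g → (a :* x :+ b :* y :+ c :* z) :* g := a :* (x :* g) :+ b :* (y :* g) :+ c :* (z :* g)) ≡-refl a b c kx ky kz order ⟩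
      a * (kx * order) + b * (ky * order) + c * (kz * order)      ≤⟨ +-mono-≤ (+-mono-≤ (*-monoʳ-≤ a (cover-bound′ ix kx px)) (*-monoʳ-≤ b (cover-bound′ iy ky py))) (*-monoʳ-≤ c (cover-bound′ iz kz pz)) ⟩
      a * ((2 * (1 + kx)) * X) + b * ((2 * (1 + ky)) * Y) + c * ((2 * (1 + kz)) * Z)
        ≡⟨ solve 9 (λ a b c x y z X Y Z → a :* (x :* X) :+ b :* (y :* Y) :+ c :* (z :* Z) := (a :* x) :* X :+ (b :* y) :* Y :+ (c :* z) :* Z)
             ≡-refl a b c (2 * (1 + kx)) (2 * (1 + ky)) (2 * (1 + kz)) X Y Z ⟩
      (a * (2 * (1 + kx))) * X + (b * (2 * (1 + ky))) * Y + (c * (2 * (1 + kz))) * Z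
        ≡⟨ cong₂ _+_ (cong₂ _+_ (cong (_* X) ea) (cong (_* Y) eb)) (cong (_* Z) ec) ⟩
      L * X + L * Y + L * Z                                       ≡⟨ solve 4 (λ l x y z → l :* x :+ l :* y :+ l :* z := l :* (x :+ (y :+ z))) ≡-refl L X Y Z ⟩
      L * (X + (Y + Z))                                           ≤-∎)
      where
      open ≤-Reasoning renaming (begin_ to ≤-begin_; _∎ to _≤-∎)
      open +-*-Solver
      X = cover-size x
      Y = cover-size y
      Z = cover-size z
      covers-short : L * (X + (Y + Z)) < L * order
      covers-short = ≤-begin
        1 + L * (X + (Y + Z))      ≤⟨ +-monoˡ-≤ _ L≥1 ⟩
        L + L * (X + (Y + Z))      ≡⟨ solve 2 (λ l s → l :+ l :* s := l :* (con 1 :+ s)) ≡-refl L (X + (Y + Z)) ⟩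
        L * (1 + (X + (Y + Z)))    ≤⟨ *-monoʳ-≤ L disjoint-covers ⟩
        L * order                  ≤-∎

  torus⁺-size≥ : ∀ {x} xs → All (Torus⁺ x) xs → AllPairs (λ g h → ¬ (g ≈ h)) xs → length xs ≤ torus⁺-size x
  torus⁺-size≥ {x} = distinct≤# (Torus⁺? x) Torus⁺-resp

-- String C-groups of rank three inside PGL₂

halve : ∀ n → ∃ λ k → n ≡ k ℕ.+ k ⊎ n ≡ suc (k ℕ.+ k)
halve zero = 0 , inj₁ ≡-refl
halve (suc n) with halve n
... | k , inj₁ e = k , inj₂ (cong suc e)
... | k , inj₂ e = suc k , inj₁ (cong suc (≡-trans e (≡-sym (ℕ.+-suc k k))))

module InvolutionLemmas {c ℓ} (G : Group c ℓ) where
  open Group G renaming (Carrier to |G|)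
  open Algebra.Properties.Group G
  open import Relation.Binary.Reasoning.Setoid setoid

  cancel-square : ∀ {x} → x ∙ x ≈ ε → ∀ y → x ∙ (x ∙ y) ≈ y
  cancel-square {x} x² y = trans (sym (assoc x x y)) (trans (∙-congʳ x²) (identityˡ y))

  square⇒⁻¹≈ : ∀ {x} → x ∙ x ≈ ε → x ≈ x ⁻¹
  square⇒⁻¹≈ {x} = inverseˡ-unique x x

  ∙≈ε⇒≈ : ∀ {x y} → x ∙ x ≈ ε → x ∙ y ≈ ε → y ≈ x
  ∙≈ε⇒≈ {x} {y} x² xy = ∙-cancelˡ x y x (trans xy (sym x²))

  commuting-product : ∀ {x y} → Involution G x → Involution G y → x ∙ y ≈ y ∙ x → ¬ (x ≈ y) → Involution G (x ∙ y)
  commuting-product {x} {y} (x² , _) (y² , _) xy x≉y = (begin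
    (x ∙ y) ∙ (x ∙ y)   ≈⟨ ∙-congˡ xy ⟩
    (x ∙ y) ∙ (y ∙ x)   ≈⟨ assoc x y _ ⟩
    x ∙ (y ∙ (y ∙ x))   ≈⟨ ∙-congˡ (cancel-square y² x) ⟩
    x ∙ x               ≈⟨ x² ⟩
    ε                   ∎) , λ e → x≉y (sym (∙≈ε⇒≈ x² e))

  product-square⇒comm : ∀ {x y} → x ∙ x ≈ ε → y ∙ y ≈ ε → (x ∙ y) ∙ (x ∙ y) ≈ ε → x ∙ y ≈ y ∙ x
  product-square⇒comm {x} {y} x² y² e = begin
    x ∙ y                 ≈⟨ square⇒⁻¹≈ e ⟩
    (x ∙ y) ⁻¹            ≈⟨ ⁻¹-anti-homo-∙ x y ⟩
    y ⁻¹ ∙ x ⁻¹           ≈⟨ ∙-cong (square⇒⁻¹≈ y²) (square⇒⁻¹≈ x²) ⟨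
    y ∙ x                 ∎

  comm⇒product-square : ∀ {x y} → x ∙ x ≈ ε → y ∙ y ≈ ε → x ∙ y ≈ y ∙ x → (x ∙ y) ∙ (x ∙ y) ≈ ε
  comm⇒product-square {x} {y} x² y² e = begin
    (x ∙ y) ∙ (x ∙ y)   ≈⟨ ∙-congˡ e ⟩
    (x ∙ y) ∙ (y ∙ x)   ≈⟨ assoc x y _ ⟩
    x ∙ (y ∙ (y ∙ x))   ≈⟨ ∙-congˡ (cancel-square y² x) ⟩
    x ∙ x               ≈⟨ x² ⟩
    ε                   ∎

module TorusLemmas {c ℓ} (G : Group c ℓ) (TG : TorusGroup G) where
  open Group G renaming (Carrier to |G|)
  open Algebra.Properties.Group G
  open Algebra.Properties.Monoid.Mult monoid using (×-homo-+) renaming (_×_ to _·_)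
  open TorusGroup TG
  open InvolutionLemmas G
  open import Relation.Binary.Reasoning.Setoid setoid

  T-involution : ∀ {x y} → Involution G x → Involution G y → T x y → x ≈ y
  T-involution {x} {y} ix iy t = T-unique ix iy (proj₂ iy) t (T-refl y)

  T-· : ∀ k y → T y (k · y)
  T-· zero    y = T-ε y
  T-· (suc k) y = T-∙ (T-refl y) (T-· k y)

  finite-order : ∀ y → ∃ λ n → suc n · y ≈ ε
  finite-order y with Fin.pigeonhole (ℕ.n<1+n (length elements)) (λ i → Any.index (complete (toℕ i · y)))
  ... | i , j , i<j , e with ℕ.m≤n⇒∃[o]m+o≡n i<j
  ...   | d , i+d = d , sym (∙-cancelˡ (toℕ i · y) ε (suc d · y) (begin
    (toℕ i · y) ∙ ε                         ≈⟨ identityʳ _ ⟩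
    toℕ i · y                               ≈⟨ Any.lookup-index (complete (toℕ i · y)) ⟨
    lookup elements (Any.index (complete (toℕ i · y)))  ≡⟨ cong (lookup elements) e ⟩
    lookup elements (Any.index (complete (toℕ j · y)))  ≈⟨ Any.lookup-index (complete (toℕ j · y)) ⟩
    toℕ j · y                               ≡⟨ cong (_· y) (≡-trans (ℕ.+-suc (toℕ i) d) i+d) ⟨
    (toℕ i ℕ.+ suc d) · y                     ≈⟨ ×-homo-+ y (toℕ i) (suc d) ⟩
    (toℕ i · y) ∙ (suc d · y)               ∎))

  Sq-⁻¹ : ∀ {g} → Sq g → Sq (g ⁻¹)
  Sq-⁻¹ {g} s = Sq-resp (trans (sym (assoc g (g ⁻¹) (g ⁻¹))) (trans (∙-congʳ (inverseʳ g)) (identityˡ _))) (Sq-∙ s (Sq-square (g ⁻¹)))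

  Sq-cancelˡ : ∀ {g h} → Sq g → Sq (g ∙ h) → Sq h
  Sq-cancelˡ {g} {h} s t = Sq-resp (trans (sym (assoc _ g h)) (trans (∙-congʳ (inverseˡ g)) (identityˡ h))) (Sq-∙ (Sq-⁻¹ s) t)

  Sq-cancelʳ : ∀ {g h} → Sq h → Sq (g ∙ h) → Sq g
  Sq-cancelʳ {g} {h} s t = Sq-resp (trans (assoc g h _) (trans (∙-congˡ (inverseʳ h)) (identityʳ g))) (Sq-∙ t (Sq-⁻¹ s))

  -- h g h⁻¹ = (h g)² g⁻¹ (h⁻¹)², the product of g⁻¹ with two squares.
  Sq-conj : ∀ h {g} → Sq g → Sq (h ∙ g ∙ h ⁻¹)
  Sq-conj h {g} s = Sq-resp (begin
    ((h ∙ g) ∙ (h ∙ g)) ∙ (g ⁻¹ ∙ (h ⁻¹ ∙ h ⁻¹))   ≈⟨ assoc (h ∙ g) (h ∙ g) _ ⟩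
    (h ∙ g) ∙ ((h ∙ g) ∙ (g ⁻¹ ∙ (h ⁻¹ ∙ h ⁻¹)))   ≈⟨ ∙-congˡ (assoc (h ∙ g) (g ⁻¹) _) ⟨
    (h ∙ g) ∙ (((h ∙ g) ∙ g ⁻¹) ∙ (h ⁻¹ ∙ h ⁻¹))   ≈⟨ ∙-congˡ (∙-congʳ (trans (assoc h g _) (trans (∙-congˡ (inverseʳ g)) (identityʳ h)))) ⟩
    (h ∙ g) ∙ (h ∙ (h ⁻¹ ∙ h ⁻¹))                  ≈⟨ ∙-congˡ (trans (sym (assoc h _ _)) (trans (∙-congʳ (inverseʳ h)) (identityˡ _))) ⟩
    h ∙ g ∙ h ⁻¹                                   ∎)
    (Sq-∙ (Sq-square (h ∙ g)) (Sq-∙ (Sq-⁻¹ s) (Sq-square (h ⁻¹))))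

  Sq-conj⁻ : ∀ h {g} → Sq (h ∙ g ∙ h ⁻¹) → Sq g
  Sq-conj⁻ h {g} s = Sq-resp (begin
    h ⁻¹ ∙ (h ∙ g ∙ h ⁻¹) ∙ h ⁻¹ ⁻¹         ≈⟨ ∙-cong (∙-congˡ (assoc h g _)) (⁻¹-involutive h) ⟩
    h ⁻¹ ∙ (h ∙ (g ∙ h ⁻¹)) ∙ h             ≈⟨ ∙-congʳ (trans (sym (assoc _ h _)) (trans (∙-congʳ (inverseˡ h)) (identityˡ _))) ⟩
    g ∙ h ⁻¹ ∙ h                            ≈⟨ trans (assoc g _ h) (trans (∙-congˡ (inverseˡ h)) (identityʳ g)) ⟩
    g                                       ∎) (Sq-conj (h ⁻¹) s)

  -- A nonsquare element has even order, since y = (y⁻ᵏ)² whenever y²ᵏ⁺¹ = 1.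
  involution-power : ∀ y → ¬ Sq y → ∃ λ k → Involution G (k · y)
  involution-power y y≢ = search (proj₁ (finite-order y)) (suc (proj₁ (finite-order y))) ℕ.≤-refl (s≤s z≤n) (proj₂ (finite-order y))
    where
    search : ∀ fuel n → n ≤ suc fuel → 1 ≤ n → n · y ≈ ε → ∃ λ k → Involution G (k · y)
    search fuel n n≤ 1≤n e with halve n
    ... | k , inj₂ ≡-refl = contradiction (Sq-resp (sym (begin
        y                              ≈⟨ inverseˡ-unique y _ (trans (∙-congˡ (sym (×-homo-+ y k k))) e) ⟩
        ((k · y) ∙ (k · y)) ⁻¹         ≈⟨ ⁻¹-anti-homo-∙ _ _ ⟩
        (k · y) ⁻¹ ∙ (k · y) ⁻¹        ∎)) (Sq-square ((k · y) ⁻¹))) y≢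
    ... | k , inj₁ ≡-refl with (k · y) ≈? ε
    ...   | no  ne = k , trans (sym (×-homo-+ y k k)) e , ne
    ...   | yes e′ = descend fuel k n≤ 1≤n e′
      where
      descend : ∀ fuel k → k ℕ.+ k ≤ suc fuel → 1 ≤ k ℕ.+ k → k · y ≈ ε → ∃ λ k → Involution G (k · y)
      descend fuel zero    _  () _
      descend zero (suc k) (s≤s h) _ _ = contradiction (ℕ.≤-trans (ℕ.m≤n+m (suc k) k) h) λ ()
      descend (suc fuel) (suc k) (s≤s h) _ e = search fuel (suc k) (ℕ.≤-trans (ℕ.m≤n+m (suc k) k) h) (s≤s z≤n) e

  -- If r and s are involutions then s inverts r s, so an involution which is a power of r s commutes with s.
  dihedral-center : ∀ {r s} → r ∙ r ≈ ε → s ∙ s ≈ ε → ∀ k → Involution G (k · (r ∙ s)) → s ∙ (k · (r ∙ s)) ≈ (k · (r ∙ s)) ∙ s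
  dihedral-center {r} {s} r² s² k (z² , _) = sym (begin
    z ∙ s                 ≈⟨ ∙-congˡ (inverts k) ⟨
    z ∙ (z ∙ (s ∙ z))     ≈⟨ cancel-square z² (s ∙ z) ⟩
    s ∙ z                 ∎)
    where
    y = r ∙ s
    z = k · y
    ysy : y ∙ (s ∙ y) ≈ s
    ysy = begin
      r ∙ s ∙ (s ∙ (r ∙ s))     ≈⟨ assoc r s _ ⟩
      r ∙ (s ∙ (s ∙ (r ∙ s)))   ≈⟨ ∙-congˡ (cancel-square s² _) ⟩
      r ∙ (r ∙ s)               ≈⟨ cancel-square r² s ⟩
      s                         ∎
    inverts : ∀ k → (k · y) ∙ (s ∙ (k · y)) ≈ s
    inverts zero    = trans (identityˡ _) (identityʳ s)
    inverts (suc k) = begin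
      y ∙ p ∙ (s ∙ (y ∙ p))     ≈⟨ ∙-congʳ (T⇒comm (T-· k y)) ⟩
      p ∙ y ∙ (s ∙ (y ∙ p))     ≈⟨ assoc p y _ ⟩
      p ∙ (y ∙ (s ∙ (y ∙ p)))   ≈⟨ ∙-congˡ (∙-congˡ (assoc s y p)) ⟨
      p ∙ (y ∙ (s ∙ y ∙ p))     ≈⟨ ∙-congˡ (assoc y _ p) ⟨
      p ∙ (y ∙ (s ∙ y) ∙ p)     ≈⟨ ∙-congˡ (∙-congʳ ysy) ⟩
      p ∙ (s ∙ p)               ≈⟨ inverts k ⟩
      s                         ∎
      where p = k · y

-- Relations in a rank three subgroup H forced by the count

module RankThree {c ℓ h} (G : Group c ℓ) (TG : TorusGroup G)
  (H : Group.Carrier G → Set h) (H? : ∀ g → Dec (H g))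
  (H-resp : ∀ {x y} → Group._≈_ G x y → H x → H y)
  (H-ε : H (Group.ε G)) (H-∙ : ∀ {x y} → H x → H y → H (Group._∙_ G x y)) (H-⁻¹ : ∀ {x} → H x → H (Group._⁻¹ G x))
  (r₀ r₁ r₂ x : Group.Carrier G)
  (i₀ : Involution G r₀) (i₁ : Involution G r₁) (i₂ : Involution G r₂) (ix : Involution G x)
  (H₀ : H r₀) (H₁ : H r₁) (H₂ : H r₂) (x∉H : ¬ H x)
  (r₀≉r₁ : ¬ Group._≈_ G r₀ r₁) (r₀≉r₂ : ¬ Group._≈_ G r₀ r₂)
  (c₀₂ : Group._≈_ G (Group._∙_ G r₀ r₂) (Group._∙_ G r₂ r₀))
  (cx₀ : Group._≈_ G (Group._∙_ G x r₀) (Group._∙_ G r₀ x))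
  (cx₁ : Group._≈_ G (Group._∙_ G x r₁) (Group._∙_ G r₁ x))
  (odd : ¬ (TorusGroup.Sq TG r₀ × TorusGroup.Sq TG r₂)) where
  open Group G renaming (Carrier to |G|)
  open Algebra.Properties.Group G
  open Algebra.Properties.Monoid.Mult monoid using () renaming (_×_ to _·_)
  open TorusGroup TG
  open InvolutionLemmas G
  open TorusLemmas G TG
  open TorusCounting G TG H H? H-resp H-ε H-∙ H-⁻¹
    using (conj; conj⁻¹; conj-inverse; NonConjugate; Torus; Torus⁺; torus⁺-size; torus⁺-size≥; packing)
  open import Relation.Binary.Reasoning.Setoid setoid

  H-· : ∀ k {y} → H y → H (k · y)
  H-· zero    Hy = H-ε
  H-· (suc k) Hy = H-∙ Hy (H-· k Hy)

  u τ : |G|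
  u = r₀ ∙ r₁
  τ = u ∙ r₂

  Hu : H u
  Hu = H-∙ H₀ H₁

  ∉H⇒¬T : ∀ {g} → Involution G g → H g → ¬ T x g
  ∉H⇒¬T ig Hg t = x∉H (H-resp (sym (T-involution ix ig t)) Hg)

  Txu : T x u
  Txu = T-anti cx₀ cx₁ (∉H⇒¬T i₀ H₀) (∉H⇒¬T i₁ H₁)

  u≉ε : ¬ (u ≈ ε)
  u≉ε e = r₀≉r₁ (sym (∙≈ε⇒≈ (proj₁ i₀) e))

  -- Otherwise u would be an involution in the torus of x, hence x itself, although u lies in H.
  u²≉ε : ¬ (u ∙ u ≈ ε)
  u²≉ε e = ∉H⇒¬T (e , u≉ε) Hu Txu

  ¬c₀₁ : ¬ (r₀ ∙ r₁ ≈ r₁ ∙ r₀)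
  ¬c₀₁ e = u²≉ε (comm⇒product-square (proj₁ i₀) (proj₁ i₁) e)

  nonconjugate-∉H : ∀ {s} → H s → NonConjugate x s
  nonconjugate-∉H {s} Hs {h} {k} Hh Hk e = x∉H (H-resp (sym (conj-inverse h (sym e)))
    (H-∙ (H-⁻¹ Hh) (H-∙ (H-∙ (H-∙ Hk Hs) (H-⁻¹ Hk)) Hh)))

  Opposite : |G| → |G| → Set
  Opposite s t = Sq s × ¬ Sq t ⊎ ¬ Sq s × Sq t

  nonconjugate-opposite : ∀ {s t} → Opposite s t → NonConjugate s t
  nonconjugate-opposite (inj₁ (a , b)) {h} {k} _ _ e = b (Sq-conj⁻ k (Sq-resp e (Sq-conj h a)))
  nonconjugate-opposite (inj₂ (a , b)) {h} {k} _ _ e = a (Sq-conj⁻ h (Sq-resp (sym e) (Sq-conj k b)))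

  opposite-product : ∀ {s t} → Opposite s t → ¬ Sq (t ∙ s)
  opposite-product (inj₁ (a , b)) e = b (Sq-cancelʳ a e)
  opposite-product (inj₂ (a , b)) e = a (Sq-cancelˡ b e)

  W : |G| → Set ℓ
  W g = g ≈ ε ⊎ g ≈ r₀ ⊎ g ≈ r₂ ⊎ g ≈ r₀ ∙ r₂

  W-resp : ∀ {g h} → g ≈ h → W g → W h
  W-resp e (inj₁ p)               = inj₁ (trans (sym e) p)
  W-resp e (inj₂ (inj₁ p))        = inj₂ (inj₁ (trans (sym e) p))
  W-resp e (inj₂ (inj₂ (inj₁ p))) = inj₂ (inj₂ (inj₁ (trans (sym e) p)))
  W-resp e (inj₂ (inj₂ (inj₂ p))) = inj₂ (inj₂ (inj₂ (trans (sym e) p)))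

  -- The partner is a second involution of W. It commutes with s but lies outside the torus of s, so
  -- it represents the other coset of the torus in the centralizer.
  record KleinElement (s : |G|) : Set (c ⊔ ℓ ⊔ h) where
    field
      involution        : Involution G s
      member            : H s
      member-W          : W s
      partner           : |G|
      partner-involution : Involution G partner
      partner-W         : W partner
      partner-commutes  : s ∙ partner ≈ partner ∙ s
      partner-distinct  : ¬ (s ≈ partner)
      product-W         : W (partner ∙ s)

  klein₀ : KleinElement r₀
  klein₀ = record { involution = i₀ ; member = H₀ ; member-W = inj₂ (inj₁ refl) ; partner = r₂ ; partner-involution = i₂
    ; partner-W = inj₂ (inj₂ (inj₁ refl)) ; partner-commutes = c₀₂ ; partner-distinct = r₀≉r₂ ; product-W = inj₂ (inj₂ (inj₂ (sym c₀₂))) }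

  klein₂ : KleinElement r₂
  klein₂ = record { involution = i₂ ; member = H₂ ; member-W = inj₂ (inj₂ (inj₁ refl)) ; partner = r₀ ; partner-involution = i₀
    ; partner-W = inj₂ (inj₁ refl) ; partner-commutes = sym c₀₂ ; partner-distinct = λ e → r₀≉r₂ (sym e) ; product-W = inj₂ (inj₂ (inj₂ refl)) }

  klein₀₂ : KleinElement (r₀ ∙ r₂)
  klein₀₂ = record { involution = commuting-product i₀ i₂ c₀₂ r₀≉r₂ ; member = H-∙ H₀ H₂ ; member-W = inj₂ (inj₂ (inj₂ refl)) ; partner = r₀
    ; partner-involution = i₀ ; partner-W = inj₂ (inj₁ refl) ; partner-commutes = trans (assoc _ _ _) (∙-congˡ (sym c₀₂))
    ; partner-distinct = λ e → proj₂ i₂ (∙-cancelˡ r₀ r₂ ε (trans e (sym (identityʳ r₀))))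
    ; product-W = inj₂ (inj₂ (inj₁ (cancel-square (proj₁ i₀) r₂))) }

  W⇒commutes-r₀ : ∀ {g} → W g → r₀ ∙ g ≈ g ∙ r₀
  W⇒commutes-r₀ (inj₁ e) = trans (∙-congˡ e) (trans (identityʳ _) (trans (sym (identityˡ _)) (∙-congʳ (sym e))))
  W⇒commutes-r₀ (inj₂ (inj₁ e)) = trans (∙-congˡ e) (∙-congʳ (sym e))
  W⇒commutes-r₀ (inj₂ (inj₂ (inj₁ e))) = trans (∙-congˡ e) (trans c₀₂ (∙-congʳ (sym e)))
  W⇒commutes-r₀ (inj₂ (inj₂ (inj₂ e))) = trans (∙-congˡ e) (trans (trans (∙-congˡ c₀₂) (sym (assoc _ _ _))) (∙-congʳ (sym e)))

  W⇒klein : ∀ {g} → W g → ¬ (g ≈ ε) → ∃ λ s → KleinElement s × g ≈ s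
  W⇒klein (inj₁ e) ne = contradiction e ne
  W⇒klein (inj₂ (inj₁ e)) _ = r₀ , klein₀ , e
  W⇒klein (inj₂ (inj₂ (inj₁ e))) _ = r₂ , klein₂ , e
  W⇒klein (inj₂ (inj₂ (inj₂ e))) _ = r₀ ∙ r₂ , klein₀₂ , e

  ∃-square-klein : ∃ λ s → KleinElement s × Sq s
  ∃-square-klein with Sq? r₀ | Sq? r₂
  ... | yes a | _     = r₀ , klein₀ , a
  ... | no _  | yes b = r₂ , klein₂ , b
  ... | no a  | no b  = r₀ ∙ r₂ , klein₀₂ , ¬Sq-∙ a b

  ∃-nonsquare-klein : ∃ λ s → KleinElement s × ¬ Sq s
  ∃-nonsquare-klein with Sq? r₀ | Sq? r₂
  ... | no a  | _     = r₀ , klein₀ , a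
  ... | yes _ | no b  = r₂ , klein₂ , b
  ... | yes a | yes b = contradiction (a , b) odd

  opposite-klein : ∀ g → ∃ λ s → KleinElement s × Opposite s g
  opposite-klein g with Sq? g
  ... | yes a = let s , k , n = ∃-nonsquare-klein in s , k , inj₂ (n , a)
  ... | no  a = let s , k , n = ∃-square-klein in s , k , inj₁ (n , a)

  SmallTorus : |G| → Set _
  SmallTorus s = ∀ g → Torus s g → g ≈ ε ⊎ g ≈ s

  -- The centralizer of s in H is the torus together with its translate by the partner. With torus
  -- {1 , s} this is {1 , s , partner , partner ∙ s}, which is W.
  centralizer⊆W : ∀ {s} → KleinElement s → SmallTorus s → ∀ {g} → H g → s ∙ g ≈ g ∙ s → W g
  centralizer⊆W {s} ks small {g} Hg sg with T? s g
  ... | yes t = [ (λ e → inj₁ e) , (λ e → W-resp (sym e) (KleinElement.member-W ks)) ]′ (small g (Hg , t))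
  ... | no ¬t = [ (λ e → W-resp (sym (∙≈ε⇒≈ p² e)) partner-W)
                , (λ e → W-resp (sym (trans (sym (cancel-square p² g)) (∙-congˡ e))) product-W) ]′
                (small (partner ∙ g) (H-∙ Hp Hg , T-anti partner-commutes sg (λ t → partner-distinct (T-involution involution partner-involution t)) ¬t))
    where
    open KleinElement ks
    p² = proj₁ partner-involution
    Hp : H partner
    Hp = let s′ , k′ , e = W⇒klein partner-W (proj₂ partner-involution) in H-resp (sym e) (KleinElement.member k′)

  -- For s in W of class opposite to r₁, the involution z in the dihedral group ⟨r₁ , s⟩ of even degree centralizes
  -- both; were all tori of W small, z and then r₁ would lie in W.
  ¬all-small : ¬ (∀ {s} → KleinElement s → SmallTorus s)
  ¬all-small small =
    let s , ks , opp = opposite-klein r₁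
        k , iz = involution-power (r₁ ∙ s) (opposite-product opp)
        z = k · (r₁ ∙ s)
        open KleinElement ks
        sz : s ∙ z ≈ z ∙ s
        sz = dihedral-center (proj₁ i₁) (proj₁ involution) k iz
        Wz : W z
        Wz = centralizer⊆W ks (small ks) (H-· k (H-∙ H₁ member)) sz
        s′ , ks′ , z≈s′ = W⇒klein Wz (proj₂ iz)
        yz : (r₁ ∙ s) ∙ z ≈ z ∙ (r₁ ∙ s)
        yz = T⇒comm (T-· k (r₁ ∙ s))
        zr₁ : z ∙ r₁ ≈ r₁ ∙ z
        zr₁ = ∙-cancelʳ s (z ∙ r₁) (r₁ ∙ z) (begin
          z ∙ r₁ ∙ s     ≈⟨ assoc z r₁ s ⟩
          z ∙ (r₁ ∙ s)   ≈⟨ yz ⟨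
          r₁ ∙ s ∙ z     ≈⟨ assoc r₁ s z ⟩
          r₁ ∙ (s ∙ z)   ≈⟨ ∙-congˡ sz ⟩
          r₁ ∙ (z ∙ s)   ≈⟨ assoc r₁ z s ⟨
          r₁ ∙ z ∙ s     ∎)
        W₁ : W r₁
        W₁ = centralizer⊆W ks′ (small ks′) H₁ (trans (∙-congʳ (sym z≈s′)) (trans zr₁ (∙-congˡ z≈s′)))
    in ¬c₀₁ (W⇒commutes-r₀ W₁)

  torus⁺-self : ∀ {s} → Involution G s → H s → Torus⁺ s s
  torus⁺-self is Hs = proj₂ is , Hs , T-refl _

  size≥1 : ∀ {s} → KleinElement s → 1 ≤ torus⁺-size s
  size≥1 {s} ks = torus⁺-size≥ (s ∷ []) (torus⁺-self involution member ∷ []) ([] ∷ [])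
    where open KleinElement ks

  u-torus : Torus⁺ x u
  u-torus = u≉ε , Hu , Txu

  u²-torus : Torus⁺ x (u ∙ u)
  u²-torus = u²≉ε , H-∙ Hu Hu , T-∙ Txu Txu

  x≉xy : ∀ {x y} → ¬ (y ≈ ε) → ¬ (x ≈ x ∙ y)
  x≉xy {x} {y} ne e = ne (∙-cancelˡ x y ε (trans (sym e) (sym (identityʳ x))))

  x≉yx : ∀ {x y} → ¬ (y ≈ ε) → ¬ (x ≈ y ∙ x)
  x≉yx {x} {y} ne e = ne (∙-cancelʳ x y ε (trans (sym e) (sym (identityˡ x))))

  -- If u³ ≠ 1, then 1, u, u², u³ give the torus of x order at least 4. By the count no torus of an
  -- involution of W can then contain a third element, contradicting `¬all-small`.
  cube : (u ∙ u) ∙ u ≈ ε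
  cube = decidable-stable (((u ∙ u) ∙ u) ≈? ε) λ u³≉ε → ¬all-small λ {s} ks g (Hg , t) →
    decide ks u³≉ε Hg t (g ≈? ε) (g ≈? s)
    where
    x-size≥3 : ¬ ((u ∙ u) ∙ u ≈ ε) → 3 ≤ torus⁺-size x
    x-size≥3 u³≉ε = torus⁺-size≥ (u ∷ u ∙ u ∷ (u ∙ u) ∙ u ∷ [])
      (u-torus ∷ u²-torus ∷ (u³≉ε , H-∙ (H-∙ Hu Hu) Hu , T-∙ (T-∙ Txu Txu) Txu) ∷ [])
      ((x≉xy u≉ε ∷ x≉yx u²≉ε ∷ []) ∷ (x≉xy u≉ε ∷ []) ∷ [] ∷ [])
    decide : ∀ {s g} → KleinElement s → ¬ ((u ∙ u) ∙ u ≈ ε) → H g → T s g → Dec (g ≈ ε) → Dec (g ≈ s) → g ≈ ε ⊎ g ≈ s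
    decide ks u³≉ε Hg t (yes e) _ = inj₁ e
    decide ks u³≉ε Hg t (no _) (yes e) = inj₂ e
    decide {s} {g} ks u³≉ε Hg t (no g≉ε) (no g≉s) =
      let o , ko , opp = opposite-klein s
      in ⊥-elim (packing ix involution (KleinElement.involution ko)
           (nonconjugate-∉H member) (nonconjugate-∉H (KleinElement.member ko))
           (λ a b e → nonconjugate-opposite opp b a (sym e))
           -- Torus orders at least 4, 4, 2: the tori of x, of s with elements 1, s, g, s g, and of
           -- an involution of W in the other square class. The common denominator is 8, and 3 + 3 +
           -- 2 · 1 reaches it.
           3 3 1 1 1 2 8 ≡-refl ≡-refl ≡-refl (s≤s z≤n) ℕ.≤-refl (x-size≥3 u³≉ε)
           (torus⁺-size≥ (s ∷ g ∷ s ∙ g ∷ [])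
             (torus⁺-self involution member ∷ (g≉ε , Hg , t) ∷
              ((λ e → g≉s (∙≈ε⇒≈ (proj₁ involution) e)) , H-∙ member Hg , T-∙ (T-refl s) t) ∷ [])
             (((λ e → g≉s (sym e)) ∷ x≉xy g≉ε ∷ []) ∷ (x≉yx (proj₂ involution) ∷ []) ∷ [] ∷ []))
           (size≥1 ko))
      where open KleinElement ks

  -- A nonsquare τ has a power z that is an involution, and τ lies in the torus of z. If τ⁴ ≠ 1,
  -- then neither τ nor τ² lies in {1 , z}, and 1, z, τ, zτ, τ², zτ² are six different elements of
  -- that torus.
  fourth-power : ¬ Sq τ → (τ ∙ τ) ∙ (τ ∙ τ) ≈ ε
  fourth-power τ≢ = decidable-stable (((τ ∙ τ) ∙ (τ ∙ τ)) ≈? ε) λ τ⁴≉ε →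
    let k , iz = involution-power τ τ≢ in large τ⁴≉ε (k · τ) iz (H-· k Hτ) (T-sym (T-· k τ))
    where
    Hτ : H τ
    Hτ = H-∙ Hu H₂
    large : ¬ ((τ ∙ τ) ∙ (τ ∙ τ) ≈ ε) → ∀ z → Involution G z → H z → T z τ → ⊥
    large τ⁴≉ε z iz Hz t =
      let o , ko , opp = opposite-klein z
      in packing ix iz (KleinElement.involution ko)
           (nonconjugate-∉H Hz) (nonconjugate-∉H (KleinElement.member ko))
           (λ a b e → nonconjugate-opposite opp b a (sym e))
           -- Torus orders at least 3, 6, 2: the tori of x with elements 1, u, u², of z, and of an
           -- involution of W in the class opposite to z. Here 2 · 2 + 5 + 3 · 1 = 12.
           2 5 1 2 1 3 12 ≡-refl ≡-refl ≡-refl (s≤s z≤n) ℕ.≤-refl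
           (torus⁺-size≥ (u ∷ u ∙ u ∷ []) (u-torus ∷ u²-torus ∷ []) ((x≉xy u≉ε ∷ []) ∷ [] ∷ []))
           (torus⁺-size≥ (z ∷ τ ∷ z ∙ τ ∷ τ² ∷ z ∙ τ² ∷ [])
             (torus⁺-self iz Hz ∷ (τ≉ε , Hτ , t) ∷ ((λ e → τ≉z (∙≈ε⇒≈ z² e)) , H-∙ Hz Hτ , T-∙ (T-refl z) t)
              ∷ (τ²≉ε , H-∙ Hτ Hτ , T-∙ t t) ∷ ((λ e → τ²≉z (∙≈ε⇒≈ z² e)) , H-∙ Hz (H-∙ Hτ Hτ) , T-∙ (T-refl z) (T-∙ t t)) ∷ [])
             ( ((λ e → τ≉z (sym e)) ∷ x≉xy τ≉ε ∷ (λ e → τ²≉z (sym e)) ∷ x≉xy τ²≉ε ∷ [])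
             ∷ (x≉yx (proj₂ iz) ∷ x≉xy τ≉ε ∷ (λ e → τ≉z (∙≈ε⇒≈ z² (sym (∙-cancelʳ τ ε (z ∙ τ) (trans (identityˡ τ) (trans e (sym (assoc z τ τ)))))))) ∷ [])
             ∷ ((λ e → τ≉z (sym (∙-cancelʳ τ z τ e))) ∷ (λ e → x≉xy τ≉ε (∙-cancelˡ z τ τ² e)) ∷ [])
             ∷ (x≉yx (proj₂ iz) ∷ [])
             ∷ [] ∷ []))
           (size≥1 ko)
      where
      τ² = τ ∙ τ
      z² = proj₁ iz
      τ²≉ε : ¬ (τ² ≈ ε)
      τ²≉ε e = τ⁴≉ε (trans (∙-cong e e) (identityˡ ε))
      τ²≉z : ¬ (τ² ≈ z)
      τ²≉z e = τ⁴≉ε (trans (∙-cong e e) z²)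
      τ≉ε : ¬ (τ ≈ ε)
      τ≉ε e = τ²≉ε (trans (∙-cong e e) (identityˡ ε))
      τ≉z : ¬ (τ ≈ z)
      τ≉z e = τ²≉ε (trans (∙-cong e e) z²)

-- Coxeter presentation of the symmetric group

-- Normal forms in the symmetric group on n + 1 points, generated by s₀, …, sₙ₋₁: a position a at the top level
-- stands for the coset representative sₐ sₐ₊₁ ⋯ sₙ₋₁ of ⟨s₀, …, sₙ₋₂⟩ (empty for a = n).
Code : ℕ → Set
Code zero    = ⊤
Code (suc n) = Fin (suc (suc n)) × Code n

-- Left multiplication by a generator acts on the cosets. If the coset is fixed, `just j` records
-- the generator of the smaller group that comes out on the right of the representative; otherwise
-- nothing is left over.
step : ∀ {n} → Fin (suc n) → Fin (suc (suc n)) → Fin (suc (suc n)) × Maybe (Fin n)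
step zero zero                    = suc zero , nothing
step zero (suc zero)              = zero , nothing
step {suc n} zero (suc (suc a))   = suc (suc a) , just zero
step (suc i) zero                 = zero , just i
step {suc n} (suc i) (suc a)      = let a′ , m = step i a in suc a′ , Maybe.map suc m

act : ∀ {n} → Fin n → Code n → Code n
act {suc n} i (a , c) = let a′ , m = step i a in a′ , maybe′ (λ j → act j c) c m

trivialCode : ∀ n → Code n
trivialCode zero    = tt
trivialCode (suc n) = fromℕ (suc n) , trivialCode n

code : ∀ {n} → List (Fin n) → Code n
code []      = trivialCode _
code (i ∷ w) = act i (code w)

encode : ∀ {n} → Code n → Fin (suc n !)
encode {zero}  _       = zero
encode {suc n} (a , c) = combine a (encode c)

encode-injective : ∀ {n} (c d : Code n) → encode c ≡ encode d → c ≡ d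
encode-injective {zero}  _       _       _ = ≡-refl
encode-injective {suc n} (a , c) (b , d) e =
  cong₂ _,_ (Fin.combine-injectiveˡ a (encode c) b (encode d) e)
            (encode-injective c d (Fin.combine-injectiveʳ a (encode c) b (encode d) e))

module Words {c ℓ} (G : Group c ℓ) where
  open Group G renaming (Carrier to |G|)

  evalWord-++ : ∀ {n} (s : Fin n → |G|) v w → evalWord G s (v ++ w) ≈ evalWord G s v ∙ evalWord G s w
  evalWord-++ s []      w = sym (identityˡ _)
  evalWord-++ s (i ∷ v) w = trans (∙-congˡ (evalWord-++ s v w)) (sym (assoc _ _ _))

  evalWord-map : ∀ {m n} (f : Fin m → Fin n) (s : Fin n → |G|) w → evalWord G (s ∘ f) w ≡ evalWord G s (map f w)
  evalWord-map f s []      = ≡-refl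
  evalWord-map f s (i ∷ w) = cong (s (f i) ∙_) (evalWord-map f s w)

  evalWord-reverse : ∀ {n} (s : Fin n → |G|) → (∀ i → s i ∙ s i ≈ ε) → ∀ w → evalWord G s w ∙ evalWord G s (reverse w) ≈ ε
  evalWord-reverse s s² []      = identityˡ ε
  evalWord-reverse s s² (i ∷ w) = begin
    (s i ∙ e) ∙ evalWord G s (reverse (i ∷ w))    ≡⟨ cong (λ v → (s i ∙ e) ∙ evalWord G s v) (List.unfold-reverse i w) ⟩
    (s i ∙ e) ∙ evalWord G s (reverse w ++ [ i ]) ≈⟨ ∙-congˡ (evalWord-++ s (reverse w) [ i ]) ⟩
    (s i ∙ e) ∙ (e′ ∙ (s i ∙ ε))                  ≈⟨ assoc _ _ _ ⟩
    s i ∙ (e ∙ (e′ ∙ (s i ∙ ε)))                  ≈⟨ ∙-congˡ (assoc _ _ _) ⟨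
    s i ∙ (e ∙ e′ ∙ (s i ∙ ε))                    ≈⟨ ∙-congˡ (∙-cong (evalWord-reverse s s² w) (identityʳ _)) ⟩
    s i ∙ (ε ∙ s i)                               ≈⟨ ∙-congˡ (identityˡ _) ⟩
    s i ∙ s i                                     ≈⟨ s² i ⟩
    ε                                             ∎
    where
    open import Relation.Binary.Reasoning.Setoid setoid
    e = evalWord G s w
    e′ = evalWord G s (reverse w)

module Coxeter {c ℓ} (G : Group c ℓ) where
  open Group G renaming (Carrier to |G|)
  open Algebra.Properties.Group G
  open Words G
  open import Relation.Binary.Reasoning.Setoid setoid

  record CoxeterRelations {n} (s : Fin n → |G|) : Set ℓ where
    field
      square  : ∀ i → s i ∙ s i ≈ ε
      commute : ∀ i j → FarApart G i j → s i ∙ s j ≈ s j ∙ s i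
      braid   : ∀ i j → toℕ j ≡ suc (toℕ i) → s i ∙ (s j ∙ s i) ≈ s j ∙ (s i ∙ s j)

    cancel : ∀ i y → s i ∙ (s i ∙ y) ≈ y
    cancel i y = trans (sym (assoc _ _ _)) (trans (∙-congʳ (square i)) (identityˡ y))

  open CoxeterRelations

  upper : ∀ {n} {s : Fin (suc n) → |G|} → CoxeterRelations s → CoxeterRelations (s ∘ suc)
  upper R .square i = R .square (suc i)
  upper R .commute i j far = R .commute (suc i) (suc j) (Sum.map s≤s s≤s far)
  upper R .braid i j e = R .braid (suc i) (suc j) (cong suc e)

  lower : ∀ {n} {s : Fin (suc n) → |G|} → CoxeterRelations s → CoxeterRelations (s ∘ inject₁)
  lower R .square i = R .square (inject₁ i)
  lower R .commute i j far = R .commute (inject₁ i) (inject₁ j)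
    (Sum.map (subst₂ (λ a b → suc (suc b) ≤ a) (≡-sym (Fin.toℕ-inject₁ i)) (≡-sym (Fin.toℕ-inject₁ j)))
             (subst₂ (λ a b → suc (suc a) ≤ b) (≡-sym (Fin.toℕ-inject₁ i)) (≡-sym (Fin.toℕ-inject₁ j))) far)
  lower R .braid i j e = R .braid (inject₁ i) (inject₁ j) (≡-trans (Fin.toℕ-inject₁ j) (≡-trans e (cong suc (≡-sym (Fin.toℕ-inject₁ i)))))

  rep : ∀ {n} (s : Fin n → |G|) → Fin (suc n) → |G|
  rep {zero}  s _       = ε
  rep {suc n} s zero    = s zero ∙ rep (s ∘ suc) zero
  rep {suc n} s (suc a) = rep (s ∘ suc) a

  rep-commutes : ∀ {n} (s : Fin n → |G|) g → (∀ i → g ∙ s i ≈ s i ∙ g) → ∀ a → g ∙ rep s a ≈ rep s a ∙ g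
  rep-commutes {zero}  s g comm a       = trans (identityʳ g) (sym (identityˡ g))
  rep-commutes {suc n} s g comm zero    = begin
    g ∙ (s zero ∙ r)      ≈⟨ assoc _ _ _ ⟨
    g ∙ s zero ∙ r        ≈⟨ ∙-congʳ (comm zero) ⟩
    s zero ∙ g ∙ r        ≈⟨ assoc _ _ _ ⟩
    s zero ∙ (g ∙ r)      ≈⟨ ∙-congˡ (rep-commutes (s ∘ suc) g (comm ∘ suc) zero) ⟩
    s zero ∙ (r ∙ g)      ≈⟨ assoc _ _ _ ⟨
    s zero ∙ r ∙ g        ∎
    where r = rep (s ∘ suc) zero
  rep-commutes {suc n} s g comm (suc a) = rep-commutes (s ∘ suc) g (comm ∘ suc) a

  -- Moving a generator through s₀ s₁ ⋯ lowers its index by one: the braid relation does so at the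
  -- place where the generator meets its neighbour, and it commutes with every other factor.
  rep-braid : ∀ {n} {s : Fin (suc n) → |G|} → CoxeterRelations s → ∀ (i : Fin n) → s (suc i) ∙ rep s zero ≈ rep s zero ∙ s (inject₁ i)
  rep-braid {suc n} {s} R zero = begin
    s₁ ∙ (s₀ ∙ (s₁ ∙ r))     ≈⟨ ∙-congˡ (assoc _ _ _) ⟨
    s₁ ∙ (s₀ ∙ s₁ ∙ r)       ≈⟨ assoc _ _ _ ⟨
    s₁ ∙ (s₀ ∙ s₁) ∙ r       ≈⟨ ∙-congʳ (R .braid zero (suc zero) ≡-refl) ⟨
    s₀ ∙ (s₁ ∙ s₀) ∙ r       ≈⟨ assoc _ _ _ ⟩
    s₀ ∙ (s₁ ∙ s₀ ∙ r)       ≈⟨ ∙-congˡ (assoc _ _ _) ⟩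
    s₀ ∙ (s₁ ∙ (s₀ ∙ r))     ≈⟨ ∙-congˡ (∙-congˡ (rep-commutes (λ i → s (suc (suc i))) s₀ (λ i → R .commute zero (suc (suc i)) (inj₂ (s≤s (s≤s z≤n)))) zero)) ⟩
    s₀ ∙ (s₁ ∙ (r ∙ s₀))     ≈⟨ ∙-congˡ (assoc _ _ _) ⟨
    s₀ ∙ (s₁ ∙ r ∙ s₀)       ≈⟨ assoc _ _ _ ⟨
    s₀ ∙ (s₁ ∙ r) ∙ s₀       ∎
    where
    s₀ = s zero
    s₁ = s (suc zero)
    r = rep (λ i → s (suc (suc i))) zero
  rep-braid {suc n} {s} R (suc i) = begin
    t ∙ (s zero ∙ r)                     ≈⟨ assoc _ _ _ ⟨
    t ∙ s zero ∙ r                       ≈⟨ ∙-congʳ (R .commute (suc (suc i)) zero (inj₁ (s≤s (s≤s z≤n)))) ⟩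
    s zero ∙ t ∙ r                       ≈⟨ assoc _ _ _ ⟩
    s zero ∙ (t ∙ r)                     ≈⟨ ∙-congˡ (rep-braid (upper R) i) ⟩
    s zero ∙ (r ∙ s (suc (inject₁ i)))   ≈⟨ assoc _ _ _ ⟨
    s zero ∙ r ∙ s (suc (inject₁ i))     ∎
    where
    t = s (suc (suc i))
    r = rep (s ∘ suc) zero

  letter : ∀ {n} → (Fin (suc n) → |G|) → Maybe (Fin n) → |G|
  letter s = maybe′ (s ∘ inject₁) ε

  letter-suc : ∀ {n} (s : Fin (suc (suc n)) → |G|) m → letter s (Maybe.map suc m) ≡ letter (s ∘ suc) m
  letter-suc s nothing  = ≡-refl
  letter-suc s (just _) = ≡-refl

  rep-step : ∀ {n} {s : Fin (suc n) → |G|} → CoxeterRelations s → ∀ i a →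
             s i ∙ rep s a ≈ rep s (proj₁ (step i a)) ∙ letter s (proj₂ (step i a))
  rep-step R zero zero       = trans (cancel R zero _) (sym (identityʳ _))
  rep-step R zero (suc zero) = sym (identityʳ _)
  rep-step {suc n} {s} R zero (suc (suc a)) =
    rep-commutes (λ i → s (suc (suc i))) (s zero) (λ i → R .commute zero (suc (suc i)) (inj₂ (s≤s (s≤s z≤n)))) a
  rep-step R (suc i) zero    = rep-braid R i
  rep-step {suc n} {s} R (suc i) (suc a) = trans (rep-step (upper R) i a) (∙-congˡ (reflexive (≡-sym (letter-suc s (proj₂ (step i a))))))

  elem : ∀ {n} → (Fin n → |G|) → Code n → |G|
  elem {zero}  s _       = ε
  elem {suc n} s (a , c) = rep s a ∙ elem (s ∘ inject₁) c

  elem-act : ∀ {n} {s : Fin n → |G|} → CoxeterRelations s → ∀ i c → s i ∙ elem s c ≈ elem s (act i c)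
  elem-act {suc n} {s} R i (a , c) = begin
    s i ∙ (rep s a ∙ y)                       ≈⟨ assoc _ _ _ ⟨
    s i ∙ rep s a ∙ y                         ≈⟨ ∙-congʳ (rep-step R i a) ⟩
    rep s a′ ∙ letter s m ∙ y                 ≈⟨ assoc _ _ _ ⟩
    rep s a′ ∙ (letter s m ∙ y)               ≈⟨ ∙-congˡ (pass m) ⟩
    rep s a′ ∙ elem (s ∘ inject₁) (maybe′ (λ j → act j c) c m) ∎
    where
    a′ = proj₁ (step i a)
    m = proj₂ (step i a)
    y = elem (s ∘ inject₁) c
    pass : ∀ m → letter s m ∙ y ≈ elem (s ∘ inject₁) (maybe′ (λ j → act j c) c m)
    pass nothing  = identityˡ y
    pass (just j) = elem-act (lower R) j c

  rep-last : ∀ {n} (s : Fin n → |G|) → rep s (fromℕ n) ≈ ε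
  rep-last {zero}  s = refl
  rep-last {suc n} s = rep-last (s ∘ suc)

  elem-trivialCode : ∀ {n} (s : Fin n → |G|) → elem s (trivialCode n) ≈ ε
  elem-trivialCode {zero}  s = refl
  elem-trivialCode {suc n} s = trans (∙-cong (rep-last s) (elem-trivialCode (s ∘ inject₁))) (identityˡ ε)

  evalWord≈elem : ∀ {n} {s : Fin n → |G|} → CoxeterRelations s → ∀ w → evalWord G s w ≈ elem s (code w)
  evalWord≈elem {s = s} R []      = sym (elem-trivialCode s)
  evalWord≈elem R (i ∷ w) = trans (∙-congˡ (evalWord≈elem R w)) (elem-act R i (code w))

  -- The part of the intersection property that makes normal forms unique, stated along the chain of
  -- subgroups on which `Code` is built.
  Independent : ∀ {n} → (Fin n → |G|) → Set ℓ
  Independent {zero}  s = Lift ℓ ⊤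
  Independent {suc n} s = (∀ w → ¬ (s (fromℕ n) ≈ evalWord G (s ∘ inject₁) w)) × Independent (s ∘ inject₁)

  rep-split : ∀ {n} (s : Fin (suc n) → |G|) a → a ≡ fromℕ (suc n) ⊎ ∃ λ w → rep s a ≈ evalWord G (s ∘ inject₁) w ∙ s (fromℕ n)
  rep-split {zero} s zero       = inj₂ ([] , trans (identityʳ _) (sym (identityˡ _)))
  rep-split {zero} s (suc zero) = inj₁ ≡-refl
  rep-split {suc n} s zero with rep-split (s ∘ suc) zero
  ... | inj₂ (w , e) = inj₂ (zero ∷ map suc w , trans (∙-congˡ (trans e (∙-congʳ (reflexive (evalWord-map suc (s ∘ inject₁) w))))) (sym (assoc _ _ _)))
  rep-split {suc n} s (suc a) with rep-split (s ∘ suc) a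
  ... | inj₁ e       = inj₁ (cong suc e)
  ... | inj₂ (w , e) = inj₂ (map suc w , trans e (∙-congʳ (reflexive (evalWord-map suc (s ∘ inject₁) w))))

  elem-word : ∀ {n} (s : Fin n → |G|) c → ∃ λ w → elem s c ≈ evalWord G s w
  elem-word {zero}  s _       = [] , refl
  elem-word {suc n} s (a , c) with elem-word (s ∘ inject₁) c | rep-word s a
    where
    rep-word : ∀ {n} (s : Fin n → |G|) a → ∃ λ w → rep s a ≈ evalWord G s w
    rep-word {zero}  s _ = [] , refl
    rep-word {suc n} s zero with rep-word (s ∘ suc) zero
    ... | w , e = zero ∷ map suc w , ∙-congˡ (trans e (reflexive (evalWord-map suc s w)))
    rep-word {suc n} s (suc a) with rep-word (s ∘ suc) a
    ... | w , e = map suc w , trans e (reflexive (evalWord-map suc s w))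
  ... | w , e | v , e′ = v ++ map inject₁ w , trans (∙-cong e′ (trans e (reflexive (evalWord-map inject₁ s w)))) (sym (evalWord-++ s v _))

  -- A nontrivial coset representative ends in the last generator (`rep-split`). Were the product
  -- trivial, that generator could be written as a word in the others.
  elem≈ε⇒trivialCode : ∀ {n} {s : Fin n → |G|} → (∀ i → s i ∙ s i ≈ ε) → Independent s → ∀ c → elem s c ≈ ε → c ≡ trivialCode n
  elem≈ε⇒trivialCode {zero}  s² ind c e = ≡-refl
  elem≈ε⇒trivialCode {suc n} {s} s² (last , ind) (a , c) e with rep-split s a
  ... | inj₁ ≡-refl = cong (fromℕ (suc n) ,_) (elem≈ε⇒trivialCode (s² ∘ inject₁) ind c
                        (trans (sym (identityˡ _)) (trans (∙-congʳ (sym (rep-last s))) e)))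
  ... | inj₂ (w , e′) = contradiction (begin
      s (fromℕ n)                      ≈⟨ trans (∙-congʳ (evalWord-inverse w)) (identityˡ _) ⟨
      w⁻ ∙ w⁺ ∙ s (fromℕ n)            ≈⟨ assoc _ _ _ ⟩
      w⁻ ∙ (w⁺ ∙ s (fromℕ n))          ≈⟨ ∙-congˡ (trans (sym e′) (trans (inverseˡ-unique _ _ e) (⁻¹-cong (proj₂ (elem-word _ c))))) ⟩
      w⁻ ∙ (evalWord G _ v) ⁻¹         ≈⟨ ∙-congˡ (sym (inverseʳ-unique _ _ (evalWord-reverse _ (s² ∘ inject₁) v))) ⟩
      w⁻ ∙ evalWord G _ (reverse v)    ≈⟨ evalWord-++ _ (reverse w) (reverse v) ⟨
      evalWord G _ (reverse w ++ reverse v) ∎) (last (reverse w ++ reverse v))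
    where
    v = proj₁ (elem-word (s ∘ inject₁) c)
    w⁺ = evalWord G (s ∘ inject₁) w
    w⁻ = evalWord G (s ∘ inject₁) (reverse w)
    evalWord-inverse : ∀ w → evalWord G (s ∘ inject₁) (reverse w) ∙ evalWord G (s ∘ inject₁) w ≈ ε
    evalWord-inverse w = trans (∙-congˡ (reflexive (cong (evalWord G (s ∘ inject₁)) (≡-sym (List.reverse-involutive w)))))
                               (evalWord-reverse (s ∘ inject₁) (s² ∘ inject₁) (reverse w))

  module _ {n} {s : Fin n → |G|} (R : CoxeterRelations s) (ind : Independent s) where

    ≈ε⇒trivialCode : ∀ w → evalWord G s w ≈ ε → code w ≡ trivialCode n
    ≈ε⇒trivialCode w e = elem≈ε⇒trivialCode (R .square) ind (code w) (trans (sym (evalWord≈elem R w)) e)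

    trivialCode⇒≈ε : ∀ w → code w ≡ trivialCode n → evalWord G s w ≈ ε
    trivialCode⇒≈ε w e = trans (evalWord≈elem R w) (trans (reflexive (cong (elem s) e)) (elem-trivialCode s))

module Transfer {c ℓ c′ ℓ′} (G : Group c ℓ) (G′ : Group c′ ℓ′) {n}
  {s : Fin n → Group.Carrier G} {s′ : Fin n → Group.Carrier G′}
  (R : Coxeter.CoxeterRelations G s) (R′ : Coxeter.CoxeterRelations G′ s′)
  (ind : Coxeter.Independent G s) (ind′ : Coxeter.Independent G′ s′) where
  private
    module G = Group G
    module G′ = Group G′
  open Algebra.Properties.Group G′ using (inverseˡ-unique)

  -- In either group v and w agree exactly when the code of v followed by the reverse of w is
  -- trivial, and codes are computed without reference to a group.
  transfer : ∀ v w → evalWord G s v G.≈ evalWord G s w → evalWord G′ s′ v G′.≈ evalWord G′ s′ w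
  transfer v w e = begin
    evalWord G′ s′ v                          ≈⟨ inverseˡ-unique _ _ (G′.trans (G′.sym (Words.evalWord-++ G′ s′ v (reverse w)))
                                                   (Coxeter.trivialCode⇒≈ε G′ R′ ind′ (v ++ reverse w) (Coxeter.≈ε⇒trivialCode G R ind (v ++ reverse w) trivial))) ⟩
    (evalWord G′ s′ (reverse w)) G′.⁻¹        ≈⟨ inverseˡ-unique _ _ (Words.evalWord-reverse G′ s′ (Coxeter.CoxeterRelations.square R′) w) ⟨
    evalWord G′ s′ w                          ∎
    where
    open import Relation.Binary.Reasoning.Setoid G′.setoid
    trivial : evalWord G s (v ++ reverse w) G.≈ G.ε
    trivial = G.trans (Words.evalWord-++ G s v (reverse w))
      (G.trans (G.∙-congʳ e) (Words.evalWord-reverse G s (Coxeter.CoxeterRelations.square R) w))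

-- The symmetric group on five points

S₅ : Group 0ℓ 0ℓ
S₅ = record
  { Carrier = Permutation′ 5
  ; _≈_ = λ x y → ∀ p → Inverse.to x p ≡ Inverse.to y p
  -- `∘ₚ` applies its left factor first, whereas `ψ-hom` applies the right factor first.
  ; _∙_ = λ x y → y ∘ₚ x
  ; ε = idₚ
  ; _⁻¹ = flip
  ; isGroup = record
    { isMonoid = record
      { isSemigroup = record
        { isMagma = record
          { isEquivalence = record
            { refl = λ _ → ≡-refl ; sym = λ e p → ≡-sym (e p) ; trans = λ e f p → ≡-trans (e p) (f p) }
          ; ∙-cong = λ {x} {y} {u} {v} e f p → ≡-trans (cong (Inverse.to x) (f p)) (e (Inverse.to v p)) }
        ; assoc = λ _ _ _ _ → ≡-refl }
      ; identity = (λ _ _ → ≡-refl) , (λ _ _ → ≡-refl) }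
    ; inverse = (λ x p → Inverse.strictlyInverseʳ x p) , (λ x p → Inverse.strictlyInverseˡ x p)
    ; ⁻¹-cong = λ {x} {y} e p → ≡-trans (cong (Inverse.from x) (≡-trans (≡-sym (Inverse.strictlyInverseˡ y p)) (≡-sym (e (Inverse.from y p)))))
                                  (Inverse.strictlyInverseʳ x (Inverse.from y p)) } }

adjacent : Fin 4 → Permutation′ 5
adjacent i = transpose (inject₁ i) (suc i)

adjacent-relations : Coxeter.CoxeterRelations S₅ adjacent
adjacent-relations = record
  { square = toWitness {a? = Fin.all? λ i → Fin.all? λ p → _ Fin.≟ _} tt
  ; commute = toWitness {a? = Fin.all? λ i → Fin.all? λ j →
      ((suc (suc (toℕ j)) ≤? toℕ i) ⊎-dec (suc (suc (toℕ i)) ≤? toℕ j)) →-dec Fin.all? λ p → _ Fin.≟ _} tt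
  ; braid = toWitness {a? = Fin.all? λ i → Fin.all? λ j → (toℕ j ℕ.≟ suc (toℕ i)) →-dec Fin.all? λ p → _ Fin.≟ _} tt }

-- The last of the first k + 1 transpositions moves the point k + 1, which all earlier ones fix.
adjacent-independent : Coxeter.Independent S₅ adjacent
adjacent-independent =
    (λ w e → contradiction (≡-trans (e 4F) (fixes 4F (λ { 0F → ≡-refl ; 1F → ≡-refl ; 2F → ≡-refl }) w)) λ ())
  , (λ w e → contradiction (≡-trans (e 3F) (fixes 3F (λ { 0F → ≡-refl ; 1F → ≡-refl }) w)) λ ())
  , (λ w e → contradiction (≡-trans (e 2F) (fixes 2F (λ { 0F → ≡-refl }) w)) λ ())
  , (λ w e → contradiction (≡-trans (e 1F) (fixes 1F (λ ()) w)) λ ())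
  , lift tt
  where
  fixes : ∀ {n} {s : Fin n → Permutation′ 5} p → (∀ i → Inverse.to (s i) p ≡ p) → ∀ w → Inverse.to (evalWord S₅ s w) p ≡ p
  fixes p f []      = ≡-refl
  fixes {s = s} p f (i ∷ w) = ≡-trans (cong (Inverse.to (s i)) (fixes p f w)) (f i)

-- For i < j this is the palindrome sᵢ ⋯ sⱼ₋₁ ⋯ sᵢ, a conjugate of its middle letter; `drop 1`
-- avoids doubling that letter. The filter makes the word symmetric in i and j.
swapWord : Fin 5 → Fin 5 → List (Fin 4)
swapWord i j = between ++ drop 1 (reverse between)
  where between = filter (λ k → ((toℕ i ≤? toℕ k) ×-dec (toℕ k <? toℕ j)) ⊎-dec ((toℕ j ≤? toℕ k) ×-dec (toℕ k <? toℕ i))) (allFin 4)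

swapWord-correct : ∀ i j p → Inverse.to (evalWord S₅ adjacent (swapWord i j)) p ≡ Inverse.to (transpose i j) p
swapWord-correct = toWitness {a? = Fin.all? λ i → Fin.all? λ j → Fin.all? λ p → _ Fin.≟ _} tt

transpositionWord : TranspositionList 5 → List (Fin 4)
transpositionWord []             = []
-- `eval` applies the head of the list first, a word its last letter first.
transpositionWord ((i , j) ∷ xs) = transpositionWord xs ++ swapWord i j

transpositionWord-correct : ∀ xs p → Inverse.to (evalWord S₅ adjacent (transpositionWord xs)) p ≡ Inverse.to (eval xs) p
transpositionWord-correct [] p = ≡-refl
transpositionWord-correct ((i , j) ∷ xs) p = ≡-trans
  (Words.evalWord-++ S₅ adjacent (transpositionWord xs) (swapWord i j) p)
  (≡-trans (transpositionWord-correct xs _) (cong (Inverse.to (eval xs)) (swapWord-correct i j p)))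

permutation-word : ∀ (σ : Permutation′ 5) → ∃ λ w → ∀ p → Inverse.to (evalWord S₅ adjacent w) p ≡ Inverse.to σ p
permutation-word σ = transpositionWord (decompose σ) , λ p → ≡-trans (transpositionWord-correct (decompose σ) p) (eval-decompose σ p)

-- Used for membership in a parabolic subgroup on the finite list of group elements: a decidable
-- goal absorbs the double negation, and the counting may decide membership.
¬¬-all-dec : ∀ {a p} {A : Set a} {P : A → Set p} xs → ¬ ¬ All (λ x → Dec (P x)) xs
¬¬-all-dec []       k = k []
¬¬-all-dec (x ∷ xs) k = ¬¬-all-dec xs λ ps → k (no (λ p → k (yes p ∷ ps)) ∷ ps)

-- Parabolic subgroups of a string C-group

module StringCGroup {c ℓ} (G : Group c ℓ) {n} (ρ : Fin n → Group.Carrier G) (S : IsStringCGroup G n ρ) where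
  open Group G renaming (Carrier to |G|)
  open Algebra.Properties.Group G
  open IsStringCGroup S
  open Words G
  open InvolutionLemmas G

  ρ-involution : ∀ i → Involution G (ρ i)
  ρ-involution i = involution i , nontrivial i

  ρ-commute : ∀ i j → FarApart G i j → ρ i ∙ ρ j ≈ ρ j ∙ ρ i
  ρ-commute i j far = product-square⇒comm (involution i) (involution j) (string i j far)

  word : |G| → List (Fin n)
  word g = proj₁ (generates g)

  word-correct : ∀ g → g ≈ evalWord G ρ (word g)
  word-correct g = proj₂ (proj₂ (generates g))

  -- Otherwise ρ i would be a word in the generators indexed by the empty set ⁅ i ⁆ ∩ J, hence
  -- trivial.
  generator-∉ : ∀ {i J} → i ∉ J → ¬ InSubgroup G ρ J (ρ i)
  generator-∉ {i} {J} i∉J i∈ with intersection ⁅ i ⁆ J (ρ i) ([ i ] , x∈⁅x⁆ i ∷ [] , sym (identityʳ _)) i∈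
  ... | []    , _     , e = nontrivial i e
  ... | j ∷ w , p ∷ _ , _ with x∈p∩q⁻ ⁅ i ⁆ J p
  ...   | j∈i , j∈J = i∉J (subst (_∈ J) (x∈⁅y⁆⇒x≡y i j∈i) j∈J)

  word-∈ : ∀ {m J} (f : Fin m → Fin n) → (∀ i → f i ∈ J) → ∀ w → InSubgroup G ρ J (evalWord G (ρ ∘ f) w)
  word-∈ f f∈ w = map f w , All.map⁺ (All.universal f∈ w) , reflexive (evalWord-map f ρ w)

  module Parabolic (J : Subset n) where
    H : |G| → Set ℓ
    H = InSubgroup G ρ J

    H-resp : ∀ {x y} → x ≈ y → H x → H y
    H-resp e (w , a , p) = w , a , trans (sym e) p

    H-ε : H ε
    H-ε = [] , [] , refl

    H-∙ : ∀ {x y} → H x → H y → H (x ∙ y)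
    H-∙ (v , a , p) (w , b , q) = v ++ w , All.++⁺ a b , trans (∙-cong p q) (sym (evalWord-++ ρ v w))

    H-⁻¹ : ∀ {x} → H x → H (x ⁻¹)
    H-⁻¹ (w , a , p) = reverse w , All-reverse w a , trans (⁻¹-cong p) (sym (inverseʳ-unique _ _ (evalWord-reverse ρ involution w)))
      where
      All-reverse : ∀ w → All (_∈ J) w → All (_∈ J) (reverse w)
      All-reverse []      []      = []
      All-reverse (i ∷ w) (p ∷ a) = subst (All (_∈ J)) (≡-sym (List.unfold-reverse i w)) (All.++⁺ (All-reverse w a) (p ∷ []))

    H-generator : ∀ {i} → i ∈ J → H (ρ i)
    H-generator {i} i∈J = [ i ] , i∈J ∷ [] , sym (identityʳ _)

-- Proof of the theorem

module DihedralLemmas {c ℓ} (G : Group c ℓ) where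
  open Group G renaming (Carrier to |G|)
  open Algebra.Properties.Group G
  open InvolutionLemmas G
  open import Relation.Binary.Reasoning.Setoid setoid

  cube-swap : ∀ {a b} → a ∙ a ≈ ε → b ∙ b ≈ ε → ((a ∙ b) ∙ (a ∙ b)) ∙ (a ∙ b) ≈ ε → ((b ∙ a) ∙ (b ∙ a)) ∙ (b ∙ a) ≈ ε
  cube-swap {a} {b} a² b² e = begin
    ((b ∙ a) ∙ (b ∙ a)) ∙ (b ∙ a)                  ≈⟨ ∙-cong (∙-cong ba ba) ba ⟩
    ((a ∙ b) ⁻¹ ∙ (a ∙ b) ⁻¹) ∙ (a ∙ b) ⁻¹         ≈⟨ ∙-congʳ (⁻¹-anti-homo-∙ _ _) ⟨
    ((a ∙ b) ∙ (a ∙ b)) ⁻¹ ∙ (a ∙ b) ⁻¹            ≈⟨ ⁻¹-anti-homo-∙ _ _ ⟨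
    ((a ∙ b) ∙ ((a ∙ b) ∙ (a ∙ b))) ⁻¹             ≈⟨ ⁻¹-cong (trans (sym (assoc _ _ _)) e) ⟩
    ε ⁻¹                                           ≈⟨ ε⁻¹≈ε ⟩
    ε                                              ∎
    where
    ba : b ∙ a ≈ (a ∙ b) ⁻¹
    ba = sym (trans (⁻¹-anti-homo-∙ a b) (sym (∙-cong (square⇒⁻¹≈ b²) (square⇒⁻¹≈ a²))))

  cube⇒braid : ∀ {a b} → a ∙ a ≈ ε → b ∙ b ≈ ε → ((a ∙ b) ∙ (a ∙ b)) ∙ (a ∙ b) ≈ ε → a ∙ (b ∙ a) ≈ b ∙ (a ∙ b)
  cube⇒braid {a} {b} a² b² e = ∙-cancelʳ bab _ _ (trans product (sym square))
    where
    bab = b ∙ (a ∙ b)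
    product : a ∙ (b ∙ a) ∙ bab ≈ ε
    product = begin
      a ∙ (b ∙ a) ∙ (b ∙ (a ∙ b))        ≈⟨ ∙-congʳ (assoc a b a) ⟨
      a ∙ b ∙ a ∙ (b ∙ (a ∙ b))          ≈⟨ assoc (a ∙ b) a _ ⟩
      a ∙ b ∙ (a ∙ (b ∙ (a ∙ b)))        ≈⟨ ∙-congˡ (assoc a b _) ⟨
      a ∙ b ∙ (a ∙ b ∙ (a ∙ b))          ≈⟨ assoc _ _ _ ⟨
      a ∙ b ∙ (a ∙ b) ∙ (a ∙ b)          ≈⟨ e ⟩
      ε                                  ∎
    square : bab ∙ bab ≈ ε
    square = begin
      b ∙ (a ∙ b) ∙ (b ∙ (a ∙ b))        ≈⟨ assoc b _ _ ⟩
      b ∙ (a ∙ b ∙ (b ∙ (a ∙ b)))        ≈⟨ ∙-congˡ (assoc a b _) ⟩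
      b ∙ (a ∙ (b ∙ (b ∙ (a ∙ b))))      ≈⟨ ∙-congˡ (∙-congˡ (cancel-square b² _)) ⟩
      b ∙ (a ∙ (a ∙ b))                  ≈⟨ ∙-congˡ (cancel-square a² b) ⟩
      b ∙ b                              ≈⟨ b² ⟩
      ε                                  ∎

-- In characteristic 2 commuting elements of PGL₂ have commuting matrices, so commuting is transitive on nontrivial elements.
module EvenCharacteristic {q : ℕ} (F : FiniteField q) {c ℓ} (G : Group c ℓ) (iso : Matrices.IsoPGL₂ F G)
  (2≡0 : MatrixTheory.2# F ≡ FieldTheory.0# F) {m} (ρ : Fin (suc (suc (suc (suc m)))) → Group.Carrier G)
  (S : IsStringCGroup G (suc (suc (suc (suc m)))) ρ) where
  open FieldTheory F
  open MatrixTheory F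
  open Matrices F
  open PGL₂ F G iso
  open IsStringCGroup S
  open StringCGroup G ρ S
  module G = Group G

  commute⇒T : ∀ {g h} → g G.∙ h G.≈ h G.∙ g → T g h
  commute⇒T {g} {h} e = split (commute⇒split e)
    where
    -1≡1 : - 1# ≡ 1#
    -1≡1 = ≡-sym (-≡0⇒≡ (≡-trans (solve 0 (con (ℤ.+ 1) :- :- con (ℤ.+ 1) := con (ℤ.+ 2)) ≡-refl) 2≡0))
    split : Comm (M g) (M h) ⊎ AntiComm (M g) (M h) → T g h
    split (inj₁ t) = t
    split (inj₂ a) = ≡-trans (≡-sym (scale-1 (M g • M h))) (≡-trans (cong (λ k → scale k (M g • M h)) (≡-sym -1≡1)) a)

  T-trans : ∀ {x g y} → ¬ (g G.≈ G.ε) → T g x → T g y → T x y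
  T-trans {x} {g} {y} ne = comm-trans {M x} {M g} {M y} (¬≈ε⇒¬scalar ne)

  T-far : ∀ i j → FarApart G i j → T (ρ i) (ρ j)
  T-far i j far = commute⇒T (ρ-commute i j far)

  T-ρ₀ : ∀ i → T (ρ zero) (ρ i)
  T-ρ₀ zero          = ≡-refl
  -- ρ₀ and ρ₁ both commute with ρ₃, which exists because the rank is at least 4.
  T-ρ₀ (suc zero)    = T-trans (nontrivial (suc (suc (suc zero))))
    (T-far (suc (suc (suc zero))) zero (inj₁ (s≤s (s≤s z≤n)))) (T-far (suc (suc (suc zero))) (suc zero) (inj₁ (s≤s (s≤s (s≤s z≤n)))))
  T-ρ₀ (suc (suc i)) = T-far zero (suc (suc i)) (inj₂ (s≤s (s≤s z≤n)))

  T-all : ∀ g → T (ρ zero) g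
  T-all g = T-resp G.refl (G.sym (word-correct g)) (T-word (word g))
    where
    T-word : ∀ w → T (ρ zero) (evalWord G ρ w)
    T-word []      = T-ε (ρ zero)
    T-word (i ∷ w) = T-∙ (T-ρ₀ i) (T-word w)

  upper-unipotent lower-unipotent : M₂
  upper-unipotent = mat 1# 1# 0# 1#
  lower-unipotent = mat 1# 0# 1# 1#

  opaque
    unfolding _•_

    ¬comm-unipotents : ¬ Comm upper-unipotent lower-unipotent
    ¬comm-unipotents e = 1≢0 (≡-trans (solve 0 (con (ℤ.+ 1) := (con (ℤ.+ 1) :* con (ℤ.+ 1) :+ con (ℤ.+ 1) :* con (ℤ.+ 1)) :- (con (ℤ.+ 1) :* con (ℤ.+ 1) :+ con (ℤ.+ 0) :* con (ℤ.+ 0))) ≡-refl)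
      (≡⇒-≡0 (cong M₂.a e)))

  contradictory : ⊥
  contradictory = ¬comm-unipotents (Comm-resp-∼ (proj₂ g) (proj₂ h) (T-trans (nontrivial zero) (T-all (proj₁ g)) (T-all (proj₁ h))))
    where
    open IsoPGL₂ iso using (φ-surj)
    g = φ-surj (upper-unipotent , λ e → 1≢0 (≡-trans (solve 0 (con (ℤ.+ 1) := con (ℤ.+ 1) :* con (ℤ.+ 1) :+ :- (con (ℤ.+ 1) :* con (ℤ.+ 0))) ≡-refl) e))
    h = φ-surj (lower-unipotent , λ e → 1≢0 (≡-trans (solve 0 (con (ℤ.+ 1) := con (ℤ.+ 1) :* con (ℤ.+ 1) :+ :- (con (ℤ.+ 0) :* con (ℤ.+ 1))) ≡-refl) e))

-- Odd characteristic: rotations and their tori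

module OddRank {c ℓ} (G : Group c ℓ) (TG : TorusGroup G) {n} (ρ : Fin n → Group.Carrier G) (S : IsStringCGroup G n ρ) where
  open Group G renaming (Carrier to |G|)
  open Algebra.Properties.Group G
  open Algebra.Properties.Monoid.Mult monoid using () renaming (_×_ to _·_)
  open TorusGroup TG
  open IsStringCGroup S
  open StringCGroup G ρ S
  open InvolutionLemmas G
  open TorusLemmas G TG

  ¬T-ρ : ∀ {i j} → i ≢ j → ¬ T (ρ i) (ρ j)
  ¬T-ρ {i} {j} i≢j t = distinct i j i≢j (T-involution (ρ-involution i) (ρ-involution j) t)

  T-rotation : ∀ {i j k} → k ≢ i → k ≢ j → FarApart G k i → FarApart G k j → T (ρ k) (ρ i ∙ ρ j)
  T-rotation {i} {j} {k} k≢i k≢j fi fj = T-anti (ρ-commute k i fi) (ρ-commute k j fj) (¬T-ρ k≢i) (¬T-ρ k≢j)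

  rotation-≉ε : ∀ {i j} → i ≢ j → ¬ (ρ i ∙ ρ j ≈ ε)
  rotation-≉ε {i} {j} i≢j e = distinct i j i≢j (sym (∙≈ε⇒≈ (involution i) e))

  all-Sq⇒⊥ : ¬ (∀ i → Sq (ρ i))
  all-Sq⇒⊥ sq = proj₂ ∃¬Sq (Sq-resp (sym (word-correct (proj₁ ∃¬Sq))) (Sq-word (word (proj₁ ∃¬Sq))))
    where
    Sq-word : ∀ w → Sq (evalWord G ρ w)
    Sq-word []      = Sq-resp (identityˡ ε) (Sq-square ε)
    Sq-word (i ∷ w) = Sq-∙ (sq i) (Sq-word w)

  -- The indices are abstract so that both ends of the diagram are covered: (i , j , k , l) is (0 ,
  -- 1 , 2 , 3) or, dually, (3 , 2 , 1 , 0).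
  module Corner (i j k l : Fin n) (J : Subset n) (i∈J : i ∈ J) (j∈J : j ∈ J) (k∈J : k ∈ J) (l∉J : l ∉ J)
           (i≢j : i ≢ j) (i≢k : i ≢ k) (l≢i : l ≢ i) (l≢j : l ≢ j)
           (ik : FarApart G i k) (li : FarApart G l i) (lj : FarApart G l j) where
    open Parabolic J

    with-decidable-H : ∀ {p} {P : Set p} → Dec P → ((∀ g → Dec (H g)) → P) → P
    with-decidable-H P? f = decidable-stable P? λ ¬p → ¬¬-all-dec {P = H} elements λ ds → ¬p (f λ g →
      let h? , e = All.lookupAny ds (complete g) in map′ (H-resp e) (H-resp (sym e)) h?)

    -- ρ l is the only involution of its torus and lies outside H, so ρ i ρ j, lying in this torus, has odd order.
    Sq-rotation : Sq (ρ i ∙ ρ j)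
    Sq-rotation = decidable-stable (Sq? _) λ ¬sq →
      let m , im = involution-power (ρ i ∙ ρ j) ¬sq
          t = T-sym (T-power m (T-sym (T-rotation l≢i l≢j li lj)))
      in generator-∉ l∉J (H-resp (sym (T-involution (ρ-involution l) im t)) (H-power m (H-∙ (H-generator i∈J) (H-generator j∈J))))
      where
      T-power : ∀ {x y} m → T y x → T (m · y) x
      T-power {x} {y} m t = T-sym (by m)
        where by : ∀ m → T x (m · y)
              by zero    = T-ε x
              by (suc m) = T-∙ (T-sym t) (by m)
      H-power : ∀ {y} m → H y → H (m · y)
      H-power zero    Hy = H-ε
      H-power (suc m) Hy = H-∙ Hy (H-power m Hy)

    module _ (odd : ¬ (Sq (ρ i) × Sq (ρ k))) where
      private
        module R (H? : ∀ g → Dec (H g)) = RankThree G TG H H? H-resp H-ε H-∙ H-⁻¹ (ρ i) (ρ j) (ρ k) (ρ l)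
          (ρ-involution i) (ρ-involution j) (ρ-involution k) (ρ-involution l)
          (H-generator i∈J) (H-generator j∈J) (H-generator k∈J) (generator-∉ l∉J)
          (distinct i j i≢j) (distinct i k i≢k) (ρ-commute i k ik) (ρ-commute l i li) (ρ-commute l j lj) odd

      rotation-cube : ((ρ i ∙ ρ j) ∙ (ρ i ∙ ρ j)) ∙ (ρ i ∙ ρ j) ≈ ε
      rotation-cube = with-decidable-H (_ ≈? _) R.cube

      petrie-fourth-power : let τ = ρ i ∙ ρ j ∙ ρ k in ¬ Sq τ → (τ ∙ τ) ∙ (τ ∙ τ) ≈ ε
      petrie-fourth-power ¬sq = with-decidable-H (_ ≈? _) λ H? → R.fourth-power H? ¬sq

-- Rank four in odd characteristic

module RankFour {q : ℕ} (F : FiniteField q) {c ℓ} (G : Group c ℓ) (iso : Matrices.IsoPGL₂ F G)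
  (2≢0 : MatrixTheory.2# F ≢ FieldTheory.0# F) (ρ : Fin 4 → Group.Carrier G) (S : IsStringCGroup G 4 ρ) where
  open FieldTheory F
  open MatrixTheory F
  open OddCharacteristic 2≢0
  open PGL₂ F G iso using (M; M-det; M-∙; torusGroup; ∼M⇒scalar; scalar⇒≈ε; ¬≈ε⇒¬scalar; involution-trace; commute⇒split)
  open Matrices F
  open Group G renaming (Carrier to |G|)
  open IsStringCGroup S
  open StringCGroup G ρ S
  TG : TorusGroup G
  TG = torusGroup 2≢0
  open TorusGroup TG
  open TorusLemmas G TG
  open OddRank G TG ρ S
  open DihedralLemmas G

  Cube : |G| → |G| → Set ℓ
  Cube a b = ((a ∙ b) ∙ (a ∙ b)) ∙ (a ∙ b) ≈ ε

  M-square : ∀ {g A} → M g ∼ A → M (g ∙ g) ∼ (A • A)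
  M-square {g} e = ∼-trans (M-∙ g g) (•-cong-∼ e e)

  cube⇒tr²≡det : ∀ {a b} → ¬ (a ∙ b ≈ ε) → Cube a b → tr (M a • M b) * tr (M a • M b) ≡ det (M a • M b)
  cube⇒tr²≡det {a} {b} ab≉ε e = cube-scalar⇒tr²≡det (M a • M b) (λ s → ab≉ε (scalar⇒≈ε (M-∙ a b) s))
    (∼M⇒scalar (∼-trans (M-∙ _ (a ∙ b)) (•-cong-∼ (M-square (M-∙ a b)) (M-∙ a b))) e)

  tr²≡det⇒cube : ∀ {a b} → tr (M a • M b) * tr (M a • M b) ≡ det (M a • M b) → Cube a b
  tr²≡det⇒cube {a} {b} e = scalar⇒≈ε (∼-trans (M-∙ _ (a ∙ b)) (•-cong-∼ (M-square (M-∙ a b)) (M-∙ a b)))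
    (tr²≡det⇒cube-scalar (M a • M b) e)

  -- Were the matrices to commute, b would be the involution of the torus of a, which is a. So they
  -- anticommute.
  commuting-involutions-tr : ∀ {a b} → Involution G a → Involution G b → ¬ (a ≈ b) → a ∙ b ≈ b ∙ a → tr (M a • M b) ≡ 0#
  commuting-involutions-tr {a} {b} ia ib a≉b e = split (commute⇒split e)
    where
    split : Comm (M a) (M b) ⊎ AntiComm (M a) (M b) → tr (M a • M b) ≡ 0#
    split (inj₁ t) = contradiction (T-involution ia ib t) a≉b
    split (inj₂ t) = *-cancelˡ _ _ 2≢0 (≡-trans (anticomm⇒2tr≡0 (M a) (M b) t) (≡-sym (zeroʳ 2#)))

  characteristic-five : ∀ {r₀ r₁ r₂ r₃} → Involution G r₀ → Involution G r₁ → Involution G r₂ → Involution G r₃ →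
    ¬ (r₀ ≈ r₂) → r₀ ∙ r₂ ≈ r₂ ∙ r₀ → T r₃ (r₀ ∙ r₁) → ¬ (r₀ ∙ r₁ ≈ ε) → ¬ (r₂ ∙ r₃ ≈ ε) → Cube r₀ r₁ → Cube r₂ r₃ →
    (let τ = r₀ ∙ r₁ ∙ r₂ in ¬ Sq τ → (τ ∙ τ) ∙ (τ ∙ τ) ≈ ε) → ¬ Sq (r₀ ∙ r₁ ∙ r₂) → 5# ≡ 0# × Cube r₁ r₂
  characteristic-five {r₀} {r₁} {r₂} {r₃} i₀ i₁ i₂ i₃ r₀≉r₂ c₀₂ t u≉ε v≉ε u³ v³ τ⁴ ¬sq =
    5≡0 A₀ A₁ A₂ A₃ tr₀ tr₁ tr₂ tr₃ d₀ d₁ d₂ d₃ tr₀₂ comm P≢ P³ R³ N≢ N⁴ ,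
    tr²≡det⇒cube (tr₁₂² A₀ A₁ A₂ A₃ tr₀ tr₁ tr₂ tr₃ d₀ d₁ d₂ d₃ tr₀₂ comm P≢ P³ R³ N≢ N⁴)
    where
    A₀ = M r₀
    A₁ = M r₁
    A₂ = M r₂
    A₃ = M r₃
    tr₀ = involution-trace i₀
    tr₁ = involution-trace i₁
    tr₂ = involution-trace i₂
    tr₃ = involution-trace i₃
    d₀ = M-det r₀
    d₁ = M-det r₁
    d₂ = M-det r₂
    d₃ = M-det r₃
    tr₀₂ = commuting-involutions-tr i₀ i₂ r₀≉r₂ c₀₂
    comm : Comm A₃ (A₀ • A₁)
    comm = Comm-resp-∼ ∼-refl (M-∙ r₀ r₁) t
    P≢ : ¬ Scalar (A₀ • A₁)
    P≢ s = u≉ε (scalar⇒≈ε (M-∙ r₀ r₁) s)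
    P³ = cube⇒tr²≡det u≉ε u³
    R³ = cube⇒tr²≡det v≉ε v³
    M-τ : M (r₀ ∙ r₁ ∙ r₂) ∼ ((A₀ • A₁) • A₂)
    M-τ = ∼-trans (M-∙ (r₀ ∙ r₁) r₂) (•-cong-∼ (M-∙ r₀ r₁) ∼-refl)
    N≢ : ¬ Scalar ((A₀ • A₁) • A₂)
    -- A scalar N would make τ trivial, and the identity has square determinant.
    N≢ s = ¬sq (Sq-resp (trans (identityˡ ε) (sym (scalar⇒≈ε M-τ s))) (Sq-square ε))
    N⁴ : Scalar ((((A₀ • A₁) • A₂) • ((A₀ • A₁) • A₂)) • (((A₀ • A₁) • A₂) • ((A₀ • A₁) • A₂)))
    N⁴ = ∼M⇒scalar (M-square (M-square M-τ)) (τ⁴ ¬sq)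

  J₀₁₂ J₁₂₃ : Subset 4
  J₀₁₂ = inside ∷ inside ∷ inside ∷ outside ∷ []
  J₁₂₃ = outside ∷ inside ∷ inside ∷ inside ∷ []

  module First = Corner 0F 1F 2F 3F J₀₁₂ (toWitness {a? = 0F ∈? J₀₁₂} tt) (toWitness {a? = 1F ∈? J₀₁₂} tt) (toWitness {a? = 2F ∈? J₀₁₂} tt)
    (toWitnessFalse {a? = 3F ∈? J₀₁₂} tt) (λ ()) (λ ()) (λ ()) (λ ())
    (inj₂ (s≤s (s≤s z≤n))) (inj₁ (s≤s (s≤s z≤n))) (inj₁ (s≤s (s≤s (s≤s z≤n))))

  module Last = Corner 3F 2F 1F 0F J₁₂₃ (toWitness {a? = 3F ∈? J₁₂₃} tt) (toWitness {a? = 2F ∈? J₁₂₃} tt) (toWitness {a? = 1F ∈? J₁₂₃} tt)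
    (toWitnessFalse {a? = 0F ∈? J₁₂₃} tt) (λ ()) (λ ()) (λ ()) (λ ())
    (inj₁ (s≤s (s≤s (s≤s z≤n)))) (inj₂ (s≤s (s≤s z≤n))) (inj₂ (s≤s (s≤s z≤n)))

  -- ρ₀ρ₁ and ρ₃ρ₂ have square determinant, so ρ₁ shares the class of ρ₀ and ρ₃ that of ρ₂; not all
  -- four generators can be square.
  odd₀₂ : ¬ (Sq (ρ 0F) × Sq (ρ 2F))
  odd₀₂ (s₀ , s₂) = all-Sq⇒⊥ λ where
    0F → s₀
    1F → Sq-cancelˡ s₀ First.Sq-rotation
    2F → s₂
    3F → Sq-cancelʳ s₂ Last.Sq-rotation

  odd₃₁ : ¬ (Sq (ρ 3F) × Sq (ρ 1F))
  odd₃₁ (s₃ , s₁) = all-Sq⇒⊥ λ where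
    0F → Sq-cancelʳ s₁ First.Sq-rotation
    1F → s₁
    2F → Sq-cancelˡ s₃ Last.Sq-rotation
    3F → s₃

  cube₀₁ : Cube (ρ 0F) (ρ 1F)
  cube₀₁ = First.rotation-cube odd₀₂

  cube₃₂ : Cube (ρ 3F) (ρ 2F)
  cube₃₂ = Last.rotation-cube odd₃₁

  -- As ρ₀ρ₁ is square, ρ₀ρ₁ρ₂ has the class of ρ₂. If ρ₂ is square, then ρ₀ and with it ρ₁ are
  -- nonsquare by `odd₀₂`, and the dual product ρ₃ρ₂ρ₁ serves instead.
  five : 5# ≡ 0# × Cube (ρ 1F) (ρ 2F)
  five with Sq? (ρ 2F)
  ... | no ¬s₂ = characteristic-five (ρ-involution 0F) (ρ-involution 1F) (ρ-involution 2F) (ρ-involution 3F)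
          (distinct 0F 2F λ ()) (ρ-commute 0F 2F (inj₂ (s≤s (s≤s z≤n))))
          (T-rotation (λ ()) (λ ()) (inj₁ (s≤s (s≤s z≤n))) (inj₁ (s≤s (s≤s (s≤s z≤n)))))
          (rotation-≉ε λ ()) (rotation-≉ε λ ()) cube₀₁ (cube-swap (involution 3F) (involution 2F) cube₃₂)
          (First.petrie-fourth-power odd₀₂) (λ s → ¬s₂ (Sq-cancelˡ First.Sq-rotation s))
  ... | yes s₂ =
    let e , cube₂₁ = characteristic-five (ρ-involution 3F) (ρ-involution 2F) (ρ-involution 1F) (ρ-involution 0F)
          (distinct 3F 1F λ ()) (ρ-commute 3F 1F (inj₁ (s≤s (s≤s (s≤s z≤n)))))
          (T-rotation (λ ()) (λ ()) (inj₂ (s≤s (s≤s z≤n))) (inj₂ (s≤s (s≤s z≤n))))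
          (rotation-≉ε λ ()) (rotation-≉ε λ ()) cube₃₂ (cube-swap (involution 0F) (involution 1F) cube₀₁)
          (Last.petrie-fourth-power odd₃₁) (λ s → odd₀₂ (Sq-cancelʳ (Sq-cancelˡ Last.Sq-rotation s) First.Sq-rotation , s₂))
    in e , cube-swap (involution 2F) (involution 1F) cube₂₁

  relations : Coxeter.CoxeterRelations G ρ
  relations = record
    { square = involution
    ; commute = ρ-commute
    ; braid = λ where
        0F j e → braid-at (cube⇒braid (involution 0F) (involution 1F) cube₀₁) (Fin.toℕ-injective e)
        1F j e → braid-at (cube⇒braid (involution 1F) (involution 2F) (proj₂ five)) (Fin.toℕ-injective e)
        2F j e → braid-at (cube⇒braid (involution 2F) (involution 3F) (cube-swap (involution 3F) (involution 2F) cube₃₂)) (Fin.toℕ-injective e)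
        3F j e → contradiction (subst (ℕ._< 4) e (Fin.toℕ<n j)) ℕ.1+n≰n }
    where
    braid-at : ∀ {i j k} → ρ i ∙ (ρ k ∙ ρ i) ≈ ρ k ∙ (ρ i ∙ ρ k) → j ≡ k → ρ i ∙ (ρ j ∙ ρ i) ≈ ρ j ∙ (ρ i ∙ ρ j)
    braid-at b ≡-refl = b

  independent : Coxeter.Independent G ρ
  independent = parabolic J₀₁₂ 3F inject₁ (λ { 0F → toWitness {a? = 0F ∈? J₀₁₂} tt ; 1F → toWitness {a? = 1F ∈? J₀₁₂} tt ; 2F → toWitness {a? = 2F ∈? J₀₁₂} tt })
                  (toWitnessFalse {a? = 3F ∈? J₀₁₂} tt)
              , parabolic J₀₁ 2F (inject₁ ∘ inject₁) (λ { 0F → toWitness {a? = 0F ∈? J₀₁} tt ; 1F → toWitness {a? = 1F ∈? J₀₁} tt })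
                  (toWitnessFalse {a? = 2F ∈? J₀₁} tt)
              , parabolic J₀ 1F (inject₁ ∘ inject₁ ∘ inject₁) (λ { 0F → toWitness {a? = 0F ∈? J₀} tt }) (toWitnessFalse {a? = 1F ∈? J₀} tt)
              , parabolic ∅ 0F (inject₁ ∘ inject₁ ∘ inject₁ ∘ inject₁) (λ ()) (toWitnessFalse {a? = 0F ∈? ∅} tt)
              , lift tt
    where
    J₀₁ J₀ ∅ : Subset 4
    ∅ = outside ∷ outside ∷ outside ∷ outside ∷ []
    J₀₁ = inside ∷ inside ∷ outside ∷ outside ∷ []
    J₀ = inside ∷ outside ∷ outside ∷ outside ∷ []
    parabolic : ∀ {m} J i (f : Fin m → Fin 4) → (∀ j → f j ∈ J) → i ∉ J → ∀ w → ¬ (ρ i ≈ evalWord G (ρ ∘ f) w)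
    parabolic J i f f∈J i∉J w e = generator-∉ i∉J (Parabolic.H-resp J (sym e) (word-∈ f f∈J w))

  ρ-code : |G| → Code 4
  ρ-code g = code (word g)

  -- There are 5! codes for four generators, so this bounds the order of G by 120.
  ρ-code-injective : ∀ {g h} → ρ-code g ≡ ρ-code h → g ≈ h
  ρ-code-injective {g} {h} e = begin
    g                               ≈⟨ word-correct g ⟩
    evalWord G ρ (word g)           ≈⟨ Coxeter.evalWord≈elem G relations (word g) ⟩
    Coxeter.elem G ρ (ρ-code g)     ≡⟨ cong (Coxeter.elem G ρ) e ⟩
    Coxeter.elem G ρ (ρ-code h)     ≈⟨ Coxeter.evalWord≈elem G relations (word h) ⟨
    evalWord G ρ (word h)           ≈⟨ word-correct h ⟨
    h                               ∎
    where open import Relation.Binary.Reasoning.Setoid setoid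

  isoSimplex : IsoSimplex G ρ
  isoSimplex = record
    { ψ      = ψ
    ; ψ-cong = λ {x} {y} e → to-S₅ (word x) (word y) (trans (sym (word-correct x)) (trans e (word-correct y)))
    ; ψ-hom  = λ x y p → ≡-trans (to-S₅ (word (x ∙ y)) (word x ++ word y)
                 (trans (sym (word-correct (x ∙ y))) (trans (∙-cong (word-correct x) (word-correct y)) (sym (Words.evalWord-++ G ρ (word x) (word y))))) p)
                 (Words.evalWord-++ S₅ adjacent (word x) (word y) p)
    ; ψ-inj  = λ x y e → trans (word-correct x) (trans (from-S₅ (word x) (word y) e) (sym (word-correct y)))
    ; ψ-surj = λ σ → let w , e = permutation-word σ in evalWord G ρ w , λ p →
                 ≡-trans (to-S₅ (word (evalWord G ρ w)) w (sym (word-correct (evalWord G ρ w))) p) (e p)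
    ; ψ-gens = λ i → to-S₅ (word (ρ i)) [ i ] (trans (sym (word-correct (ρ i))) (sym (identityʳ (ρ i)))) }
    where
    ψ : |G| → Permutation′ 5
    ψ g = evalWord S₅ adjacent (word g)
    to-S₅ = Transfer.transfer G S₅ relations adjacent-relations independent adjacent-independent
    from-S₅ = Transfer.transfer S₅ G adjacent-relations relations adjacent-independent independent

-- In characteristic 5 there are at least 5 scalars, and the q² (q - 1) matrices with upper left entry 1 represent
-- distinct elements of a group of order at most 5!.
module FieldSize {q′ : ℕ} (F : FiniteField (suc q′)) {c ℓ} (G : Group c ℓ) (iso : Matrices.IsoPGL₂ F G)
  (5≡0 : MatrixTheory.5# F ≡ FieldTheory.0# F) (index₁₂₀ : Group.Carrier G → Fin (5 !))
  (index₁₂₀-injective : ∀ {g h} → index₁₂₀ g ≡ index₁₂₀ h → Group._≈_ G g h) where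
  open FieldTheory F
  open MatrixTheory F
  open Matrices F
  open Squares F using (index; index-injective; to-injective)
  open FiniteField F using (enumeration)
  open IsoPGL₂ iso using (φ-surj; φ-cong)

  q : ℕ
  q = suc q′

  5≤q : 5 ≤ q
  5≤q = Fin.injective⇒≤ {f = λ i → index (numeral i)} (λ {i} {j} e → numeral-injective i j (index-injective e))
    where
    numeral : Fin 5 → Carrier
    numeral i = ⟦ ℤ.+ toℕ i ⟧ℤ
    2≡0 3≡0 4≡0 : Set
    2≡0 = 2# ≡ 0#
    3≡0 = 3# ≡ 0#
    4≡0 = 4# ≡ 0#
    2≢0 : ¬ 2≡0
    2≢0 e = 1≢0 (≡-trans (solve 0 (con (ℤ.+ 1) := con (ℤ.+ 5) :- con (ℤ.+ 2) :* con (ℤ.+ 2)) ≡-refl)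
      (≡-trans (cong₂ (λ a b → a - b * 2#) 5≡0 e) (solve 0 (con (ℤ.+ 0) :- con (ℤ.+ 0) :* con (ℤ.+ 2) := con (ℤ.+ 0)) ≡-refl)))
    3≢0 : ¬ 3≡0
    3≢0 e = 2≢0 (≡-trans (solve 0 (con (ℤ.+ 2) := con (ℤ.+ 5) :- con (ℤ.+ 3)) ≡-refl)
      (≡-trans (cong₂ _-_ 5≡0 e) (solve 0 (con (ℤ.+ 0) :- con (ℤ.+ 0) := con (ℤ.+ 0)) ≡-refl)))
    4≢0 : ¬ 4≡0
    4≢0 e = 1≢0 (≡-trans (solve 0 (con (ℤ.+ 1) := con (ℤ.+ 5) :- con (ℤ.+ 4)) ≡-refl)
      (≡-trans (cong₂ _-_ 5≡0 e) (solve 0 (con (ℤ.+ 0) :- con (ℤ.+ 0) := con (ℤ.+ 0)) ≡-refl)))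
    nonzero : ∀ d → suc d ℕ.< 5 → ⟦ ℤ.+ suc d ⟧ℤ ≢ 0#
    nonzero 0 _ = 1≢0
    nonzero 1 _ = 2≢0
    nonzero 2 _ = 3≢0
    nonzero 3 _ = 4≢0
    nonzero (suc (suc (suc (suc _)))) (s≤s (s≤s (s≤s (s≤s (s≤s ())))))
    ⟦⟧-injective : ∀ a b → a ℕ.< 5 → b ℕ.< 5 → ⟦ ℤ.+ a ⟧ℤ ≡ ⟦ ℤ.+ b ⟧ℤ → a ≡ b
    ⟦⟧-injective zero    zero    _  _  _ = ≡-refl
    ⟦⟧-injective zero    (suc b) _  lb e = contradiction (≡-sym e) (nonzero b lb)
    ⟦⟧-injective (suc a) zero    la _  e = contradiction e (nonzero a la)
    ⟦⟧-injective (suc a) (suc b) la lb e = cong suc (⟦⟧-injective a b (ℕ.<⇒≤ la) (ℕ.<⇒≤ lb)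
      (+-cancelˡ 1# _ _ (≡-trans (≡-sym (+-homo (ℤ.+ 1) (ℤ.+ a))) (≡-trans e (+-homo (ℤ.+ 1) (ℤ.+ b))))))
    numeral-injective : ∀ i j → numeral i ≡ numeral j → i ≡ j
    numeral-injective i j e = Fin.toℕ-injective (⟦⟧-injective (toℕ i) (toℕ j) (Fin.toℕ<n i) (Fin.toℕ<n j) e)

  scalar : Fin q → Carrier
  scalar = Inverse.to enumeration

  unit : Fin q′ → Carrier
  unit e = scalar (punchIn (index 0#) e)

  unit≢0 : ∀ e → unit e ≢ 0#
  unit≢0 e p = Fin.punchInᵢ≢i (index 0#) e (≡-trans (≡-sym (Inverse.strictlyInverseʳ enumeration _)) (cong index p))

  -- The lower right entry is chosen so that the determinant is the unit indexed by e.
  affine : Fin q × Fin q × Fin q′ → M₂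
  affine (b , c , e) = mat 1# (scalar b) (scalar c) (scalar b * scalar c + unit e)

  affine-det : ∀ t → det (affine t) ≢ 0#
  affine-det (b , c , e) p = unit≢0 e (≡-trans (solve 3 (λ b c e → e := con (ℤ.+ 1) :* (b :* c :+ e) :+ :- (b :* c)) ≡-refl (scalar b) (scalar c) (unit e)) p)

  affine-injective : ∀ s t → affine s ∼ affine t → s ≡ t
  affine-injective (b , c , e) (b′ , c′ , e′) (k , _ , p) = assemble b≡ c≡ (cong M₂.d A≡)
    where
    k≡1 : k ≡ 1#
    k≡1 = ≡-trans (≡-sym (*-identityʳ k)) (cong M₂.a p)
    A≡ : affine (b , c , e) ≡ affine (b′ , c′ , e′)
    A≡ = ≡-trans (≡-sym (scale-1 _)) (≡-trans (cong (λ l → scale l (affine (b , c , e))) (≡-sym k≡1)) p)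
    b≡ : b ≡ b′
    b≡ = to-injective b b′ (cong M₂.b A≡)
    c≡ : c ≡ c′
    c≡ = to-injective c c′ (cong M₂.c A≡)
    assemble : b ≡ b′ → c ≡ c′ → scalar b * scalar c + unit e ≡ scalar b′ * scalar c′ + unit e′ → (b , c , e) ≡ (b′ , c′ , e′)
    assemble ≡-refl ≡-refl d = cong (λ e → b , c , e) (Fin.punchIn-injective (index 0#) e e′ (to-injective _ _ (+-cancelˡ (scalar b * scalar c) (unit e) (unit e′) d)))

  triple : Fin (q ℕ.* (q ℕ.* q′)) → Fin q × Fin q × Fin q′
  triple i = let b , j = remQuot (q ℕ.* q′) i in b , remQuot q′ j

  triple-injective : ∀ i j → triple i ≡ triple j → i ≡ j
  triple-injective i j e = remQuot-injective (q ℕ.* q′) i j (cong₂ _,_ (cong proj₁ e) (remQuot-injective q′ _ _ (cong proj₂ e)))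
    where
    remQuot-injective : ∀ {n} k (i j : Fin (n ℕ.* k)) → remQuot {n} k i ≡ remQuot k j → i ≡ j
    remQuot-injective {n} k i j e = ≡-trans (≡-sym (Fin.combine-remQuot {n} k i))
      (≡-trans (cong (λ (a , b) → combine a b) e) (Fin.combine-remQuot {n} k j))

  q²[q-1]≤120 : q ℕ.* (q ℕ.* q′) ≤ 120
  q²[q-1]≤120 = Fin.injective⇒≤ {f = λ i → index₁₂₀ (element (triple i))} λ {i} {j} e →
    triple-injective i j (affine-injective (triple i) (triple j)
      (∼-trans (∼-sym (proj₂ (φ-surj (affine (triple i) , affine-det (triple i)))))
        (∼-trans (φ-cong (index₁₂₀-injective e)) (proj₂ (φ-surj (affine (triple j) , affine-det (triple j)))))))
    where
    element : Fin q × Fin q × Fin q′ → Group.Carrier G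
    element t = proj₁ (φ-surj (affine t , affine-det t))

  q≤5 : q ≤ 5
  -- q ≥ 6 would give q² (q - 1) ≥ 6 · 6 · 5 = 180.
  q≤5 = ℕ.≮⇒≥ λ { (s≤s 5≤q′) → contradiction
    (ℕ.≤-trans (ℕ.*-mono-≤ (s≤s 5≤q′) (ℕ.*-mono-≤ (s≤s 5≤q′) 5≤q′)) q²[q-1]≤120)
    (toWitnessFalse {a? = 180 ℕ.≤? 120} tt) }

  q≡5 : q ≡ 5
  q≡5 = ℕ.≤-antisym q≤5 5≤q

theorem4p8 : {c ℓ : Level} (q : ℕ) (F : FiniteField q) (G : Group c ℓ)
    (n : ℕ) (ρ : Fin n → Group.Carrier G) →
    n ≥ 4 →
    IsStringCGroup G n ρ →
    Matrices.IsoPGL₂ F G →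
    Σ (n ≡ 4) λ e →
    (q ≡ 5) × IsoSimplex G (subst (λ m → Fin m → Group.Carrier G) e ρ)
theorem4p8 zero F G n ρ n≥4 S iso with () ← Squares.index F (FieldTheory.0# F)
theorem4p8 (suc q′) F G (suc (suc (suc (suc m)))) ρ n≥4 S iso =
  by-characteristic m ρ S (FieldTheory._≟_ F (MatrixTheory.2# F) (FieldTheory.0# F))
  where
  by-characteristic : ∀ m ρ → IsStringCGroup G (suc (suc (suc (suc m)))) ρ → Dec (MatrixTheory.2# F ≡ FieldTheory.0# F) →
    Σ (suc (suc (suc (suc m))) ≡ 4) λ e → (suc q′ ≡ 5) × IsoSimplex G (subst (λ m → Fin m → Group.Carrier G) e ρ)
  by-characteristic m ρ S (yes 2≡0) = ⊥-elim (EvenCharacteristic.contradictory F G iso 2≡0 ρ S)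
  by-characteristic zero ρ S (no 2≢0) = ≡-refl
    , FieldSize.q≡5 F G iso (proj₁ five) (λ g → encode (ρ-code g)) (λ e → ρ-code-injective (encode-injective _ _ e))
    , isoSimplex
    where open RankFour F G iso 2≢0 ρ S
  by-characteristic (suc m) ρ S (no 2≢0) = ⊥-elim (distinct 3F 4F (λ ())
      (T-unique (ρ-involution 3F) (ρ-involution 4F) (rotation-≉ε {0F} {1F} λ ())
        (T-rotation (λ ()) (λ ()) (inj₁ (s≤s (s≤s z≤n))) (inj₁ (s≤s (s≤s (s≤s z≤n)))))
        (T-rotation (λ ()) (λ ()) (inj₁ (s≤s (s≤s z≤n))) (inj₁ (s≤s (s≤s (s≤s z≤n)))))))
    where
    TG : TorusGroup G
    TG = PGL₂.torusGroup F G iso 2≢0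
    open TorusGroup TG using (T-unique)
    open IsStringCGroup S using (distinct)
    open StringCGroup G ρ S using (ρ-involution)
    open OddRank G TG ρ S using (T-rotation; rotation-≉ε)
theorem4p8 (suc _) _ _ (suc (suc (suc zero))) _ (s≤s (s≤s (s≤s ()))) _ _
theorem4p8 (suc _) _ _ (suc (suc zero)) _ (s≤s (s≤s ())) _ _
theorem4p8 (suc _) _ _ (suc zero) _ (s≤s ()) _ _
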